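{- Let $(R_n(x))_{n\ge 1}$ be the alternating runs polynomials (of type $A$), i.e. $R_n(x)=\sum_{k}R(n,k)x^k$ where $R(1,0)=1$, $R(1,k)=0$ for $k\ge 1$ and $R(n,k)=kR(n-1,k)+2R(n-1,k-1)+(n-k)R(n-1,k-2)$; equivalently $R_1(x)=1$, $R_2(x)=2x$ and $$R_{n+2}(x)=x(nx+2)R_{n+1}(x)+x(1-x^2)\,\frac{d}{dx}R_{n+1}(x).$$ Then the Turán expressions $(R_{n+1}(x))^2-R_{n+2}(x)R_n(x)$ are Hurwitz stable for all $n\ge 1$.
   Context: A polynomial $f\in\mathbb{C}[x]$ is Hurwitz stable if it is identically zero or $f(x)\ne0$ whenever $\Re(x)>0$. Combinatorially, $R(n,k)$ is the number of permutations of $\{1,\dots,n\}$ with $k$ alternating runs, i.e. with $k-1$ indices $i\in\{2,\dots,n-1\}$ such that $\pi_{i-1}<\pi_i>\pi_{i+1}$ or $\pi_{i-1}>\pi_i<\pi_{i+1}$ (for $n\ge 2$). -}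

module Defs where

open import Algebra.Bundles.Raw using (RawRing)
open import Data.Integer.Base as ℤ using (ℤ; +_; 0ℤ; 1ℤ)
import Data.Integer.Properties as ℤ
open import Data.List.Base using (List; []; _∷_; foldr; map; upTo)
open import Data.List.Relation.Unary.All using (All)
open import Data.Nat.Base as ℕ using (ℕ; zero; suc; _⊔_; z≤n; s≤s)
import Data.Nat.Properties as ℕ
open import Data.Product.Base using (∃-syntax; _×_; _,_)
open import Data.Rational.Base as ℚ using (ℚ; 0ℚ; 1ℚ; ½; ∣_∣; 1/_)
import Data.Rational.Properties as ℚ
open import Data.Rational.Solver using (module +-*-Solver)
open import Data.Sum.Base using (_⊎_; inj₁; inj₂)
open import Level using (0ℓ)
open import Relation.Binary.PropositionalEquality
  using (_≡_; refl; sym; trans; cong; cong₂; subst)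
open import Relation.Nullary using (¬_)

------------------------------------------------------------------------
-- Real numbers: Cauchy sequences of rationals, with the usual setoid
-- equality in place of a quotient.

record ℝ : Set where
  constructor mkℝ
  field
    seq    : ℕ → ℚ
    cauchy : ∀ ε → 0ℚ ℚ.< ε →
             ∃[ N ] (∀ m n → N ℕ.≤ m → N ℕ.≤ n → ∣ seq m ℚ.- seq n ∣ ℚ.< ε)

open ℝ public

infix 4 _≈ᴿ_ _<ᴿ_

_≈ᴿ_ : ℝ → ℝ → Set
x ≈ᴿ y = ∀ ε → 0ℚ ℚ.< ε →
         ∃[ N ] (∀ n → N ℕ.≤ n → ∣ seq x n ℚ.- seq y n ∣ ℚ.< ε)

_<ᴿ_ : ℝ → ℝ → Set
x <ᴿ y = ∃[ ε ] (0ℚ ℚ.< ε × ∃[ N ] (∀ n → N ℕ.≤ n → seq x n ℚ.+ ε ℚ.≤ seq y n))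

fromℚ : ℚ → ℝ
fromℚ q = mkℝ (λ _ → q) λ ε 0<ε → 0 , λ _ _ _ _ →
  subst (ℚ._< ε) (sym (cong ∣_∣ (ℚ.+-inverseʳ q))) 0<ε

0ᴿ 1ᴿ : ℝ
0ᴿ = fromℚ 0ℚ
1ᴿ = fromℚ 1ℚ

open +-*-Solver using (solve; _:=_; _:+_; _:*_; _:-_; :-_)

half-pos : ∀ {ε} → 0ℚ ℚ.< ε → 0ℚ ℚ.< ½ ℚ.* ε
half-pos {ε} 0<ε = subst (ℚ._< ½ ℚ.* ε) (ℚ.*-zeroʳ ½) (ℚ.*-monoʳ-<-pos ½ 0<ε)

half+half : ∀ ε → ½ ℚ.* ε ℚ.+ ½ ℚ.* ε ≡ ε
half+half ε = trans (sym (ℚ.*-distribʳ-+ ε ½ ½)) (ℚ.*-identityˡ ε)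

+-rearrange : ∀ a b c d → (a ℚ.+ b) ℚ.- (c ℚ.+ d) ≡ (a ℚ.- c) ℚ.+ (b ℚ.- d)
+-rearrange = solve 4 (λ a b c d →
  ((a :+ b) :- (c :+ d)) := ((a :- c) :+ (b :- d))) refl

neg-rearrange : ∀ a b → (ℚ.- a) ℚ.- (ℚ.- b) ≡ ℚ.- (a ℚ.- b)
neg-rearrange = solve 2 (λ a b → ((:- a) :- (:- b)) := (:- (a :- b))) refl

*-rearrange : ∀ a b c d →
  a ℚ.* b ℚ.- c ℚ.* d ≡ a ℚ.* (b ℚ.- d) ℚ.+ (a ℚ.- c) ℚ.* d
*-rearrange = solve 4 (λ a b c d →
  (a :* b :- c :* d) := (a :* (b :- d) :+ (a :- c) :* d)) refl

split : ∀ a b → a ≡ (a ℚ.- b) ℚ.+ b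
split = solve 2 (λ a b → a := ((a :- b) :+ b)) refl

divide : ∀ K ε → 0ℚ ℚ.< K → 0ℚ ℚ.< ε → ∃[ δ ] (0ℚ ℚ.< δ × K ℚ.* δ ≡ ε)
divide K ε 0<K 0<ε = 1/ K ℚ.* ε , 0<δ , Kδ≡ε
  where
  instance
    K-pos : ℚ.Positive K
    K-pos = ℚ.positive 0<K
    K-nonZero : ℚ.NonZero K
    K-nonZero = ℚ.pos⇒nonZero K
    1/K-pos : ℚ.Positive (1/ K)
    1/K-pos = ℚ.1/pos⇒pos K
  0<δ : 0ℚ ℚ.< 1/ K ℚ.* ε
  0<δ = subst (ℚ._< 1/ K ℚ.* ε) (ℚ.*-zeroʳ (1/ K)) (ℚ.*-monoʳ-<-pos (1/ K) 0<ε)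
  Kδ≡ε : K ℚ.* (1/ K ℚ.* ε) ≡ ε
  Kδ≡ε = trans (sym (ℚ.*-assoc K (1/ K) ε))
           (trans (cong (ℚ._* ε) (ℚ.*-inverseʳ K)) (ℚ.*-identityˡ ε))

product-bound : ∀ a b {A D} → ∣ a ∣ ℚ.< A → ∣ b ∣ ℚ.< D → 0ℚ ℚ.< A →
                ∣ a ℚ.* b ∣ ℚ.< A ℚ.* D
product-bound a b {A} {D} a<A b<D 0<A = begin-strict
  ∣ a ℚ.* b ∣       ≡⟨ ℚ.∣p*q∣≡∣p∣*∣q∣ a b ⟩
  ∣ a ∣ ℚ.* ∣ b ∣   ≤⟨ ℚ.*-monoʳ-≤-nonNeg ∣ b ∣ {{ℚ.∣-∣-nonNeg b}} (ℚ.<⇒≤ a<A) ⟩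
  A ℚ.* ∣ b ∣       <⟨ ℚ.*-monoʳ-<-pos A {{ℚ.positive 0<A}} b<D ⟩
  A ℚ.* D           ∎
  where open ℚ.≤-Reasoning

products-close : ∀ a b c d B C δ → 0ℚ ℚ.< B → 0ℚ ℚ.< δ →
  ∣ a ∣ ℚ.< B → ∣ d ∣ ℚ.< C → ∣ a ℚ.- c ∣ ℚ.< δ → ∣ b ℚ.- d ∣ ℚ.< δ →
  ∣ a ℚ.* b ℚ.- c ℚ.* d ∣ ℚ.< (B ℚ.+ C) ℚ.* δ
products-close a b c d B C δ 0<B 0<δ a<B d<C ac<δ bd<δ = begin-strict
  ∣ a ℚ.* b ℚ.- c ℚ.* d ∣
    ≡⟨ cong ∣_∣ (*-rearrange a b c d) ⟩
  ∣ a ℚ.* (b ℚ.- d) ℚ.+ (a ℚ.- c) ℚ.* d ∣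
    ≤⟨ ℚ.∣p+q∣≤∣p∣+∣q∣ (a ℚ.* (b ℚ.- d)) ((a ℚ.- c) ℚ.* d) ⟩
  ∣ a ℚ.* (b ℚ.- d) ∣ ℚ.+ ∣ (a ℚ.- c) ℚ.* d ∣
    <⟨ ℚ.+-mono-< (product-bound a (b ℚ.- d) a<B bd<δ 0<B)
                  (product-bound (a ℚ.- c) d ac<δ d<C 0<δ) ⟩
  B ℚ.* δ ℚ.+ δ ℚ.* C
    ≡⟨ cong (B ℚ.* δ ℚ.+_) (ℚ.*-comm δ C) ⟩
  B ℚ.* δ ℚ.+ C ℚ.* δ
    ≡⟨ ℚ.*-distribʳ-+ δ B C ⟨
  (B ℚ.+ C) ℚ.* δ ∎
  where open ℚ.≤-Reasoning

eventually-bounded : ∀ x →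
  ∃[ B ] (0ℚ ℚ.< B × ∃[ N ] (∀ n → N ℕ.≤ n → ∣ seq x n ∣ ℚ.< B))
eventually-bounded x with cauchy x 1ℚ (ℚ.positive⁻¹ 1ℚ)
... | N , close = 1ℚ ℚ.+ ∣ seq x N ∣ , 0<B , N , bound
  where
  open ℚ.≤-Reasoning
  0<B : 0ℚ ℚ.< 1ℚ ℚ.+ ∣ seq x N ∣
  0<B = ℚ.+-mono-<-≤ (ℚ.positive⁻¹ 1ℚ)
          (ℚ.nonNegative⁻¹ ∣ seq x N ∣ {{ℚ.∣-∣-nonNeg (seq x N)}})
  bound : ∀ n → N ℕ.≤ n → ∣ seq x n ∣ ℚ.< 1ℚ ℚ.+ ∣ seq x N ∣
  bound n N≤n = begin-strict
    ∣ seq x n ∣                                 ≡⟨ cong ∣_∣ (split (seq x n) (seq x N)) ⟩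
    ∣ (seq x n ℚ.- seq x N) ℚ.+ seq x N ∣       ≤⟨ ℚ.∣p+q∣≤∣p∣+∣q∣ (seq x n ℚ.- seq x N) (seq x N) ⟩
    ∣ seq x n ℚ.- seq x N ∣ ℚ.+ ∣ seq x N ∣     <⟨ ℚ.+-monoˡ-< ∣ seq x N ∣ (close n N N≤n ℕ.≤-refl) ⟩
    1ℚ ℚ.+ ∣ seq x N ∣                          ∎

infixl 6 _+ᴿ_
infixl 7 _*ᴿ_
infix  8 -ᴿ_

_+ᴿ_ : ℝ → ℝ → ℝ
x +ᴿ y = mkℝ (λ n → seq x n ℚ.+ seq y n) cauchy-+
  where
  cauchy-+ : ∀ ε → 0ℚ ℚ.< ε → ∃[ N ] (∀ m n → N ℕ.≤ m → N ℕ.≤ n →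
             ∣ (seq x m ℚ.+ seq y m) ℚ.- (seq x n ℚ.+ seq y n) ∣ ℚ.< ε)
  cauchy-+ ε 0<ε with cauchy x (½ ℚ.* ε) (half-pos 0<ε) | cauchy y (½ ℚ.* ε) (half-pos 0<ε)
  ... | N₁ , p | N₂ , q = N₁ ⊔ N₂ , λ m n N≤m N≤n → begin-strict
      ∣ (seq x m ℚ.+ seq y m) ℚ.- (seq x n ℚ.+ seq y n) ∣
        ≡⟨ cong ∣_∣ (+-rearrange (seq x m) (seq y m) (seq x n) (seq y n)) ⟩
      ∣ (seq x m ℚ.- seq x n) ℚ.+ (seq y m ℚ.- seq y n) ∣
        ≤⟨ ℚ.∣p+q∣≤∣p∣+∣q∣ (seq x m ℚ.- seq x n) (seq y m ℚ.- seq y n) ⟩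
      ∣ seq x m ℚ.- seq x n ∣ ℚ.+ ∣ seq y m ℚ.- seq y n ∣
        <⟨ ℚ.+-mono-< (p m n (ℕ.m⊔n≤o⇒m≤o N₁ N₂ N≤m) (ℕ.m⊔n≤o⇒m≤o N₁ N₂ N≤n))
                      (q m n (ℕ.m⊔n≤o⇒n≤o N₁ N₂ N≤m) (ℕ.m⊔n≤o⇒n≤o N₁ N₂ N≤n)) ⟩
      ½ ℚ.* ε ℚ.+ ½ ℚ.* ε
        ≡⟨ half+half ε ⟩
      ε ∎
    where open ℚ.≤-Reasoning

-ᴿ_ : ℝ → ℝ
-ᴿ x = mkℝ (λ n → ℚ.- seq x n) cauchy-neg
  where
  cauchy-neg : ∀ ε → 0ℚ ℚ.< ε → ∃[ N ] (∀ m n → N ℕ.≤ m → N ℕ.≤ n →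
               ∣ (ℚ.- seq x m) ℚ.- (ℚ.- seq x n) ∣ ℚ.< ε)
  cauchy-neg ε 0<ε with cauchy x ε 0<ε
  ... | N , p = N , λ m n N≤m N≤n →
    subst (ℚ._< ε)
      (sym (trans (cong ∣_∣ (neg-rearrange (seq x m) (seq x n)))
                  (ℚ.∣-p∣≡∣p∣ (seq x m ℚ.- seq x n))))
      (p m n N≤m N≤n)

_*ᴿ_ : ℝ → ℝ → ℝ
x *ᴿ y = mkℝ (λ n → seq x n ℚ.* seq y n) λ ε 0<ε →
  let B , 0<B , M₁ , x-bounded = eventually-bounded x
      C , 0<C , M₂ , y-bounded = eventually-bounded y
      δ , 0<δ , Kδ≡ε = divide (B ℚ.+ C) ε (ℚ.+-mono-< 0<B 0<C) 0<ε
      N₁ , x-close = cauchy x δ 0<δ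
      N₂ , y-close = cauchy y δ 0<δ
  in (M₁ ⊔ M₂) ⊔ (N₁ ⊔ N₂) , λ m n N≤m N≤n →
     subst (∣ seq x m ℚ.* seq y m ℚ.- seq x n ℚ.* seq y n ∣ ℚ.<_) Kδ≡ε
       (products-close (seq x m) (seq y m) (seq x n) (seq y n) B C δ 0<B 0<δ
         (x-bounded m (⊔₁ M₁ M₂ (⊔₁ (M₁ ⊔ M₂) (N₁ ⊔ N₂) N≤m)))
         (y-bounded n (⊔₂ M₁ M₂ (⊔₁ (M₁ ⊔ M₂) (N₁ ⊔ N₂) N≤n)))
         (x-close m n (⊔₁ N₁ N₂ (⊔₂ (M₁ ⊔ M₂) (N₁ ⊔ N₂) N≤m))
                      (⊔₁ N₁ N₂ (⊔₂ (M₁ ⊔ M₂) (N₁ ⊔ N₂) N≤n)))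
         (y-close m n (⊔₂ N₁ N₂ (⊔₂ (M₁ ⊔ M₂) (N₁ ⊔ N₂) N≤m))
                      (⊔₂ N₁ N₂ (⊔₂ (M₁ ⊔ M₂) (N₁ ⊔ N₂) N≤n))))
  where
  ⊔₁ = ℕ.m⊔n≤o⇒m≤o
  ⊔₂ = ℕ.m⊔n≤o⇒n≤o

------------------------------------------------------------------------
-- Complex numbers

record ℂ : Set where
  constructor _+i_
  field
    re : ℝ
    im : ℝ

open ℂ public

infix 5 _+i_
infix 4 _≈ᶜ_

_≈ᶜ_ : ℂ → ℂ → Set
z ≈ᶜ w = (re z ≈ᴿ re w) × (im z ≈ᴿ im w)

0ᶜ : ℂ
0ᶜ = 0ᴿ +i 0ᴿ

ℂ-rawRing : RawRing 0ℓ 0ℓ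
ℂ-rawRing = record
  { Carrier = ℂ
  ; _≈_     = _≈ᶜ_
  ; _+_     = λ z w → (re z +ᴿ re w) +i (im z +ᴿ im w)
  ; _*_     = λ z w → (re z *ᴿ re w +ᴿ -ᴿ (im z *ᴿ im w))
                   +i (re z *ᴿ im w +ᴿ im z *ᴿ re w)
  ; -_      = λ z → (-ᴿ re z) +i (-ᴿ im z)
  ; 0#      = 0ᶜ
  ; 1#      = 1ᴿ +i 0ᴿ
  }

fromℤ : ℤ → ℂ
fromℤ i = fromℚ (i ℚ./ 1) +i 0ᴿ

------------------------------------------------------------------------
-- Polynomials as coefficient lists, constant term first; trailing zeros
-- are allowed.

module Polynomial {c ℓ} (R : RawRing c ℓ) where
  open RawRing R

  Poly : Set c
  Poly = List Carrier

  infixl 6 _⊕_ _⊖_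
  infixl 7 _⊗_

  _⊕_ : Poly → Poly → Poly
  []      ⊕ q       = q
  (a ∷ p) ⊕ []      = a ∷ p
  (a ∷ p) ⊕ (b ∷ q) = (a + b) ∷ (p ⊕ q)

  _⊖_ : Poly → Poly → Poly
  p ⊖ q = p ⊕ map -_ q

  _⊗_ : Poly → Poly → Poly
  []      ⊗ q = []
  (a ∷ p) ⊗ q = map (a *_) q ⊕ (0# ∷ (p ⊗ q))

  IsZero : Poly → Set _
  IsZero = All (_≈ 0#)

  eval : Poly → Carrier → Carrier
  eval p x = foldr (λ a v → a + x * v) 0# p

module ℤ[x] = Polynomial ℤ.+-*-rawRing
module ℂ[x] = Polynomial ℂ-rawRing

HurwitzStable : ℂ[x].Poly → Set
HurwitzStable f =
  ℂ[x].IsZero f ⊎ (∀ z → 0ᴿ <ᴿ re z → ¬ (ℂ[x].eval f z ≈ᶜ 0ᶜ))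

------------------------------------------------------------------------
-- Alternating runs

-- R(n,k) for n ≥ 1, with R(n,k) = 0 for k < 0; the row n = 0 is a dummy.
R : ℕ → ℕ → ℤ
R zero          _       = 0ℤ
R (suc zero)    zero    = 1ℤ
R (suc zero)    (suc _) = 0ℤ
R (suc (suc m)) zero    = 0ℤ
R (suc (suc m)) (suc zero) =
  + 1 ℤ.* R (suc m) 1 ℤ.+ + 2 ℤ.* R (suc m) 0
R n@(suc (suc m)) k@(suc (suc j)) =
  + k ℤ.* R (suc m) k ℤ.+ + 2 ℤ.* R (suc m) (suc j)
    ℤ.+ (+ n ℤ.- + k) ℤ.* R (suc m) j

R-vanishes-step : ∀ m → (∀ k → suc m ℕ.≤ k → R (suc m) k ≡ 0ℤ) →
                  ∀ j → m ℕ.≤ j → R (suc (suc m)) (suc (suc j)) ≡ 0ℤ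
R-vanishes-step m vanishes j m≤j =
  cong₂ ℤ._+_ (cong₂ ℤ._+_ first second) third
  where
  first : + suc (suc j) ℤ.* R (suc m) (suc (suc j)) ≡ 0ℤ
  first = trans (cong (+ suc (suc j) ℤ.*_) (vanishes _ (s≤s (ℕ.m≤n⇒m≤1+n m≤j))))
                (ℤ.*-zeroʳ (+ suc (suc j)))
  second : + 2 ℤ.* R (suc m) (suc j) ≡ 0ℤ
  second = cong (+ 2 ℤ.*_) (vanishes _ (s≤s m≤j))
  third : (+ suc (suc m) ℤ.- + suc (suc j)) ℤ.* R (suc m) j ≡ 0ℤ
  third with ℕ.m≤n⇒m<n∨m≡n m≤j
  ... | inj₁ m<j  = trans (cong ((+ suc (suc m) ℤ.- + suc (suc j)) ℤ.*_) (vanishes j m<j))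
                          (ℤ.*-zeroʳ (+ suc (suc m) ℤ.- + suc (suc j)))
  ... | inj₂ refl = cong (ℤ._* R (suc m) m) (ℤ.+-inverseʳ (+ suc (suc m)))

R-vanishes : ∀ n k → n ℕ.≤ k → R n k ≡ 0ℤ
R-vanishes zero          _             _               = refl
R-vanishes (suc zero)    (suc _)       _               = refl
R-vanishes (suc (suc m)) (suc (suc j)) (s≤s (s≤s m≤j)) =
  R-vanishes-step m (R-vanishes (suc m)) j m≤j

-- Truncating the sum over k to k < n drops no terms, by R-vanishes.
Rₙ : ℕ → ℤ[x].Poly
Rₙ n = map (R n) (upTo n)

turán : ℕ → ℤ[x].Poly
turán n = (Rₙ (suc n) ⊗ Rₙ (suc n)) ⊖ (Rₙ (suc (suc n)) ⊗ Rₙ n)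
  where open ℤ[x]

toℂ[x] : ℤ[x].Poly → ℂ[x].Poly
toℂ[x] = map fromℤ

{- With η = (z − 1)/(z + 1) the half plane Re z > 0 becomes the unit disc, and expanding 2^m R_{m+1}
in the basis (1 + z)^(m−b) (z − 1)^b with coefficients ρ m b gives polynomials ρ_m(η) with
ρ_{m+1} = (1 + η)((m + 2) ρ_m − 2η ρ_m′). Writing f = ρ_m and F = ρ_{m+1}, the Turán expression is,
up to a nonvanishing factor, (1 + η)(2η(F′f − Ff′) − fF). If F has zeros −τ_j with τ_j ≥ 1 and f/F is
c₀ + Σ c_j/(η + τ_j) up to a positive factor, with all c's nonnegative, then this is
−(1 + η) F² (c₀ + Σ c_j (τ_j − η)/(η + τ_j)²), and each (1 + η)(τ − η)/(η + τ)² has positive real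
part in the disc.

The zeros come from σ(w) = −w^(m+2) ρ_m(−1/w²) on [0 , 1], for which ρ_{m+1} corresponds to
(w² − 1)σ′, so that Rolle's theorem interlaces them. All of this is done over ℚ: instead of the zeros
of F we use rational near-maxima of ∣σ∣ as interpolation nodes. There F is as small as we please
compared with f, while f has the right signs for c_j ≥ 0, so that the lower bound for the Turán
expression survives and is uniform on compact parts of the half plane. -}

module Submission where

open import Defs
open import Algebra.Bundles using (CommutativeRing)
import Algebra.Solver.Ring
import Algebra.Solver.Ring.AlmostCommutativeRing as ACR
open import Algebra.Structures using (IsCommutativeRing)
open import Data.Integer.Base as ℤ using (ℤ; +_; +≤+; +<+)
import Data.Integer.Properties as ℤ
open import Data.List.Base using (List; []; _∷_; map; applyUpTo)
open import Data.Maybe.Base as Maybe using (Maybe)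
open import Data.Nat.Base as ℕ using (ℕ; zero; suc; _∸_; s≤s; z≤n; ⌊_/2⌋)
import Data.Nat.Coprimality as Coprime
import Data.Nat.Properties as ℕ
open import Data.Product.Base using (_×_; _,_; proj₁; proj₂; ∃-syntax; Σ-syntax)
open import Data.Rational.Base as ℚ using (ℚ; 0ℚ; 1ℚ)
import Data.Rational.Properties as ℚ
open import Data.Sum.Base using (_⊎_; inj₁; inj₂)
open import Data.Vec.Base using (Vec; []; _∷_; last)
open import Data.Vec.Relation.Unary.All as All using (All; []; _∷_)
open import Function.Base using (_∘_; id)
open import Level using (0ℓ)
open import Relation.Binary.PropositionalEquality
  using (_≡_; refl; sym; trans; cong; cong₂; subst; _≗_; isEquivalence; module ≡-Reasoning)
open import Relation.Nullary using (¬_; yes; no; contradiction)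
open import Relation.Nullary.Decidable using (dec⇒maybe)

-- A real number is a Cauchy sequence of rationals, so a zero at z says only that the values at
-- Gaussian rational approximations of z tend to 0. Excluding it takes one positive lower bound for
-- all Gaussian rationals in a bounded region with Re z ≥ r. The zeros of F need not be rational,
-- and approximate nodes move whenever their tolerance Λ is tightened, so the constants of the bound
-- must not depend on them. For this reason all majorants are taken at the point 2. With nonnegative
-- weights and τ ≥ 1, the expression of f through the nodes dominates at 2 its own values in the
-- disc, and it equals f(2) whatever the nodes are. Hence Λ can be chosen last. Polynomial
-- identities are proved over every commutative ℚ-algebra with propositional equality. One statement
-- then serves for rational arguments, for ℚ(i) and, through the dual numbers, for derivatives.

-- Commutative ℚ-algebras and their quadratic extensions

record ℚ-Algebra : Set₁ where
  infixl 6 _+_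
  infixl 7 _*_
  infix  8 -_
  field
    Carrier : Set
    _+_ _*_ : Carrier → Carrier → Carrier
    -_      : Carrier → Carrier
    ι       : ℚ → Carrier
    isCommutativeRing : IsCommutativeRing _≡_ _+_ _*_ -_ (ι 0ℚ) (ι 1ℚ)
    ι-+     : ∀ p q → ι (p ℚ.+ q) ≡ ι p + ι q
    ι-*     : ∀ p q → ι (p ℚ.* q) ≡ ι p * ι q
    ι-neg   : ∀ p → ι (ℚ.- p) ≡ - ι p

  infixl 6 _-_
  _-_ : Carrier → Carrier → Carrier
  x - y = x + - y

  commutativeRing : CommutativeRing 0ℓ 0ℓ
  commutativeRing = record { isCommutativeRing = isCommutativeRing }

  open CommutativeRing commutativeRing public
    using (+-identityˡ; +-identityʳ)

  almostCommutativeRing : ACR.AlmostCommutativeRing 0ℓ 0ℓ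
  almostCommutativeRing = ACR.fromCommutativeRing commutativeRing

  ι-morphism : ℚ.+-*-rawRing ACR.-Raw-AlmostCommutative⟶ almostCommutativeRing
  ι-morphism = record
    { ⟦_⟧ = ι ; +-homo = ι-+ ; *-homo = ι-* ; -‿homo = ι-neg
    ; 0-homo = refl ; 1-homo = refl }

  module Solver = Algebra.Solver.Ring ℚ.+-*-rawRing almostCommutativeRing ι-morphism
    (λ p q → Maybe.map (cong ι) (dec⇒maybe (p ℚ.≟ q)))

ℚ-self : ℚ-Algebra
ℚ-self = record
  { isCommutativeRing = ℚ.+-*-isCommutativeRing
  ; ι = λ q → q
  ; ι-+ = λ _ _ → refl ; ι-* = λ _ _ → refl ; ι-neg = λ _ → refl }

module Quadratic (κ : ℚ) (A : ℚ-Algebra) where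
  open ℚ-Algebra A
  open CommutativeRing commutativeRing using (+-assoc; +-comm; -‿inverseˡ; -‿inverseʳ)
  open Solver

  infixl 6 _⊕_
  infixl 7 _⊛_

  _⊕_ _⊛_ : Carrier × Carrier → Carrier × Carrier → Carrier × Carrier
  (a , b) ⊕ (c , d) = a + c , b + d
  (a , b) ⊛ (c , d) = a * c + ι κ * (b * d) , a * d + b * c

  ⊖_ : Carrier × Carrier → Carrier × Carrier
  ⊖ (a , b) = - a , - b

  embed : ℚ → Carrier × Carrier
  embed q = ι q , ι 0ℚ

  abstract
    ⊕-⊛-isCommutativeRing : IsCommutativeRing _≡_ _⊕_ _⊛_ ⊖_ (embed 0ℚ) (embed 1ℚ)
    ⊕-⊛-isCommutativeRing = record
      { isRing = record
        { +-isAbelianGroup = record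
          { isGroup = record
            { isMonoid = record
              { isSemigroup = record
                { isMagma = record { isEquivalence = isEquivalence ; ∙-cong = cong₂ _ }
                ; assoc = λ (a , b) (c , d) (e , f) → cong₂ _,_ (+-assoc a c e) (+-assoc b d f) }
              ; identity = (λ (a , b) → cong₂ _,_ (+-identityˡ a) (+-identityˡ b))
                         , (λ (a , b) → cong₂ _,_ (+-identityʳ a) (+-identityʳ b)) }
            ; inverse = (λ (a , b) → cong₂ _,_ (-‿inverseˡ a) (-‿inverseˡ b))
                      , (λ (a , b) → cong₂ _,_ (-‿inverseʳ a) (-‿inverseʳ b))
            ; ⁻¹-cong = λ { refl → refl } }
          ; comm = λ (a , b) (c , d) → cong₂ _,_ (+-comm a c) (+-comm b d) }
        ; *-cong = cong₂ _
        ; *-assoc = λ (a , b) (c , d) (e , f) → cong₂ _,_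
            (solve 7 (λ k a b c d e f →
              (a :* c :+ k :* (b :* d)) :* e :+ k :* ((a :* d :+ b :* c) :* f)
              := a :* (c :* e :+ k :* (d :* f)) :+ k :* (b :* (c :* f :+ d :* e)))
              refl (ι κ) a b c d e f)
            (solve 7 (λ k a b c d e f →
              (a :* c :+ k :* (b :* d)) :* f :+ (a :* d :+ b :* c) :* e
              := a :* (c :* f :+ d :* e) :+ b :* (c :* e :+ k :* (d :* f)))
              refl (ι κ) a b c d e f)
        ; *-identity =
            (λ (a , b) → cong₂ _,_
              (solve 3 (λ k a b → con 1ℚ :* a :+ k :* (con 0ℚ :* b) := a) refl (ι κ) a b)
              (solve 2 (λ a b → con 1ℚ :* b :+ con 0ℚ :* a := b) refl a b))
          , (λ (a , b) → cong₂ _,_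
              (solve 3 (λ k a b → a :* con 1ℚ :+ k :* (b :* con 0ℚ) := a) refl (ι κ) a b)
              (solve 2 (λ a b → a :* con 0ℚ :+ b :* con 1ℚ := b) refl a b))
        ; distrib =
            (λ (a , b) (c , d) (e , f) → cong₂ _,_
              (solve 7 (λ k a b c d e f →
                a :* (c :+ e) :+ k :* (b :* (d :+ f))
                := a :* c :+ k :* (b :* d) :+ (a :* e :+ k :* (b :* f)))
                refl (ι κ) a b c d e f)
              (solve 6 (λ a b c d e f →
                a :* (d :+ f) :+ b :* (c :+ e) := a :* d :+ b :* c :+ (a :* f :+ b :* e))
                refl a b c d e f))
          , (λ (a , b) (c , d) (e , f) → cong₂ _,_
              (solve 7 (λ k a b c d e f →
                (c :+ e) :* a :+ k :* ((d :+ f) :* b)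
                := c :* a :+ k :* (d :* b) :+ (e :* a :+ k :* (f :* b)))
                refl (ι κ) a b c d e f)
              (solve 6 (λ a b c d e f →
                (c :+ e) :* b :+ (d :+ f) :* a := c :* b :+ d :* a :+ (e :* b :+ f :* a))
                refl a b c d e f)) }
      ; *-comm = λ (a , b) (c , d) → cong₂ _,_
          (solve 5 (λ k a b c d → a :* c :+ k :* (b :* d) := c :* a :+ k :* (d :* b)) refl (ι κ) a b c d)
          (solve 4 (λ a b c d → a :* d :+ b :* c := c :* b :+ d :* a) refl a b c d) }

    embed-+ : ∀ p q → embed (p ℚ.+ q) ≡ embed p ⊕ embed q
    embed-+ p q = cong₂ _,_ (ι-+ p q) (sym (+-identityˡ (ι 0ℚ)))

    embed-* : ∀ p q → embed (p ℚ.* q) ≡ embed p ⊛ embed q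
    embed-* p q = cong₂ _,_
      (trans (ι-* p q)
        (solve 3 (λ k p q → p :* q := p :* q :+ k :* (con 0ℚ :* con 0ℚ)) refl (ι κ) (ι p) (ι q)))
      (solve 2 (λ p q → con 0ℚ := p :* con 0ℚ :+ con 0ℚ :* q) refl (ι p) (ι q))

    embed-neg : ∀ p → embed (ℚ.- p) ≡ ⊖ embed p
    embed-neg p = cong₂ _,_ (ι-neg p) (solve 0 (con 0ℚ := :- con 0ℚ) refl)

-- A[X]/(X² − κ): the dual numbers over A for κ = 0, and ℚ(i) for A = ℚ, κ = −1.
quadratic : ℚ → ℚ-Algebra → ℚ-Algebra
quadratic κ A = record
  { isCommutativeRing = ⊕-⊛-isCommutativeRing
  ; ι = embed ; ι-+ = embed-+ ; ι-* = embed-* ; ι-neg = embed-neg }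
  where open Quadratic κ A

module Q = ℚ-Algebra.Solver ℚ-self

-- Coefficient sequences: evaluation, derivatives, homogenisation

nat : ℕ → ℚ
nat zero    = 0ℚ
nat (suc n) = 1ℚ ℚ.+ nat n

2ℚ : ℚ
2ℚ = 1ℚ ℚ.+ 1ℚ

/1≡mkℚ : ∀ i → i ℚ./ 1 ≡ ℚ.mkℚ i 0 (Coprime.sym (Coprime.1-coprimeTo ℤ.∣ i ∣))
/1≡mkℚ i = ℚ.↥p/↧p≡p (ℚ.mkℚ i 0 (Coprime.sym (Coprime.1-coprimeTo ℤ.∣ i ∣)))

/1-+ : ∀ i j → (i ℤ.+ j) ℚ./ 1 ≡ i ℚ./ 1 ℚ.+ j ℚ./ 1
/1-+ i j rewrite /1≡mkℚ i | /1≡mkℚ j =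
  cong (ℚ._/ 1) (cong₂ ℤ._+_ (sym (ℤ.*-identityʳ i)) (sym (ℤ.*-identityʳ j)))

/1-* : ∀ i j → (i ℤ.* j) ℚ./ 1 ≡ (i ℚ./ 1) ℚ.* (j ℚ./ 1)
/1-* i j rewrite /1≡mkℚ i | /1≡mkℚ j = refl

/1-neg : ∀ i → (ℤ.- i) ℚ./ 1 ≡ ℚ.- (i ℚ./ 1)
/1-neg (+ zero)   = refl
/1-neg (+ suc n)  = refl
/1-neg ℤ.-[1+ n ] = Q.solve 1 (λ x → x Q.:= Q.:- (Q.:- x)) refl ((+ suc n) ℚ./ 1)

/1-nat : ∀ n → (+ n) ℚ./ 1 ≡ nat n
/1-nat zero    = refl
/1-nat (suc n) = trans (/1-+ (+ 1) (+ n)) (cong (1ℚ ℚ.+_) (/1-nat n))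

-- e − 2x d/dx and multiplication by 1 + x and by x, on coefficient sequences.
θ : ℚ → (ℕ → ℚ) → ℕ → ℚ
θ e a k = (e ℚ.- 2ℚ ℚ.* nat k) ℚ.* a k

[1+x] [x] : (ℕ → ℚ) → ℕ → ℚ
[1+x] a zero    = a zero
[1+x] a (suc k) = a (suc k) ℚ.+ a k
[x] a zero    = 0ℚ
[x] a (suc k) = a k

coeffs : (ℕ → ℚ) → ∀ N → Vec ℚ N
coeffs a zero    = []
coeffs a (suc N) = a zero ∷ coeffs (a ∘ suc) N

module Evaluation (A : ℚ-Algebra) where
  open ℚ-Algebra A

  eval : ∀ {N} → Vec ℚ N → Carrier → Carrier
  eval []       x = ι 0ℚ
  eval (a ∷ as) x = ι a + x * eval as x

  horner : (ℕ → ℚ) → ℕ → Carrier → Carrier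
  horner a N x = eval (coeffs a N) x

  power : Carrier → ℕ → Carrier
  power p zero    = ι 1ℚ
  power p (suc n) = p * power p n

  homogeneous : (ℕ → ℚ) → ℕ → Carrier → Carrier → Carrier
  homogeneous a zero    p q = ι (a zero)
  homogeneous a (suc d) p q = ι (a zero) * power p (suc d) + q * homogeneous (a ∘ suc) d p q

module _ (A : ℚ-Algebra) where
  open ℚ-Algebra A
  open Evaluation A
  open Solver
  open ≡-Reasoning
  private
    Dual : ℚ-Algebra
    Dual = quadratic 0ℚ A
    module D = ℚ-Algebra Dual
    module ED = Evaluation Dual

  -- Reading the derivative off the dual numbers means that an identity proved for all algebras is
  -- differentiated by instantiating it at `quadratic 0ℚ A`.
  derivative : ∀ {N} → Vec ℚ N → Carrier → Carrier
  derivative as x = proj₂ (ED.eval as (x , ι 1ℚ))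

  eval-dual : ∀ {N} (as : Vec ℚ N) x → proj₁ (ED.eval as (x , ι 1ℚ)) ≡ eval as x
  eval-dual []       x = refl
  eval-dual (a ∷ as) x rewrite eval-dual as x =
    solve 4 (λ a x v d → a :+ (x :* v :+ con 0ℚ :* (con 1ℚ :* d)) := a :+ x :* v)
      refl (ι a) x (eval as x) (proj₂ (ED.eval as (x , ι 1ℚ)))

  derivative-∷ : ∀ {N} a (as : Vec ℚ N) x →
    derivative (a ∷ as) x ≡ eval as x + x * derivative as x
  derivative-∷ a as x rewrite eval-dual as x =
    solve 3 (λ x v d → con 0ℚ :+ (x :* d :+ con 1ℚ :* v) := v :+ x :* d)
      refl x (eval as x) (derivative as x)

  horner-cong : ∀ {a b} → a ≗ b → ∀ N x → horner a N x ≡ horner b N x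
  horner-cong a≗b zero    x = refl
  horner-cong a≗b (suc N) x =
    cong₂ (λ u v → ι u + x * v) (a≗b zero) (horner-cong (λ k → a≗b (suc k)) N x)

  horner-linear : ∀ p q a b N x →
    horner (λ k → p ℚ.* a k ℚ.+ q ℚ.* b k) N x ≡ ι p * horner a N x + ι q * horner b N x
  horner-linear p q a b zero    x =
    solve 2 (λ p q → con 0ℚ := p :* con 0ℚ :+ q :* con 0ℚ) refl (ι p) (ι q)
  horner-linear p q a b (suc N) x
    rewrite horner-linear p q (a ∘ suc) (b ∘ suc) N x
          | ι-+ (p ℚ.* a 0) (q ℚ.* b 0) | ι-* p (a 0) | ι-* q (b 0) =
    solve 7 (λ p q a b x u v →
      p :* a :+ q :* b :+ x :* (p :* u :+ q :* v) := p :* (a :+ x :* u) :+ q :* (b :+ x :* v))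
      refl (ι p) (ι q) (ι (a 0)) (ι (b 0)) x (horner (a ∘ suc) N x) (horner (b ∘ suc) N x)

  horner-top : ∀ a N x → a N ≡ 0ℚ → horner a (suc N) x ≡ horner a N x
  horner-top a zero    x a≡0 rewrite a≡0 = solve 1 (λ x → con 0ℚ :+ x :* con 0ℚ := con 0ℚ) refl x
  horner-top a (suc N) x a≡0 = cong (λ v → ι (a 0) + x * v) (horner-top (a ∘ suc) N x a≡0)

  horner-[x] : ∀ a N x → horner ([x] a) (suc N) x ≡ x * horner a N x
  horner-[x] a N x = +-identityˡ _

  horner-nat : ∀ a N x → horner (λ k → nat k ℚ.* a k) N x ≡ x * derivative (coeffs a N) x
  horner-nat a zero    x = solve 1 (λ x → con 0ℚ := x :* con 0ℚ) refl x
  horner-nat a (suc N) x = begin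
    ι (0ℚ ℚ.* a 0) + x * horner (λ k → nat (suc k) ℚ.* a (suc k)) N x
      ≡⟨ cong₂ (λ u v → ι u + x * v) (ℚ.*-zeroˡ (a 0)) (trans (horner-cong (λ k →
           ℚ.*-distribʳ-+ (a (suc k)) 1ℚ (nat k)) N x) (trans (horner-cong (λ k →
             cong (1ℚ ℚ.* a (suc k) ℚ.+_) (sym (ℚ.*-identityˡ _))) N x)
           (horner-linear 1ℚ 1ℚ (a ∘ suc) (λ k → nat k ℚ.* a (suc k)) N x))) ⟩
    ι 0ℚ + x * (ι 1ℚ * horner (a ∘ suc) N x + ι 1ℚ * horner (λ k → nat k ℚ.* a (suc k)) N x)
      ≡⟨ cong (λ v → ι 0ℚ + x * (ι 1ℚ * horner (a ∘ suc) N x + ι 1ℚ * v)) (horner-nat (a ∘ suc) N x) ⟩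
    ι 0ℚ + x * (ι 1ℚ * horner (a ∘ suc) N x + ι 1ℚ * (x * derivative (coeffs (a ∘ suc) N) x))
      ≡⟨ solve 3 (λ x v d → con 0ℚ :+ x :* (con 1ℚ :* v :+ con 1ℚ :* (x :* d)) := x :* (v :+ x :* d))
           refl x (horner (a ∘ suc) N x) (derivative (coeffs (a ∘ suc) N) x) ⟩
    x * (horner (a ∘ suc) N x + x * derivative (coeffs (a ∘ suc) N) x)
      ≡⟨ cong (x *_) (derivative-∷ (a 0) (coeffs (a ∘ suc) N) x) ⟨
    x * derivative (coeffs a (suc N)) x ∎

  horner-θ : ∀ e a N x →
    horner (θ e a) N x ≡ ι e * horner a N x - ι 2ℚ * (x * derivative (coeffs a N) x)
  horner-θ e a N x = begin
    horner (θ e a) N x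
      ≡⟨ horner-cong (λ k → Q.solve 3 (λ e n a →
           (e Q.:- Q.con 2ℚ Q.:* n) Q.:* a Q.:= e Q.:* a Q.:+ (Q.:- Q.con 2ℚ) Q.:* (n Q.:* a)) refl e (nat k) (a k)) N x ⟩
    horner (λ k → e ℚ.* a k ℚ.+ ℚ.- 2ℚ ℚ.* (nat k ℚ.* a k)) N x
      ≡⟨ horner-linear e (ℚ.- 2ℚ) a (λ k → nat k ℚ.* a k) N x ⟩
    ι e * horner a N x + ι (ℚ.- 2ℚ) * horner (λ k → nat k ℚ.* a k) N x
      ≡⟨ cong (λ v → ι e * horner a N x + ι (ℚ.- 2ℚ) * v) (horner-nat a N x) ⟩
    ι e * horner a N x + ι (ℚ.- 2ℚ) * (x * derivative (coeffs a N) x)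
      ≡⟨ solve 3 (λ e v d → e :* v :+ con (ℚ.- 2ℚ) :* d := e :* v :- con 2ℚ :* d)
           refl (ι e) (horner a N x) (x * derivative (coeffs a N) x) ⟩
    ι e * horner a N x - ι 2ℚ * (x * derivative (coeffs a N) x) ∎

  horner-[1+x] : ∀ a N x → a N ≡ 0ℚ →
    horner ([1+x] a) (suc N) x ≡ (ι 1ℚ + x) * horner a N x
  horner-[1+x] a N x a≡0 = begin
    horner ([1+x] a) (suc N) x
      ≡⟨ horner-cong pointwise (suc N) x ⟩
    horner (λ k → 1ℚ ℚ.* a k ℚ.+ 1ℚ ℚ.* [x] a k) (suc N) x
      ≡⟨ horner-linear 1ℚ 1ℚ a ([x] a) (suc N) x ⟩
    ι 1ℚ * horner a (suc N) x + ι 1ℚ * horner ([x] a) (suc N) x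
      ≡⟨ cong₂ (λ u v → ι 1ℚ * u + ι 1ℚ * v) (horner-top a N x a≡0) (horner-[x] a N x) ⟩
    ι 1ℚ * horner a N x + ι 1ℚ * (x * horner a N x)
      ≡⟨ solve 2 (λ x v → con 1ℚ :* v :+ con 1ℚ :* (x :* v) := (con 1ℚ :+ x) :* v) refl x (horner a N x) ⟩
    (ι 1ℚ + x) * horner a N x ∎
    where
    pointwise : [1+x] a ≗ (λ k → 1ℚ ℚ.* a k ℚ.+ 1ℚ ℚ.* [x] a k)
    pointwise zero    = sym (trans (cong (ℚ._+ 1ℚ ℚ.* 0ℚ) (ℚ.*-identityˡ (a 0))) (ℚ.+-identityʳ (a 0)))
    pointwise (suc k) = sym (cong₂ ℚ._+_ (ℚ.*-identityˡ (a (suc k))) (ℚ.*-identityˡ (a k)))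

  homogeneous-cong : ∀ {a b} → a ≗ b → ∀ d p q → homogeneous a d p q ≡ homogeneous b d p q
  homogeneous-cong a≗b zero    p q = cong ι (a≗b zero)
  homogeneous-cong a≗b (suc d) p q =
    cong₂ (λ u v → ι u * power p (suc d) + q * v) (a≗b zero) (homogeneous-cong (λ k → a≗b (suc k)) d p q)

  homogeneous-linear : ∀ s t a b d p q →
    homogeneous (λ k → s ℚ.* a k ℚ.+ t ℚ.* b k) d p q
      ≡ ι s * homogeneous a d p q + ι t * homogeneous b d p q
  homogeneous-linear s t a b zero    p q =
    trans (ι-+ _ _) (cong₂ _+_ (ι-* s (a 0)) (ι-* t (b 0)))
  homogeneous-linear s t a b (suc d) p q
    rewrite homogeneous-linear s t (a ∘ suc) (b ∘ suc) d p q
          | ι-+ (s ℚ.* a 0) (t ℚ.* b 0) | ι-* s (a 0) | ι-* t (b 0) =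
    solve 8 (λ s t a b q u v w →
      (s :* a :+ t :* b) :* w :+ q :* (s :* u :+ t :* v) := s :* (a :* w :+ q :* u) :+ t :* (b :* w :+ q :* v))
      refl (ι s) (ι t) (ι (a 0)) (ι (b 0)) q (homogeneous (a ∘ suc) d p q) (homogeneous (b ∘ suc) d p q)
      (power p (suc d))

  -- The right-hand side is `homogeneous a (suc d) p q` unfolded. Raising the degree multiplies
  -- every monomial by `p`, provided that the new slot `suc d` is empty.
  homogeneous-*p : ∀ a d p q → a (suc d) ≡ 0ℚ →
    p * homogeneous a d p q ≡ ι (a 0) * power p (suc d) + q * homogeneous (a ∘ suc) d p q
  homogeneous-*p a zero    p q a≡0 rewrite a≡0 =
    solve 3 (λ p q a → p :* a := a :* (p :* con 1ℚ) :+ q :* con 0ℚ) refl p q (ι (a 0))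
  homogeneous-*p a (suc d) p q a≡0 = begin
    p * (ι (a 0) * power p (suc d) + q * homogeneous (a ∘ suc) d p q)
      ≡⟨ solve 5 (λ p q a w v → p :* (a :* w :+ q :* v) := a :* (p :* w) :+ q :* (p :* v))
           refl p q (ι (a 0)) (power p (suc d)) (homogeneous (a ∘ suc) d p q) ⟩
    ι (a 0) * power p (suc (suc d)) + q * (p * homogeneous (a ∘ suc) d p q)
      ≡⟨ cong (λ v → ι (a 0) * power p (suc (suc d)) + q * v) (homogeneous-*p (a ∘ suc) d p q a≡0) ⟩
    ι (a 0) * power p (suc (suc d)) + q * homogeneous (a ∘ suc) (suc d) p q ∎

  homogeneous-[1+x] : ∀ a d p q → a (suc d) ≡ 0ℚ →
    homogeneous ([1+x] a) (suc d) p q ≡ (p + q) * homogeneous a d p q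
  homogeneous-[1+x] a d p q a≡0 = begin
    w + q * homogeneous ([1+x] a ∘ suc) d p q
      ≡⟨ cong (λ v → w + q * v) (trans
           (homogeneous-cong (λ k → cong₂ ℚ._+_ (sym (ℚ.*-identityˡ (a (suc k)))) (sym (ℚ.*-identityˡ (a k)))) d p q)
           (homogeneous-linear 1ℚ 1ℚ (a ∘ suc) a d p q)) ⟩
    w + q * (ι 1ℚ * homogeneous (a ∘ suc) d p q + ι 1ℚ * homogeneous a d p q)
      ≡⟨ solve 4 (λ q w u v → w :+ q :* (con 1ℚ :* u :+ con 1ℚ :* v) := w :+ q :* u :+ q :* v)
           refl q w (homogeneous (a ∘ suc) d p q) (homogeneous a d p q) ⟩
    w + q * homogeneous (a ∘ suc) d p q + q * homogeneous a d p q
      ≡⟨ cong (_+ q * homogeneous a d p q) (homogeneous-*p a d p q a≡0) ⟨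
    p * homogeneous a d p q + q * homogeneous a d p q
      ≡⟨ solve 3 (λ p q v → p :* v :+ q :* v := (p :+ q) :* v) refl p q (homogeneous a d p q) ⟩
    (p + q) * homogeneous a d p q ∎
    where w = ι (a 0) * power p (suc d)

  power-dual : ∀ p n →
    ED.power (p , ι 1ℚ) (suc n) ≡ (power p (suc n) , ι (nat (suc n)) * power p n)
  power-dual p zero    = cong₂ _,_
    (solve 1 (λ p → p :* con 1ℚ :+ con 0ℚ :* (con 1ℚ :* con 0ℚ) := p :* con 1ℚ) refl p)
    (solve 1 (λ p → p :* con 0ℚ :+ con 1ℚ :* con 1ℚ := con (1ℚ ℚ.+ 0ℚ) :* con 1ℚ) refl p)
  power-dual p (suc n) = trans (cong ((p , ι 1ℚ) D.*_) (power-dual p n)) (cong₂ _,_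
    (solve 3 (λ p w d → p :* w :+ con 0ℚ :* (con 1ℚ :* d) := p :* w)
      refl p (power p (suc n)) (ι (nat (suc n)) * power p n))
    (trans
      (solve 3 (λ p m w → p :* (m :* w) :+ con 1ℚ :* (p :* w) := (con 1ℚ :+ m) :* (p :* w))
        refl p (ι (nat (suc n))) (power p n))
      (cong (_* (p * power p n)) (sym (ι-+ 1ℚ (nat (suc n)))))))

  homogeneous-dual : ∀ a d p q →
    proj₁ (ED.homogeneous a d (p , ι 1ℚ) (q , ι 1ℚ)) ≡ homogeneous a d p q
  homogeneous-dual a zero    p q = refl
  homogeneous-dual a (suc d) p q = trans
    (cong₂ (λ w v → proj₁ (D.ι (a 0) D.* w) + (q * v + ι 0ℚ * (ι 1ℚ * v′)))
      (power-dual p d) (homogeneous-dual (a ∘ suc) d p q))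
    (solve 6 (λ a w w′ q v v′ →
      a :* w :+ con 0ℚ :* (con 0ℚ :* w′) :+ (q :* v :+ con 0ℚ :* (con 1ℚ :* v′)) := a :* w :+ q :* v)
      refl (ι (a 0)) (power p (suc d)) (ι (nat (suc d)) * power p d) q (homogeneous (a ∘ suc) d p q) v′)
    where v′ = proj₂ (ED.homogeneous (a ∘ suc) d (p , ι 1ℚ) (q , ι 1ℚ))

  -- In the coordinates p, q the operator d − 2b on the monomials p^(d−b) q^b is the first-order
  -- operator that generates the alternating runs polynomials.
  homogeneous-θ : ∀ a d p q →
    (p - q) * homogeneous (θ (nat d) a) d p q
      ≡ ι (nat d) * ((p + q) * homogeneous a d p q)
        - ι 2ℚ * (p * (q * proj₂ (ED.homogeneous a d (p , ι 1ℚ) (q , ι 1ℚ))))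
  homogeneous-θ a zero    p q rewrite
      cong (λ v → ι (v ℚ.* a 0)) (ℚ.+-inverseʳ 0ℚ) | ι-* 0ℚ (a 0) =
    solve 3 (λ p q a → (p :- q) :* (con 0ℚ :* a)
      := con 0ℚ :* ((p :+ q) :* a) :- con 2ℚ :* (p :* (q :* con 0ℚ))) refl p q (ι (a 0))
  homogeneous-θ a (suc d) p q = begin
    (p - q) * (ι ((n ℚ.- 2ℚ ℚ.* 0ℚ) ℚ.* a 0) * w + q * homogeneous (θ n a ∘ suc) d p q)
      ≡⟨ cong₂ (λ u v → (p - q) * (u * w + q * v)) (trans (ι-* _ (a 0)) (cong (_* ι (a 0)) (cong ι
           (Q.solve 1 (λ n → n Q.:- Q.con 2ℚ Q.:* Q.con 0ℚ Q.:= n) refl n))))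
           (trans (homogeneous-cong shift d p q)
             (homogeneous-linear 1ℚ (ℚ.- 1ℚ) (θ (nat d) (a ∘ suc)) (a ∘ suc) d p q)) ⟩
    (p - q) * (ι n * ι (a 0) * w + q * (ι 1ℚ * t + ι (ℚ.- 1ℚ) * h))
      ≡⟨ solve 7 (λ p q n a w t h →
           (p :- q) :* (n :* a :* w :+ q :* (con 1ℚ :* t :+ con (ℚ.- 1ℚ) :* h))
           := (p :- q) :* (n :* a :* w :- q :* h) :+ q :* ((p :- q) :* t))
           refl p q (ι n) (ι (a 0)) w t h ⟩
    (p - q) * (ι n * ι (a 0) * w - q * h) + q * ((p - q) * t)
      ≡⟨ cong₂ (λ u v → (p - q) * (u * ι (a 0) * w - q * h) + q * v) (ι-+ 1ℚ (nat d)) (homogeneous-θ (a ∘ suc) d p q) ⟩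
    (p - q) * ((ι 1ℚ + ι (nat d)) * ι (a 0) * w - q * h)
      + q * (ι (nat d) * ((p + q) * h) - ι 2ℚ * (p * (q * h′)))
      ≡⟨ solve 7 (λ p q n a w h h′ →
           (p :- q) :* ((con 1ℚ :+ n) :* a :* (p :* w) :- q :* h)
             :+ q :* (n :* ((p :+ q) :* h) :- con 2ℚ :* (p :* (q :* h′)))
           := (con 1ℚ :+ n) :* ((p :+ q) :* (a :* (p :* w) :+ q :* h))
             :- con 2ℚ :* (p :* (q :* (a :* ((con 1ℚ :+ n) :* w) :+ con 0ℚ :* (p :* w)
                 :+ (q :* h′ :+ con 1ℚ :* h)))))
           refl p q (ι (nat d)) (ι (a 0)) (power p d) h h′ ⟩
    (ι 1ℚ + ι (nat d)) * ((p + q) * homogeneous a (suc d) p q)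
      - ι 2ℚ * (p * (q * (ι (a 0) * ((ι 1ℚ + ι (nat d)) * power p d) + ι 0ℚ * w + (q * h′ + ι 1ℚ * h))))
      ≡⟨ cong₂ (λ u v → u * ((p + q) * homogeneous a (suc d) p q) - ι 2ℚ * (p * (q * v)))
           (sym (ι-+ 1ℚ (nat d))) (sym dual) ⟩
    ι n * ((p + q) * homogeneous a (suc d) p q)
      - ι 2ℚ * (p * (q * proj₂ (ED.homogeneous a (suc d) (p , ι 1ℚ) (q , ι 1ℚ)))) ∎
    where
    n = nat (suc d)
    w = power p (suc d)
    h = homogeneous (a ∘ suc) d p q
    t = homogeneous (θ (nat d) (a ∘ suc)) d p q
    h′ = proj₂ (ED.homogeneous (a ∘ suc) d (p , ι 1ℚ) (q , ι 1ℚ))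
    shift : θ n a ∘ suc ≗ (λ k → 1ℚ ℚ.* θ (nat d) (a ∘ suc) k ℚ.+ ℚ.- 1ℚ ℚ.* a (suc k))
    shift k = Q.solve 3 (λ d k a →
      (Q.con 1ℚ Q.:+ d Q.:- Q.con 2ℚ Q.:* (Q.con 1ℚ Q.:+ k)) Q.:* a
      Q.:= Q.con 1ℚ Q.:* ((d Q.:- Q.con 2ℚ Q.:* k) Q.:* a) Q.:+ Q.con (ℚ.- 1ℚ) Q.:* a) refl (nat d) (nat k) (a (suc k))
    dual : proj₂ (ED.homogeneous a (suc d) (p , ι 1ℚ) (q , ι 1ℚ))
      ≡ ι (a 0) * ((ι 1ℚ + ι (nat d)) * power p d) + ι 0ℚ * w + (q * h′ + ι 1ℚ * h)
    dual = cong₂ (λ u v → u + (q * h′ + ι 1ℚ * v))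
      (trans (cong (λ w → proj₂ (D.ι (a 0) D.* w)) (power-dual p d))
        (cong (λ m → ι (a 0) * (m * power p d) + ι 0ℚ * w) (ι-+ 1ℚ (nat d))))
      (homogeneous-dual (a ∘ suc) d p q)

  homogeneous-horner : ∀ a d p q η → p * η ≡ q →
    homogeneous a d p q ≡ power p d * horner a (suc d) η
  homogeneous-horner a zero    p q η pη≡q =
    solve 2 (λ a η → a := con 1ℚ :* (a :+ η :* con 0ℚ)) refl (ι (a 0)) η
  homogeneous-horner a (suc d) p q η pη≡q
    rewrite homogeneous-horner (a ∘ suc) d p q η pη≡q | sym pη≡q =
    solve 5 (λ p η a w v → a :* (p :* w) :+ p :* η :* (w :* v) := p :* w :* (a :+ η :* v))
      refl p η (ι (a 0)) (power p d) (horner (a ∘ suc) (suc d) η)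

-- The transformed polynomials ρ and their degree

-- ρ m holds the coefficients of 2^m R_{m+1} in the basis (1+z)^(m−b) (z−1)^b.
ρ : ℕ → ℕ → ℚ
ρ zero    zero    = 1ℚ
ρ zero    (suc _) = 0ℚ
ρ (suc m) = [1+x] (θ (nat (2 ℕ.+ m)) (ρ m))

nat-+ : ∀ m n → nat (m ℕ.+ n) ≡ nat m ℚ.+ nat n
nat-+ zero    n = sym (ℚ.+-identityˡ (nat n))
nat-+ (suc m) n = trans (cong (1ℚ ℚ.+_) (nat-+ m n)) (sym (ℚ.+-assoc 1ℚ (nat m) (nat n)))

*-vanishesʳ : ∀ p {q} → q ≡ 0ℚ → p ℚ.* q ≡ 0ℚ
*-vanishesʳ p refl = ℚ.*-zeroʳ p

θ-vanishes : ∀ e a k → a k ≡ 0ℚ → θ e a k ≡ 0ℚ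
θ-vanishes e a k = *-vanishesʳ (e ℚ.- 2ℚ ℚ.* nat k)

θ-vanishes-middle : ∀ a k → θ (nat (k ℕ.+ k)) a k ≡ 0ℚ
θ-vanishes-middle a k = trans (cong (λ n → (n ℚ.- 2ℚ ℚ.* nat k) ℚ.* a k) (nat-+ k k))
  (Q.solve 2 (λ n a → (n Q.:+ n Q.:- Q.con 2ℚ Q.:* n) Q.:* a Q.:= Q.con 0ℚ) refl (nat k) (a k))

-- The degree grows only at every other step: for 2k = m + 2 the factor m + 2 - 2k kills the
-- coefficient that `[1+x]` would otherwise shift up. This boundary case is the difference between
-- the two bounds.
ρ-vanishes : ∀ m k → 2 ℕ.+ m ℕ.< k ℕ.+ k → ρ m k ≡ 0ℚ
θρ-vanishes : ∀ m k → 2 ℕ.+ m ℕ.≤ k ℕ.+ k → θ (nat (2 ℕ.+ m)) (ρ m) k ≡ 0ℚ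
ρ-vanishes zero    (suc k) _ = refl
ρ-vanishes (suc m) (suc k) m<2k = cong₂ ℚ._+_
  (θ-vanishes (nat (2 ℕ.+ m)) (ρ m) (suc k) (ρ-vanishes m (suc k) (ℕ.<-trans (ℕ.n<1+n _) m<2k)))
  (θρ-vanishes m k (ℕ.s≤s⁻¹ (ℕ.s≤s⁻¹ (subst (4 ℕ.+ m ℕ.≤_) (cong suc (ℕ.+-suc k k)) m<2k))))
θρ-vanishes m k m≤2k with ℕ.m≤n⇒m<n∨m≡n m≤2k
... | inj₁ m<2k = θ-vanishes (nat (2 ℕ.+ m)) (ρ m) k (ρ-vanishes m k m<2k)
... | inj₂ m≡2k = subst (λ n → θ (nat n) (ρ m) k ≡ 0ℚ) (sym m≡2k) (θ-vanishes-middle (ρ m) k)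

ρ-degree : ∀ m → ρ m (suc m) ≡ 0ℚ
ρ-degree zero    = refl
ρ-degree (suc m) = ρ-vanishes (suc m) (2 ℕ.+ m)
  (s≤s (s≤s (subst (2 ℕ.+ m ℕ.≤_) (sym (ℕ.+-suc m (suc m))) (s≤s (ℕ.m≤n+m (suc m) m)))))

-- The change of basis for the alternating runs polynomials

Rℚ : ℕ → ℕ → ℚ
Rℚ n k = R n k ℚ./ 1

/1-*+* : ∀ i j k l → (i ℤ.* j ℤ.+ k ℤ.* l) ℚ./ 1 ≡ (i ℚ./ 1) ℚ.* (j ℚ./ 1) ℚ.+ (k ℚ./ 1) ℚ.* (l ℚ./ 1)
/1-*+* i j k l = trans (/1-+ (i ℤ.* j) (k ℤ.* l)) (cong₂ ℚ._+_ (/1-* i j) (/1-* k l))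

-- The three summands are the coefficients of R′, 2R and x(mR - xR′); the shift by two in the last
-- term of the recurrence turns n - k into m - j. The factors 1 match the shape of `horner-linear`.
Rℚ-tail : ∀ m k → Rℚ (2 ℕ.+ m) (suc k) ≡
  1ℚ ℚ.* (1ℚ ℚ.* (nat (suc k) ℚ.* Rℚ (1 ℕ.+ m) (suc k)) ℚ.+ 2ℚ ℚ.* Rℚ (1 ℕ.+ m) k)
    ℚ.+ 1ℚ ℚ.* [x] (λ j → (nat m ℚ.- nat j) ℚ.* Rℚ (1 ℕ.+ m) j) k
Rℚ-tail m zero = begin
  (+ 1 ℤ.* R (suc m) 1 ℤ.+ + 2 ℤ.* R (suc m) 0) ℚ./ 1
    ≡⟨ /1-*+* (+ 1) (R (suc m) 1) (+ 2) (R (suc m) 0) ⟩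
  1ℚ ℚ.* Rℚ (suc m) 1 ℚ.+ 2ℚ ℚ.* Rℚ (suc m) 0
    ≡⟨ Q.solve 2 (λ a b → Q.con 1ℚ Q.:* a Q.:+ Q.con 2ℚ Q.:* b
         Q.:= Q.con 1ℚ Q.:* (Q.con 1ℚ Q.:* (Q.con (nat 1) Q.:* a) Q.:+ Q.con 2ℚ Q.:* b) Q.:+ Q.con 1ℚ Q.:* Q.con 0ℚ)
         refl (Rℚ (suc m) 1) (Rℚ (suc m) 0) ⟩
  1ℚ ℚ.* (1ℚ ℚ.* (nat 1 ℚ.* Rℚ (suc m) 1) ℚ.+ 2ℚ ℚ.* Rℚ (suc m) 0) ℚ.+ 1ℚ ℚ.* 0ℚ ∎
  where open ≡-Reasoning
Rℚ-tail m (suc j) = begin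
  (+ (2 ℕ.+ j) ℤ.* R (suc m) (2 ℕ.+ j) ℤ.+ + 2 ℤ.* R (suc m) (suc j)
    ℤ.+ (+ (2 ℕ.+ m) ℤ.- + (2 ℕ.+ j)) ℤ.* R (suc m) j) ℚ./ 1
    ≡⟨ trans (/1-+ (+ (2 ℕ.+ j) ℤ.* R (suc m) (2 ℕ.+ j) ℤ.+ + 2 ℤ.* R (suc m) (suc j))
                   ((+ (2 ℕ.+ m) ℤ.- + (2 ℕ.+ j)) ℤ.* R (suc m) j)) (cong₂ ℚ._+_
         (/1-*+* (+ (2 ℕ.+ j)) (R (suc m) (2 ℕ.+ j)) (+ 2) (R (suc m) (suc j)))
         (trans (/1-* (+ (2 ℕ.+ m) ℤ.- + (2 ℕ.+ j)) (R (suc m) j))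
           (cong (ℚ._* Rℚ (suc m) j) (trans (/1-+ (+ (2 ℕ.+ m)) (ℤ.- + (2 ℕ.+ j)))
             (cong (+ (2 ℕ.+ m) ℚ./ 1 ℚ.+_) (/1-neg (+ (2 ℕ.+ j)))))))) ⟩
  (+ (2 ℕ.+ j) ℚ./ 1) ℚ.* Rℚ (suc m) (2 ℕ.+ j) ℚ.+ 2ℚ ℚ.* Rℚ (suc m) (suc j)
    ℚ.+ (+ (2 ℕ.+ m) ℚ./ 1 ℚ.- + (2 ℕ.+ j) ℚ./ 1) ℚ.* Rℚ (suc m) j
    ≡⟨ cong₂ (λ x y → x ℚ.* Rℚ (suc m) (2 ℕ.+ j) ℚ.+ 2ℚ ℚ.* Rℚ (suc m) (suc j)
         ℚ.+ (y ℚ.- x) ℚ.* Rℚ (suc m) j) (/1-nat (2 ℕ.+ j)) (/1-nat (2 ℕ.+ m)) ⟩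
  nat (2 ℕ.+ j) ℚ.* Rℚ (suc m) (2 ℕ.+ j) ℚ.+ 2ℚ ℚ.* Rℚ (suc m) (suc j)
    ℚ.+ (nat (2 ℕ.+ m) ℚ.- nat (2 ℕ.+ j)) ℚ.* Rℚ (suc m) j
    ≡⟨ Q.solve 5 (λ j m a b c →
         (Q.con 1ℚ Q.:+ (Q.con 1ℚ Q.:+ j)) Q.:* a Q.:+ Q.con 2ℚ Q.:* b
           Q.:+ ((Q.con 1ℚ Q.:+ (Q.con 1ℚ Q.:+ m)) Q.:- (Q.con 1ℚ Q.:+ (Q.con 1ℚ Q.:+ j))) Q.:* c
         Q.:= Q.con 1ℚ Q.:* (Q.con 1ℚ Q.:* ((Q.con 1ℚ Q.:+ (Q.con 1ℚ Q.:+ j)) Q.:* a) Q.:+ Q.con 2ℚ Q.:* b)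
           Q.:+ Q.con 1ℚ Q.:* ((m Q.:- j) Q.:* c))
         refl (nat j) (nat m) (Rℚ (suc m) (2 ℕ.+ j)) (Rℚ (suc m) (suc j)) (Rℚ (suc m) j) ⟩
  _ ∎
  where open ≡-Reasoning

Rℚ-vanishes : ∀ m → Rℚ (suc m) (suc m) ≡ 0ℚ
Rℚ-vanishes m = cong (ℚ._/ 1) (R-vanishes (suc m) (suc m) ℕ.≤-refl)

module _ (A : ℚ-Algebra) where
  open ℚ-Algebra A
  open Evaluation A
  open Solver
  open ≡-Reasoning

  horner-derivative : ∀ a N z → a (suc N) ≡ 0ℚ →
    horner (λ k → nat (suc k) ℚ.* a (suc k)) (suc N) z ≡ derivative A (coeffs a (suc N)) z
  horner-derivative a N z a≡0 = begin
    horner (λ k → nat (suc k) ℚ.* a (suc k)) (suc N) z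
      ≡⟨ horner-top A (λ k → nat (suc k) ℚ.* a (suc k)) N z
           (*-vanishesʳ (nat (suc N)) a≡0) ⟩
    horner (λ k → nat (suc k) ℚ.* a (suc k)) N z
      ≡⟨ horner-cong A (λ k → Q.solve 2 (λ k a → (Q.con 1ℚ Q.:+ k) Q.:* a
           Q.:= Q.con 1ℚ Q.:* a Q.:+ Q.con 1ℚ Q.:* (k Q.:* a)) refl (nat k) (a (suc k))) N z ⟩
    horner (λ k → 1ℚ ℚ.* a (suc k) ℚ.+ 1ℚ ℚ.* (nat k ℚ.* a (suc k))) N z
      ≡⟨ horner-linear A 1ℚ 1ℚ (a ∘ suc) (λ k → nat k ℚ.* a (suc k)) N z ⟩
    ι 1ℚ * horner (a ∘ suc) N z + ι 1ℚ * horner (λ k → nat k ℚ.* a (suc k)) N z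
      ≡⟨ cong (λ v → ι 1ℚ * horner (a ∘ suc) N z + ι 1ℚ * v) (horner-nat A (a ∘ suc) N z) ⟩
    ι 1ℚ * horner (a ∘ suc) N z + ι 1ℚ * (z * derivative A (coeffs (a ∘ suc) N) z)
      ≡⟨ solve 3 (λ z v d → con 1ℚ :* v :+ con 1ℚ :* (z :* d) := v :+ z :* d) refl
           z (horner (a ∘ suc) N z) (derivative A (coeffs (a ∘ suc) N) z) ⟩
    horner (a ∘ suc) N z + z * derivative A (coeffs (a ∘ suc) N) z
      ≡⟨ derivative-∷ A (a 0) (coeffs (a ∘ suc) N) z ⟨
    derivative A (coeffs a (suc N)) z ∎

  R-recurrence : ∀ m z →
    let h = horner (Rℚ (suc m)) (suc m) z
        d = derivative A (coeffs (Rℚ (suc m)) (suc m)) z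
    in horner (Rℚ (2 ℕ.+ m)) (2 ℕ.+ m) z
         ≡ z * (ι 2ℚ * h + ι (nat m) * (z * h) + (ι 1ℚ - z * z) * d)
  R-recurrence m z = begin
    ι 0ℚ + z * horner (Rℚ (2 ℕ.+ m) ∘ suc) (suc m) z
      ≡⟨ cong (λ v → ι 0ℚ + z * v) (trans (horner-cong A (Rℚ-tail m) (suc m) z)
           (trans (horner-linear A 1ℚ 1ℚ (λ k → 1ℚ ℚ.* u k ℚ.+ 2ℚ ℚ.* a k) ([x] v) (suc m) z)
             (cong (λ w → ι 1ℚ * w + ι 1ℚ * horner ([x] v) (suc m) z)
               (horner-linear A 1ℚ 2ℚ u a (suc m) z)))) ⟩
    ι 0ℚ + z * (ι 1ℚ * (ι 1ℚ * horner u (suc m) z + ι 2ℚ * h) + ι 1ℚ * horner ([x] v) (suc m) z)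
      ≡⟨ cong₂ (λ x y → ι 0ℚ + z * (ι 1ℚ * (ι 1ℚ * x + ι 2ℚ * h) + ι 1ℚ * y))
           (horner-derivative a m z (Rℚ-vanishes m)) lower ⟩
    ι 0ℚ + z * (ι 1ℚ * (ι 1ℚ * d + ι 2ℚ * h)
      + ι 1ℚ * (z * (ι (nat m) * h + ι (ℚ.- 1ℚ) * (z * d))))
      ≡⟨ solve 4 (λ z m h d →
           con 0ℚ :+ z :* (con 1ℚ :* (con 1ℚ :* d :+ con 2ℚ :* h)
             :+ con 1ℚ :* (z :* (m :* h :+ con (ℚ.- 1ℚ) :* (z :* d))))
           := z :* (con 2ℚ :* h :+ m :* (z :* h) :+ (con 1ℚ :- z :* z) :* d)) refl z (ι (nat m)) h d ⟩
    z * (ι 2ℚ * h + ι (nat m) * (z * h) + (ι 1ℚ - z * z) * d) ∎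
    where
    a = Rℚ (suc m)
    h = horner a (suc m) z
    d = derivative A (coeffs a (suc m)) z
    u v : ℕ → ℚ
    u k = nat (suc k) ℚ.* a (suc k)
    v k = (nat m ℚ.- nat k) ℚ.* a k
    lower : horner ([x] v) (suc m) z ≡ z * (ι (nat m) * h + ι (ℚ.- 1ℚ) * (z * d))
    lower = begin
      horner ([x] v) (suc m) z
        ≡⟨ horner-[x] A v m z ⟩
      z * horner v m z
        ≡⟨ cong (z *_) (horner-top A v m z (trans (cong (ℚ._* a m) (ℚ.+-inverseʳ (nat m))) (ℚ.*-zeroˡ (a m)))) ⟨
      z * horner v (suc m) z
        ≡⟨ cong (z *_) (horner-cong A (λ k → Q.solve 3 (λ m k a → (m Q.:- k) Q.:* a
             Q.:= m Q.:* a Q.:+ Q.con (ℚ.- 1ℚ) Q.:* (k Q.:* a)) refl (nat m) (nat k) (a k)) (suc m) z) ⟩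
      z * horner (λ k → nat m ℚ.* a k ℚ.+ ℚ.- 1ℚ ℚ.* (nat k ℚ.* a k)) (suc m) z
        ≡⟨ cong (z *_) (horner-linear A (nat m) (ℚ.- 1ℚ) a (λ k → nat k ℚ.* a k) (suc m) z) ⟩
      z * (ι (nat m) * h + ι (ℚ.- 1ℚ) * horner (λ k → nat k ℚ.* a k) (suc m) z)
        ≡⟨ cong (λ w → z * (ι (nat m) * h + ι (ℚ.- 1ℚ) * w)) (horner-nat A a (suc m) z) ⟩
      z * (ι (nat m) * h + ι (ℚ.- 1ℚ) * (z * d)) ∎

2^ : ℕ → ℚ
2^ = Evaluation.power ℚ-self 2ℚ

-- The induction needs the statement for the dual numbers over A as well, to differentiate it.
R-basis-change : ∀ m (A : ℚ-Algebra) → let open ℚ-Algebra A in let open Evaluation A in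
  ∀ z → ι (2^ m) * horner (Rℚ (suc m)) (suc m) z ≡ homogeneous (ρ m) m (ι 1ℚ + z) (z - ι 1ℚ)
R-basis-change zero    A z = solve 1 (λ z → con 1ℚ :* (con 1ℚ :+ z :* con 0ℚ) := con 1ℚ) refl z
  where open ℚ-Algebra.Solver A
R-basis-change (suc m) A z = begin
  ι (2ℚ ℚ.* 2^ m) * horner (Rℚ (2 ℕ.+ m)) (2 ℕ.+ m) z
    ≡⟨ cong₂ _*_ (ι-* 2ℚ (2^ m)) (R-recurrence A m z) ⟩
  ι 2ℚ * c * (z * (ι 2ℚ * h + ι (nat m) * (z * h) + (ι 1ℚ - z * z) * d))
    ≡⟨ solve 5 (λ z m c h d →
         con 2ℚ :* c :* (z :* (con 2ℚ :* h :+ m :* (z :* h) :+ (con 1ℚ :- z :* z) :* d))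
         := z :* (con 2ℚ :* (con 2ℚ :* (c :* h)) :+ (con 2ℚ :* z :* (m :* (c :* h))
             :+ con 2ℚ :* ((con 1ℚ :- z :* z) :* (c :* d)))))
         refl z (ι (nat m)) c h d ⟩
  z * (ι 2ℚ * (ι 2ℚ * (c * h)) + (ι 2ℚ * z * (ι (nat m) * (c * h)) + ι 2ℚ * ((ι 1ℚ - z * z) * (c * d))))
    ≡⟨ cong₂ (λ x y → z * (ι 2ℚ * (ι 2ℚ * x) + (ι 2ℚ * z * (ι (nat m) * x) + ι 2ℚ * ((ι 1ℚ - z * z) * y))))
         (R-basis-change m A z) dual ⟩
  z * (ι 2ℚ * (ι 2ℚ * H) + (ι 2ℚ * z * (ι (nat m) * H) + ι 2ℚ * ((ι 1ℚ - z * z) * H′)))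
    -- Here p + q = 2z, p - q = 2 and pq = z² - 1, so the terms with `m` and `H′` form the
    -- right-hand side of `homogeneous-θ`.
    ≡⟨ solve 4 (λ z m H H′ →
         z :* (con 2ℚ :* (con 2ℚ :* H) :+ (con 2ℚ :* z :* (m :* H) :+ con 2ℚ :* ((con 1ℚ :- z :* z) :* H′)))
         := z :* (con 2ℚ :* (con 2ℚ :* H) :+ (m :* (((con 1ℚ :+ z) :+ (z :- con 1ℚ)) :* H)
             :- con 2ℚ :* ((con 1ℚ :+ z) :* ((z :- con 1ℚ) :* H′)))))
         refl z (ι (nat m)) H H′ ⟩
  z * (ι 2ℚ * (ι 2ℚ * H) + (ι (nat m) * ((p + q) * H) - ι 2ℚ * (p * (q * H′))))
    ≡⟨ cong (λ v → z * (ι 2ℚ * (ι 2ℚ * H) + v)) (homogeneous-θ A (ρ m) m p q) ⟨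
  z * (ι 2ℚ * (ι 2ℚ * H) + (p - q) * T)
    ≡⟨ solve 3 (λ z H T →
         z :* (con 2ℚ :* (con 2ℚ :* H) :+ ((con 1ℚ :+ z) :- (z :- con 1ℚ)) :* T)
         := ((con 1ℚ :+ z) :+ (z :- con 1ℚ)) :* (con 1ℚ :* T :+ con 2ℚ :* H)) refl z H T ⟩
  (p + q) * (ι 1ℚ * T + ι 2ℚ * H)
    ≡⟨ cong ((p + q) *_) (homogeneous-linear A 1ℚ 2ℚ (θ (nat m) (ρ m)) (ρ m) m p q) ⟨
  (p + q) * homogeneous (λ k → 1ℚ ℚ.* θ (nat m) (ρ m) k ℚ.+ 2ℚ ℚ.* ρ m k) m p q
    -- The summand 2R of the recurrence raises the parameter of `θ` from m to m + 2.
    ≡⟨ cong ((p + q) *_) (homogeneous-cong A (λ k → Q.solve 3 (λ m k a →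
         Q.con 1ℚ Q.:* ((m Q.:- Q.con 2ℚ Q.:* k) Q.:* a) Q.:+ Q.con 2ℚ Q.:* a
         Q.:= (Q.con 1ℚ Q.:+ (Q.con 1ℚ Q.:+ m) Q.:- Q.con 2ℚ Q.:* k) Q.:* a) refl (nat m) (nat k) (ρ m k)) m p q) ⟩
  (p + q) * homogeneous (θ (nat (2 ℕ.+ m)) (ρ m)) m p q
    ≡⟨ homogeneous-[1+x] A (θ (nat (2 ℕ.+ m)) (ρ m)) m p q (θ-vanishes (nat (2 ℕ.+ m)) (ρ m) (suc m) (ρ-degree m)) ⟨
  homogeneous (ρ (suc m)) (suc m) p q ∎
  where
  open ℚ-Algebra A
  open Evaluation A
  open Solver
  open ≡-Reasoning
  module D = ℚ-Algebra (quadratic 0ℚ A)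
  module ED = Evaluation (quadratic 0ℚ A)
  p = ι 1ℚ + z
  q = z - ι 1ℚ
  c = ι (2^ m)
  h = horner (Rℚ (suc m)) (suc m) z
  d = derivative A (coeffs (Rℚ (suc m)) (suc m)) z
  H = homogeneous (ρ m) m p q
  H′ = proj₂ (ED.homogeneous (ρ m) m (p , ι 1ℚ) (q , ι 1ℚ))
  T = homogeneous (θ (nat m) (ρ m)) m p q
  dual : c * d ≡ H′
  dual = begin
    c * d
      ≡⟨ solve 3 (λ c d v → c :* d := c :* d :+ con 0ℚ :* v) refl c d (proj₁ (ED.horner (Rℚ (suc m)) (suc m) (z , ι 1ℚ))) ⟩
    proj₂ (D.ι (2^ m) D.* ED.horner (Rℚ (suc m)) (suc m) (z , ι 1ℚ))
      ≡⟨ cong proj₂ (R-basis-change m (quadratic 0ℚ A) (z , ι 1ℚ)) ⟩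
    proj₂ (ED.homogeneous (ρ m) m (D.ι 1ℚ D.+ (z , ι 1ℚ)) ((z , ι 1ℚ) D.- D.ι 1ℚ))
      ≡⟨ cong₂ (λ x y → proj₂ (ED.homogeneous (ρ m) m (p , x) (q , y)))
           (solve 0 (con 0ℚ :+ con 1ℚ := con 1ℚ) refl) (solve 0 (con 1ℚ :- con 0ℚ := con 1ℚ) refl) ⟩
    H′ ∎

-- Elementary inequalities over ℚ

module Estimates where
  open import Data.Rational.Base
  open import Data.Rational.Properties

  0≤-+ : ∀ {a b} → 0ℚ ≤ a → 0ℚ ≤ b → 0ℚ ≤ a + b
  0≤-+ 0≤a 0≤b = +-mono-≤ 0≤a 0≤b

  0<-+ˡ : ∀ {a b} → 0ℚ < a → 0ℚ ≤ b → 0ℚ < a + b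
  0<-+ˡ 0<a 0≤b = +-mono-<-≤ 0<a 0≤b

  0≤-* : ∀ {a b} → 0ℚ ≤ a → 0ℚ ≤ b → 0ℚ ≤ a * b
  0≤-* {a} {b} 0≤a 0≤b =
    subst (_≤ a * b) (*-zeroʳ a) (*-monoˡ-≤-nonNeg a {{nonNegative 0≤a}} 0≤b)

  0<-* : ∀ {a b} → 0ℚ < a → 0ℚ < b → 0ℚ < a * b
  0<-* {a} {b} 0<a 0<b = subst (_< a * b) (*-zeroʳ a) (*-monoʳ-<-pos a {{positive 0<a}} 0<b)

  0≤-square : ∀ a → 0ℚ ≤ a * a
  0≤-square a with ≤-total 0ℚ a
  ... | inj₁ 0≤a = 0≤-* 0≤a 0≤a
  ... | inj₂ a≤0 = subst (0ℚ ≤_) (Q.solve 1 (λ a → (Q.:- a) Q.:* (Q.:- a) Q.:= a Q.:* a) refl a)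
                     (0≤-* (neg-antimono-≤ a≤0) (neg-antimono-≤ a≤0))

  0<1 : 0ℚ < 1ℚ
  0<1 = positive⁻¹ 1ℚ

  0≤1 : 0ℚ ≤ 1ℚ
  0≤1 = <⇒≤ 0<1

  0≤nat : ∀ n → 0ℚ ≤ nat n
  0≤nat zero    = ≤-refl
  0≤nat (suc n) = 0≤-+ 0≤1 (0≤nat n)

  ≤-by : ∀ {a b} d → 0ℚ ≤ d → a + d ≡ b → a ≤ b
  ≤-by {a} d 0≤d refl = subst (_≤ a + d) (+-identityʳ a) (+-monoʳ-≤ a 0≤d)

  <-by : ∀ {a b} d → 0ℚ < d → a + d ≡ b → a < b
  <-by {a} d 0<d refl = subst (_< a + d) (+-identityʳ a) (+-monoʳ-< a 0<d)

  ≤⇒0≤- : ∀ {a b} → a ≤ b → 0ℚ ≤ b - a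
  ≤⇒0≤- {a} {b} a≤b = subst (_≤ b - a) (+-inverseʳ a) (+-monoˡ-≤ (- a) a≤b)

  <⇒0<- : ∀ {a b} → a < b → 0ℚ < b - a
  <⇒0<- {a} {b} a<b = subst (_< b - a) (+-inverseʳ a) (+-monoˡ-< (- a) a<b)

  *-mono-≤ : ∀ {a b c d} → 0ℚ ≤ a → a ≤ b → 0ℚ ≤ c → c ≤ d → a * c ≤ b * d
  *-mono-≤ {a} {b} {c} {d} 0≤a a≤b 0≤c c≤d = ≤-trans
    (*-monoʳ-≤-nonNeg c {{nonNegative 0≤c}} a≤b)
    (*-monoˡ-≤-nonNeg b {{nonNegative (≤-trans 0≤a a≤b)}} c≤d)

  *-monoˡ : ∀ {c d} a → 0ℚ ≤ a → c ≤ d → a * c ≤ a * d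
  *-monoˡ a 0≤a = *-monoˡ-≤-nonNeg a {{nonNegative 0≤a}}

  *-cancelˡ-≤ : ∀ {c d} a → 0ℚ < a → a * c ≤ a * d → c ≤ d
  *-cancelˡ-≤ a 0<a = *-cancelˡ-≤-pos a {{positive 0<a}}

  0≤-cancel : ∀ {b} a → 0ℚ < a → 0ℚ ≤ a * b → 0ℚ ≤ b
  0≤-cancel {b} a 0<a 0≤ab = *-cancelˡ-≤ a 0<a (subst (_≤ a * b) (sym (*-zeroʳ a)) 0≤ab)

  reciprocal : ∀ a → 0ℚ < a → ∃[ r ] (0ℚ < r × a * r ≡ 1ℚ)
  reciprocal a 0<a = 1/ a , positive⁻¹ (1/ a) {{1/pos⇒pos a}} , *-inverseʳ a
    where
    instance
      a-pos : Positive a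
      a-pos = positive 0<a
      a-nonZero : NonZero a
      a-nonZero = pos⇒nonZero a

  -- Partial fractions at approximate zeros

  -- A node −τ with the coefficients c and e of 1/(x + τ) in the partial fractions of f and F.
  Node : Set
  Node = ℚ × ℚ × ℚ

  module NodePolynomials (A : ℚ-Algebra) where
    open ℚ-Algebra A using (Carrier; ι) renaming (_+_ to _⊕_; _*_ to _⊛_)

    nodal : ∀ {M} → Vec Node M → Carrier → Carrier
    nodal []             x = ι 1ℚ
    nodal ((τ , _) ∷ ns) x = (x ⊕ ι τ) ⊛ nodal ns x

    -- w₀ ∏ (x + τᵢ) + Σⱼ wⱼ ∏_{i≠j} (x + τᵢ)
    interpolant : ∀ {M} → (Node → ℚ) → ℚ → Vec Node M → Carrier → Carrier
    interpolant w w₀ []               x = ι w₀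
    interpolant w w₀ (n@(τ , _) ∷ ns) x = ι (w n) ⊛ nodal ns x ⊕ (x ⊕ ι τ) ⊛ interpolant w w₀ ns x

  weight defect : Node → ℚ
  weight (_ , c , _) = c
  defect (_ , _ , e) = e

  addConstant : ∀ {N} → ℚ → Vec ℚ (suc N) → Vec ℚ (suc N)
  addConstant a (b ∷ bs) = a + b ∷ bs

  timesLinear : ∀ {N} → ℚ → Vec ℚ N → Vec ℚ (suc N)
  timesLinear τ []       = 0ℚ ∷ []
  timesLinear τ (a ∷ as) = τ * a ∷ addConstant a (timesLinear τ as)

  subtract : ∀ {N} → Vec ℚ (suc N) → ℚ → Vec ℚ N → Vec ℚ (suc N)
  subtract as       c []       = as
  subtract (a ∷ as) c (b ∷ bs) = a - c * b ∷ subtract as c bs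

  evalℚ : ∀ {N} → Vec ℚ N → ℚ → ℚ
  evalℚ = Evaluation.eval ℚ-self

  -- Synthetic division by x - x₀: the coefficients of the quotient are the intermediate values of
  -- Horner's scheme at x₀.
  quotient : ∀ {N} → ℚ → Vec ℚ (suc N) → Vec ℚ N
  quotient x₀ (a ∷ [])         = []
  quotient x₀ (a ∷ as@(_ ∷ _)) = evalℚ as x₀ ∷ quotient x₀ as

  last-subtract : ∀ {N} (as : Vec ℚ (suc N)) c bs → last (subtract as c bs) ≡ last as
  last-subtract (a ∷ [])     c []       = refl
  last-subtract (a ∷ as@(_ ∷ _)) c (b ∷ bs) with subtract as c bs | last-subtract as c bs
  ... | _ ∷ _ | eq = eq

  last-quotient : ∀ {N} x₀ (as : Vec ℚ (suc (suc N))) → last (quotient x₀ as) ≡ last as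
  last-quotient x₀ (a ∷ b ∷ [])         = trans (cong (λ y → b + y) (*-zeroʳ x₀)) (+-identityʳ b)
  last-quotient x₀ (a ∷ as@(b ∷ _ ∷ _)) = last-quotient x₀ as

  module _ (A : ℚ-Algebra) where
    open ℚ-Algebra A using (ι; ι-+; ι-*; ι-neg; module Solver) renaming (_+_ to _⊕_; _*_ to _⊛_; _-_ to _⊖_)
    open Evaluation A
    open Solver
    open NodePolynomials A

    eval-addConstant : ∀ {N} a (as : Vec ℚ (suc N)) x → eval (addConstant a as) x ≡ ι a ⊕ eval as x
    eval-addConstant a (b ∷ bs) x rewrite ι-+ a b =
      solve 3 (λ a b v → a :+ b :+ v := a :+ (b :+ v)) refl (ι a) (ι b) (x ⊛ eval bs x)

    eval-timesLinear : ∀ {N} τ (as : Vec ℚ N) x → eval (timesLinear τ as) x ≡ (x ⊕ ι τ) ⊛ eval as x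
    eval-timesLinear τ []       x =
      solve 2 (λ x t → con 0ℚ :+ x :* con 0ℚ := (x :+ t) :* con 0ℚ) refl x (ι τ)
    eval-timesLinear τ (a ∷ as) x
      rewrite eval-addConstant a (timesLinear τ as) x | eval-timesLinear τ as x | ι-* τ a =
      solve 4 (λ x t a v → t :* a :+ x :* (a :+ (x :+ t) :* v) := (x :+ t) :* (a :+ x :* v))
        refl x (ι τ) (ι a) (eval as x)

    eval-subtract : ∀ {N} (as : Vec ℚ (suc N)) c bs x →
      eval (subtract as c bs) x ≡ eval as x ⊖ ι c ⊛ eval bs x
    eval-subtract as       c []       x =
      solve 2 (λ v c → v := v :- c :* con 0ℚ) refl (eval as x) (ι c)
    eval-subtract (a ∷ as) c (b ∷ bs) x
      rewrite eval-subtract as c bs x | ι-+ a (- (c * b)) | ι-neg (c * b) | ι-* c b =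
      solve 6 (λ a b c x u v → a :- c :* b :+ x :* (u :- c :* v) := a :+ x :* u :- c :* (b :+ x :* v))
        refl (ι a) (ι b) (ι c) x (eval as x) (eval bs x)

    eval-quotient : ∀ {N} x₀ (as : Vec ℚ (suc N)) x →
      eval as x ≡ ι (evalℚ as x₀) ⊕ (x ⊖ ι x₀) ⊛ eval (quotient x₀ as) x
    eval-quotient x₀ (a ∷ []) x
      rewrite *-zeroʳ x₀ | +-identityʳ a =
      solve 3 (λ a x y → a :+ x :* con 0ℚ := a :+ (x :- y) :* con 0ℚ) refl (ι a) x (ι x₀)
    eval-quotient x₀ (a ∷ as@(_ ∷ _)) x
      rewrite eval-quotient x₀ as x | ι-+ a (x₀ * evalℚ as x₀) | ι-* x₀ (evalℚ as x₀) =
      solve 5 (λ a x y v w → a :+ x :* (v :+ (x :- y) :* w) := a :+ y :* v :+ (x :- y) :* (v :+ x :* w))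
        refl (ι a) x (ι x₀) (ι (evalℚ as x₀)) (eval (quotient x₀ as) x)

  -- The signs alternate because φ and Φ are negated from each node to the next.
  data Alternating (Λ : ℚ) : (φ Φ : ℚ → ℚ) → ℚ → ∀ {M} → Vec ℚ M → Set where
    []  : ∀ {φ Φ t} → Alternating Λ φ Φ t []
    next : ∀ {φ Φ t τ M} {τs : Vec ℚ M} → t < τ → 0ℚ ≤ φ τ → ∣ Φ τ ∣ ≤ Λ * φ τ →
      Alternating Λ (λ x → - φ x) (λ x → - Φ x) τ τs → Alternating Λ φ Φ t (τ ∷ τs)

  ∣∣≤-cancel : ∀ Λ u v r → 0ℚ < r → ∣ r * u ∣ ≤ Λ * (r * v) → ∣ u ∣ ≤ Λ * v
  ∣∣≤-cancel Λ u v r 0<r hyp = *-cancelˡ-≤ r 0<r (begin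
    r * ∣ u ∣  ≡⟨ cong (_* ∣ u ∣) (0≤p⇒∣p∣≡p (<⇒≤ 0<r)) ⟨
    ∣ r ∣ * ∣ u ∣  ≡⟨ ∣p*q∣≡∣p∣*∣q∣ r u ⟨
    ∣ r * u ∣  ≤⟨ hyp ⟩
    Λ * (r * v)  ≡⟨ Q.solve 3 (λ l r v → l Q.:* (r Q.:* v) Q.:= r Q.:* (l Q.:* v)) refl Λ r v ⟩
    r * (Λ * v)  ∎)
    where open ≤-Reasoning

  Proportional : ℚ → (φ ψ : ℚ → ℚ) → ∀ {M} → Vec ℚ M → Set
  Proportional s φ ψ = All (λ τ → (τ - s) * ψ τ ≡ φ τ)

  negate : ∀ {s φ ψ M} {τs : Vec ℚ M} → Proportional s φ ψ τs →
    Proportional s (λ x → - φ x) (λ x → - ψ x) τs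
  negate {s} {φ} {ψ} = All.map λ {τ} eq → trans (sym (neg-distribʳ-* (τ - s) (ψ τ))) (cong -_ eq)

  -- Beyond `s` the factor τ - s is positive, and dividing both functions by it affects neither the
  -- sign nor the ratio.
  transfer : ∀ {Λ φ Φ ψ Ψ s t M} {τs : Vec ℚ M} → s ≤ t →
    Proportional s φ ψ τs → Proportional s Φ Ψ τs → Alternating Λ φ Φ t τs → Alternating Λ ψ Ψ t τs
  transfer s≤t [] [] [] = []
  transfer {Λ} {φ} {Φ} {ψ} {Ψ} {s} {τs = τ ∷ _} s≤t (eq ∷ prop) (eq′ ∷ prop′) (next t<τ 0≤φ Φ≤φ alt) =
    next t<τ (0≤-cancel (τ - s) 0<r (subst (0ℚ ≤_) (sym eq) 0≤φ))
      (∣∣≤-cancel Λ (Ψ τ) (ψ τ) (τ - s) 0<r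
        (subst (λ v → ∣ (τ - s) * Ψ τ ∣ ≤ Λ * v) (sym eq) (subst (λ v → ∣ v ∣ ≤ Λ * φ τ) (sym eq′) Φ≤φ)))
      (transfer (<⇒≤ s<τ) (negate prop) (negate prop′) alt)
    where
    s<τ : s < τ
    s<τ = ≤-<-trans s≤t t<τ
    0<r = <⇒0<- s<τ

  nodes-above : ∀ {Λ φ Φ s t M} {τs : Vec ℚ M} → s ≤ t → Alternating Λ φ Φ t τs → All (s <_) τs
  nodes-above s≤t []                  = []
  nodes-above s≤t (next t<τ _ _ alt) = ≤-<-trans s≤t t<τ ∷ nodes-above (≤-trans s≤t (<⇒≤ t<τ)) alt

  nodalCoeffs : ∀ {M} → Vec ℚ M → Vec ℚ (suc M)
  nodalCoeffs []       = 1ℚ ∷ []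
  nodalCoeffs (τ ∷ τs) = timesLinear τ (nodalCoeffs τs)

  nodalCoeffs-positive : ∀ {t M} {τs : Vec ℚ M} → All (t <_) τs → 0ℚ < evalℚ (nodalCoeffs τs) (- t)
  nodalCoeffs-positive {t} [] = subst (0ℚ <_) (sym (trans (cong (λ y → 1ℚ + y) (*-zeroʳ (- t))) (+-identityʳ 1ℚ))) 0<1
  nodalCoeffs-positive {t} {τs = τ ∷ τs} (t<τ ∷ above) =
    subst (0ℚ <_) (sym (eval-timesLinear ℚ-self τ (nodalCoeffs τs) (- t)))
      (0<-* (subst (0ℚ <_) (+-comm τ (- t)) (<⇒0<- t<τ)) (nodalCoeffs-positive above))

  nodalCoeffs-roots : ∀ {M} (τs : Vec ℚ M) → All (λ τ → evalℚ (nodalCoeffs τs) (- τ) ≡ 0ℚ) τs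
  nodalCoeffs-roots []       = []
  nodalCoeffs-roots (τ ∷ τs) =
    trans (eval-timesLinear ℚ-self τ (nodalCoeffs τs) (- τ))
      (trans (cong (_* evalℚ (nodalCoeffs τs) (- τ)) (+-inverseˡ τ)) (*-zeroˡ (evalℚ (nodalCoeffs τs) (- τ))))
    ∷ All.map (λ {σ} root → trans (eval-timesLinear ℚ-self τ (nodalCoeffs τs) (- σ))
        (trans (cong ((- σ + τ) *_) root) (*-zeroʳ (- σ + τ)))) (nodalCoeffs-roots τs)

  data Admissible (Λ : ℚ) : ∀ {M} → Vec ℚ M → Vec Node M → Set where
    []  : Admissible Λ [] []
    next : ∀ {τ c e M} {τs : Vec ℚ M} {ns} → 0ℚ ≤ c → ∣ e ∣ ≤ Λ * c → Admissible Λ τs ns →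
      Admissible Λ (τ ∷ τs) ((τ , c , e) ∷ ns)

  -- Quantified over all algebras because it is needed at the point 2 over ℚ and over the dual
  -- numbers of ℚ(i). The leading coefficient of `f` is the constant in the partial fractions of
  -- f/P, where P is the nodal polynomial.
  Represents : ∀ {M} → (Node → ℚ) → Vec ℚ (suc M) → Vec Node M → Set₁
  Represents w f ns = ∀ (A : ℚ-Algebra) x →
    Evaluation.eval A f x ≡ NodePolynomials.interpolant A w (last f) ns x

  eval-nodalCoeffs : ∀ (A : ℚ-Algebra) {Λ M} {τs : Vec ℚ M} {ns} → Admissible Λ τs ns →
    ∀ x → Evaluation.eval A (nodalCoeffs τs) x ≡ NodePolynomials.nodal A ns x
  eval-nodalCoeffs A [] x = solve 1 (λ x → con 1ℚ :+ x :* con 0ℚ := con 1ℚ) refl x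
    where open ℚ-Algebra.Solver A
  eval-nodalCoeffs A {τs = τ ∷ τs} (next _ _ adm) x =
    trans (eval-timesLinear A τ (nodalCoeffs τs) x) (cong ((x ⊕ ι τ) ⊛_) (eval-nodalCoeffs A adm x))
    where open ℚ-Algebra A using (ι) renaming (_+_ to _⊕_; _*_ to _⊛_)

  -- One step of the partial fraction expansion. With P the nodal polynomial of `τs`, the
  -- coefficient is f(-τ)/P(-τ), so that f - coefficient · P is divisible by x + τ; `rest` is the
  -- quotient.
  module Peel {M} (f : Vec ℚ (suc (suc M))) (τ : ℚ) (τs : Vec ℚ M) (r : ℚ)
              (p*r≡1 : evalℚ (nodalCoeffs τs) (- τ) * r ≡ 1ℚ) where
    coefficient : ℚ
    coefficient = r * evalℚ f (- τ)

    remainder rest : Vec ℚ _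
    remainder = subtract f coefficient (nodalCoeffs τs)
    rest      = quotient (- τ) remainder

    remainder-root : evalℚ remainder (- τ) ≡ 0ℚ
    remainder-root = begin
      evalℚ remainder (- τ)
        ≡⟨ eval-subtract ℚ-self f coefficient (nodalCoeffs τs) (- τ) ⟩
      v - r * v * p
        ≡⟨ Q.solve 3 (λ v r p → v Q.:- r Q.:* v Q.:* p Q.:= v Q.:- p Q.:* r Q.:* v) refl v r p ⟩
      v - p * r * v
        ≡⟨ cong (λ u → v - u * v) p*r≡1 ⟩
      v - 1ℚ * v
        ≡⟨ Q.solve 1 (λ v → v Q.:- Q.con 1ℚ Q.:* v Q.:= Q.con 0ℚ) refl v ⟩
      0ℚ ∎
      where
      open ≡-Reasoning
      v = evalℚ f (- τ)
      p = evalℚ (nodalCoeffs τs) (- τ)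

    eval-peel : ∀ (A : ℚ-Algebra) x → let open ℚ-Algebra A using (ι) renaming (_+_ to _⊕_; _*_ to _⊛_) in
      Evaluation.eval A f x
        ≡ ι coefficient ⊛ Evaluation.eval A (nodalCoeffs τs) x ⊕ (x ⊕ ι τ) ⊛ Evaluation.eval A rest x
    eval-peel A x = begin
      eval f x
        ≡⟨ solve 2 (λ v w → v := w :+ (v :- w)) refl (eval f x) w ⟩
      w ⊕ (eval f x ⊖ w)
        ≡⟨ cong (w ⊕_) (eval-subtract A f coefficient (nodalCoeffs τs) x) ⟨
      w ⊕ eval remainder x
        ≡⟨ cong (w ⊕_) (eval-quotient A (- τ) remainder x) ⟩
      w ⊕ (ι (evalℚ remainder (- τ)) ⊕ (x ⊖ ι (- τ)) ⊛ eval rest x)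
        ≡⟨ cong₂ (λ u v → w ⊕ (ι u ⊕ (x ⊖ v) ⊛ eval rest x)) remainder-root (ι-neg τ) ⟩
      w ⊕ (ι 0ℚ ⊕ (x ⊖ ⊝ ι τ) ⊛ eval rest x)
        ≡⟨ solve 4 (λ w x t v → w :+ (con 0ℚ :+ (x :- (:- t)) :* v) := w :+ (x :+ t) :* v)
             refl w x (ι τ) (eval rest x) ⟩
      w ⊕ (x ⊕ ι τ) ⊛ eval rest x ∎
      where
      open ℚ-Algebra A using (ι; ι-neg; module Solver) renaming (_+_ to _⊕_; _*_ to _⊛_; _-_ to _⊖_; -_ to ⊝_)
      open Solver
      open Evaluation A
      open ≡-Reasoning
      w = ι coefficient ⊛ eval (nodalCoeffs τs) x

    last-rest : last rest ≡ last f
    last-rest = trans (last-quotient (- τ) remainder) (last-subtract f coefficient (nodalCoeffs τs))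

    -- At a root -σ of the remaining nodal polynomial, f(-σ) = (τ - σ) rest(-σ). The sign is put on
    -- `f` to make the factor σ - τ positive, and it is the same negation by which `Alternating`
    -- passes to the next node.
    rest-proportional : Proportional τ (λ x → - evalℚ f (- x)) (λ x → evalℚ rest (- x)) τs
    rest-proportional = All.map (λ {σ} root → begin
      (σ - τ) * evalℚ rest (- σ)
        ≡⟨ Q.solve 4 (λ s t v c → (s Q.:- t) Q.:* v
             Q.:= Q.:- (c Q.:* Q.con 0ℚ Q.:+ ((Q.:- s) Q.:+ t) Q.:* v)) refl σ τ (evalℚ rest (- σ)) coefficient ⟩
      - (coefficient * 0ℚ + (- σ + τ) * evalℚ rest (- σ))
        ≡⟨ cong (λ v → - (coefficient * v + (- σ + τ) * evalℚ rest (- σ))) root ⟨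
      - (coefficient * evalℚ (nodalCoeffs τs) (- σ) + (- σ + τ) * evalℚ rest (- σ))
        ≡⟨ cong -_ (eval-peel ℚ-self (- σ)) ⟨
      - evalℚ f (- σ) ∎) (nodalCoeffs-roots τs)
      where open ≡-Reasoning

    represents : ∀ {Λ} {ns : Vec Node M} (w : Node → ℚ) {n} → proj₁ n ≡ τ → w n ≡ coefficient →
      Admissible Λ τs ns → Represents w rest ns → Represents w f (n ∷ ns)
    represents {ns = ns} w refl w≡ adm repr A x = trans (eval-peel A x)
      (cong₂ (λ u v → u ⊕ (x ⊕ ι τ) ⊛ v)
        (cong₂ _⊛_ (cong ι (sym w≡)) (eval-nodalCoeffs A adm x))
        (trans (repr A x) (cong (λ l → interpolant w l ns x) last-rest)))
      where
      open ℚ-Algebra A using (ι) renaming (_+_ to _⊕_; _*_ to _⊛_)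
      open NodePolynomials A

  -- The smallest node is peeled off first, where the remaining nodal polynomial is a product of
  -- positive factors σ - τ. Hence the weight inherits the sign of f(-τ) and the defect its bound by
  -- Λ, and what remains is again alternating.
  interpolate : ∀ {Λ t M} (τs : Vec ℚ M) (f F : Vec ℚ (suc M)) →
    Alternating Λ (λ x → evalℚ f (- x)) (λ x → evalℚ F (- x)) t τs →
    Σ[ ns ∈ Vec Node M ] (Admissible Λ τs ns × Represents weight f ns × Represents defect F ns)
  interpolate [] (a ∷ []) (b ∷ []) [] = [] , [] , constant {weight} a , constant {defect} b
    where
    constant : ∀ {w : Node → ℚ} a → Represents w (a ∷ []) []
    constant a A x = solve 2 (λ a x → a :+ x :* con 0ℚ := a) refl (ℚ-Algebra.ι A a) x
      where open ℚ-Algebra.Solver A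
  interpolate {Λ} (τ ∷ τs) f F (next _ 0≤f F≤f alt) =
    let ns , adm , repr , repr′ = interpolate τs f.rest F.rest
          (transfer {ψ = λ x → evalℚ f.rest (- x)} {Ψ = λ x → evalℚ F.rest (- x)} ≤-refl f.rest-proportional F.rest-proportional alt)
        n = τ , f.coefficient , F.coefficient
    in n ∷ ns
     , next (0≤-* (<⇒≤ 0<r) 0≤f) bound adm
     , f.represents weight {n} refl refl adm repr
     , F.represents defect {n} refl refl adm repr′
    where
    inverse = reciprocal (evalℚ (nodalCoeffs τs) (- τ)) (nodalCoeffs-positive (nodes-above ≤-refl alt))
    r : ℚ
    r = proj₁ inverse
    0<r : 0ℚ < r
    0<r = proj₁ (proj₂ inverse)
    module f = Peel f τ τs r (proj₂ (proj₂ inverse))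
    module F = Peel F τ τs r (proj₂ (proj₂ inverse))
    bound : ∣ r * evalℚ F (- τ) ∣ ≤ Λ * (r * evalℚ f (- τ))
    bound = begin
      ∣ r * evalℚ F (- τ) ∣  ≡⟨ ∣p*q∣≡∣p∣*∣q∣ r (evalℚ F (- τ)) ⟩
      ∣ r ∣ * ∣ evalℚ F (- τ) ∣  ≡⟨ cong (_* ∣ evalℚ F (- τ) ∣) (0≤p⇒∣p∣≡p (<⇒≤ 0<r)) ⟩
      r * ∣ evalℚ F (- τ) ∣  ≤⟨ *-monoˡ r (<⇒≤ 0<r) F≤f ⟩
      r * (Λ * evalℚ f (- τ))  ≡⟨ Q.solve 3 (λ l r v → r Q.:* (l Q.:* v) Q.:= l Q.:* (r Q.:* v)) refl Λ r (evalℚ f (- τ)) ⟩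
      Λ * (r * evalℚ f (- τ))  ∎
      where open ≤-Reasoning

  -- The Turán form in terms of the nodes

  module NodeForm (B : ℚ-Algebra) where
    open ℚ-Algebra B using (Carrier; ι; module Solver) renaming (_+_ to _⊕_; _*_ to _⊛_; _-_ to _⊖_)
    open Solver
    open NodePolynomials B public
    open ≡-Reasoning
    private
      module ND = NodePolynomials (quadratic 0ℚ B)
      module D = ℚ-Algebra (quadratic 0ℚ B)

    nodal′ : ∀ {M} → Vec Node M → Carrier → Carrier
    nodal′ []             x = ι 0ℚ
    nodal′ ((τ , _) ∷ ns) x = nodal ns x ⊕ (x ⊕ ι τ) ⊛ nodal′ ns x

    interpolant′ : ∀ {M} → (Node → ℚ) → ℚ → Vec Node M → Carrier → Carrier
    interpolant′ w w₀ []               x = ι 0ℚ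
    interpolant′ w w₀ (n@(τ , _) ∷ ns) x =
      ι (w n) ⊛ nodal′ ns x ⊕ (interpolant w w₀ ns x ⊕ (x ⊕ ι τ) ⊛ interpolant′ w w₀ ns x)

    nodal-dual : ∀ {M} (ns : Vec Node M) x → ND.nodal ns (x , ι 1ℚ) ≡ (nodal ns x , nodal′ ns x)
    nodal-dual []             x = refl
    nodal-dual ((τ , _) ∷ ns) x =
      trans (cong (((x , ι 1ℚ) D.+ D.ι τ) D.*_) (nodal-dual ns x)) (cong₂ _,_
        (solve 4 (λ x t p p′ → (x :+ t) :* p :+ con 0ℚ :* ((con 1ℚ :+ con 0ℚ) :* p′) := (x :+ t) :* p)
          refl x (ι τ) (nodal ns x) (nodal′ ns x))
        (solve 4 (λ x t p p′ → (x :+ t) :* p′ :+ (con 1ℚ :+ con 0ℚ) :* p := p :+ (x :+ t) :* p′)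
          refl x (ι τ) (nodal ns x) (nodal′ ns x)))

    interpolant-dual : ∀ {M} w w₀ (ns : Vec Node M) x →
      ND.interpolant w w₀ ns (x , ι 1ℚ) ≡ (interpolant w w₀ ns x , interpolant′ w w₀ ns x)
    interpolant-dual w w₀ []               x = refl
    interpolant-dual w w₀ (n@(τ , _) ∷ ns) x =
      trans (cong₂ (λ u v → D.ι (w n) D.* u D.+ ((x , ι 1ℚ) D.+ D.ι τ) D.* v)
        (nodal-dual ns x) (interpolant-dual w w₀ ns x)) (cong₂ _,_
          (solve 7 (λ x t w p p′ g g′ →
            w :* p :+ con 0ℚ :* (con 0ℚ :* p′) :+ ((x :+ t) :* g :+ con 0ℚ :* ((con 1ℚ :+ con 0ℚ) :* g′))
            := w :* p :+ (x :+ t) :* g)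
            refl x (ι τ) (ι (w n)) (nodal ns x) (nodal′ ns x) (interpolant w w₀ ns x) (interpolant′ w w₀ ns x))
          (solve 7 (λ x t w p p′ g g′ →
            w :* p′ :+ con 0ℚ :* p :+ ((x :+ t) :* g′ :+ (con 1ℚ :+ con 0ℚ) :* g)
            := w :* p′ :+ (g :+ (x :+ t) :* g′))
            refl x (ι τ) (ι (w n)) (nodal ns x) (nodal′ ns x) (interpolant w w₀ ns x) (interpolant′ w w₀ ns x)))

    interpolant-split : ∀ {M} w w₀ (ns : Vec Node M) x →
      interpolant w w₀ ns x ≡ ι w₀ ⊛ nodal ns x ⊕ interpolant w 0ℚ ns x
    interpolant-split w w₀ []               x = solve 1 (λ w → w := w :* con 1ℚ :+ con 0ℚ) refl (ι w₀)
    interpolant-split w w₀ (n@(τ , _) ∷ ns) x =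
      trans (cong (λ g → ι (w n) ⊛ nodal ns x ⊕ (x ⊕ ι τ) ⊛ g) (interpolant-split w w₀ ns x))
        (solve 6 (λ x t w w₀ p g → w :* p :+ (x :+ t) :* (w₀ :* p :+ g) := w₀ :* ((x :+ t) :* p) :+ (w :* p :+ (x :+ t) :* g))
          refl x (ι τ) (ι (w n)) (ι w₀) (nodal ns x) (interpolant w 0ℚ ns x))

    interpolant-split′ : ∀ {M} w w₀ (ns : Vec Node M) x →
      interpolant′ w w₀ ns x ≡ ι w₀ ⊛ nodal′ ns x ⊕ interpolant′ w 0ℚ ns x
    interpolant-split′ w w₀ []               x = solve 1 (λ w → con 0ℚ := w :* con 0ℚ :+ con 0ℚ) refl (ι w₀)
    interpolant-split′ w w₀ (n@(τ , _) ∷ ns) x =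
      trans (cong₂ (λ g g′ → ι (w n) ⊛ nodal′ ns x ⊕ (g ⊕ (x ⊕ ι τ) ⊛ g′))
          (interpolant-split w w₀ ns x) (interpolant-split′ w w₀ ns x))
        (solve 8 (λ x t w w₀ p p′ g g′ →
          w :* p′ :+ (w₀ :* p :+ g :+ (x :+ t) :* (w₀ :* p′ :+ g′))
          := w₀ :* (p :+ (x :+ t) :* p′) :+ (w :* p′ :+ (g :+ (x :+ t) :* g′)))
          refl x (ι τ) (ι (w n)) (ι w₀) (nodal ns x) (nodal′ ns x) (interpolant w 0ℚ ns x) (interpolant′ w 0ℚ ns x))

    -- Unfolded, with P the nodal polynomial: c₀ P² + Σ_j c_j (τ_j - x) ∏_{i≠j} (x + τ_i)².
    form : ∀ {M} → ℚ → Vec Node M → Carrier → Carrier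
    form c₀ []                 x = ι c₀
    form c₀ ((τ , c , _) ∷ ns) x =
      ι c ⊛ ((ι τ ⊖ x) ⊛ (nodal ns x ⊛ nodal ns x)) ⊕ (x ⊕ ι τ) ⊛ (x ⊕ ι τ) ⊛ form c₀ ns x

    -- −f − 2x (f/P)′ P² for f the interpolant and P the nodal polynomial, summed over the partial
    -- fractions of f/P; each term contributes −(τ − x)/(x + τ)².
    form-identity : ∀ {M} c₀ (ns : Vec Node M) x →
      let p = nodal ns x ; p′ = nodal′ ns x ; g = interpolant weight c₀ ns x ; g′ = interpolant′ weight c₀ ns x
      in g ⊛ p ⊖ ι 2ℚ ⊛ (x ⊛ (p′ ⊛ g ⊖ p ⊛ g′)) ≡ form c₀ ns x
    form-identity c₀ []                 x =
      solve 2 (λ c x → c :* con 1ℚ :- con 2ℚ :* (x :* (con 0ℚ :* c :- con 1ℚ :* con 0ℚ)) := c) refl (ι c₀) x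
    form-identity c₀ ((τ , c , _) ∷ ns) x = trans
      (solve 7 (λ x t c p p′ g g′ →
        (c :* p :+ (x :+ t) :* g) :* ((x :+ t) :* p)
          :- con 2ℚ :* (x :* ((p :+ (x :+ t) :* p′) :* (c :* p :+ (x :+ t) :* g)
            :- (x :+ t) :* p :* (c :* p′ :+ (g :+ (x :+ t) :* g′))))
        := c :* ((t :- x) :* (p :* p)) :+ (x :+ t) :* (x :+ t) :* (g :* p :- con 2ℚ :* (x :* (p′ :* g :- p :* g′))))
        refl x (ι τ) (ι c) p p′ g g′)
      (cong (λ v → ι c ⊛ ((ι τ ⊖ x) ⊛ (p ⊛ p)) ⊕ (x ⊕ ι τ) ⊛ (x ⊕ ι τ) ⊛ v) (form-identity c₀ ns x))
      where
      p  = nodal ns x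
      p′ = nodal′ ns x
      g  = interpolant weight c₀ ns x
      g′ = interpolant′ weight c₀ ns x

  -- Gaussian rationals and majorants

  ℚ[i] : ℚ-Algebra
  ℚ[i] = quadratic (- 1ℚ) ℚ-self

  module K where
    open ℚ-Algebra ℚ[i] public using (ι; module Solver) renaming
      (Carrier to ℂℚ; _+_ to _⊕_; _*_ to _⊛_; _-_ to _⊖_; -_ to ⊝_)
    open NodeForm ℚ[i] public
  open K using (ℂℚ; ι; _⊕_; _⊛_; _⊖_; ⊝_)

  conjugate : ℂℚ → ℂℚ
  conjugate (a , b) = a , - b

  norm² : ℂℚ → ℚ
  norm² (a , b) = a * a + b * b

  -- The ℓ¹ norm stays rational and is still submultiplicative; the Euclidean norm would bring in
  -- square roots.
  ‖_‖ : ℂℚ → ℚ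
  ‖ a , b ‖ = ∣ a ∣ + ∣ b ∣

  0≤‖‖ : ∀ z → 0ℚ ≤ ‖ z ‖
  0≤‖‖ (a , b) = 0≤-+ (0≤∣p∣ a) (0≤∣p∣ b)

  ∣re∣≤‖‖ : ∀ z → ∣ proj₁ z ∣ ≤ ‖ z ‖
  ∣re∣≤‖‖ (a , b) = ≤-by ∣ b ∣ (0≤∣p∣ b) refl

  ‖⊕‖≤ : ∀ z w → ‖ z ⊕ w ‖ ≤ ‖ z ‖ + ‖ w ‖
  ‖⊕‖≤ (a , b) (c , d) = begin
    ∣ a + c ∣ + ∣ b + d ∣  ≤⟨ +-mono-≤ (∣p+q∣≤∣p∣+∣q∣ a c) (∣p+q∣≤∣p∣+∣q∣ b d) ⟩
    (∣ a ∣ + ∣ c ∣) + (∣ b ∣ + ∣ d ∣)  ≡⟨ Q.solve 4 (λ a b c d →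
      (a Q.:+ c) Q.:+ (b Q.:+ d) Q.:= (a Q.:+ b) Q.:+ (c Q.:+ d)) refl (∣ a ∣) (∣ b ∣) (∣ c ∣) (∣ d ∣) ⟩
    (∣ a ∣ + ∣ b ∣) + (∣ c ∣ + ∣ d ∣)  ∎
    where open ≤-Reasoning

  ‖⊝‖≡ : ∀ z → ‖ ⊝ z ‖ ≡ ‖ z ‖
  ‖⊝‖≡ (a , b) = cong₂ _+_ (∣-p∣≡∣p∣ a) (∣-p∣≡∣p∣ b)

  ‖⊛‖≤ : ∀ z w → ‖ z ⊛ w ‖ ≤ ‖ z ‖ * ‖ w ‖
  ‖⊛‖≤ (a , b) (c , d) = begin
    ∣ a * c + - 1ℚ * (b * d) ∣ + ∣ a * d + b * c ∣
      ≤⟨ +-mono-≤ (∣p+q∣≤∣p∣+∣q∣ (a * c) (- 1ℚ * (b * d))) (∣p+q∣≤∣p∣+∣q∣ (a * d) (b * c)) ⟩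
    (∣ a * c ∣ + ∣ - 1ℚ * (b * d) ∣) + (∣ a * d ∣ + ∣ b * c ∣)
      ≡⟨ cong₂ _+_
           (cong₂ _+_ (∣p*q∣≡∣p∣*∣q∣ a c) (trans (∣p*q∣≡∣p∣*∣q∣ (- 1ℚ) (b * d)) (cong (1ℚ *_) (∣p*q∣≡∣p∣*∣q∣ b d))))
           (cong₂ _+_ (∣p*q∣≡∣p∣*∣q∣ a d) (∣p*q∣≡∣p∣*∣q∣ b c)) ⟩
    (∣ a ∣ * ∣ c ∣ + 1ℚ * (∣ b ∣ * ∣ d ∣)) + (∣ a ∣ * ∣ d ∣ + ∣ b ∣ * ∣ c ∣)
      ≡⟨ Q.solve 4 (λ a b c d →
           (a Q.:* c Q.:+ Q.con 1ℚ Q.:* (b Q.:* d)) Q.:+ (a Q.:* d Q.:+ b Q.:* c)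
           Q.:= (a Q.:+ b) Q.:* (c Q.:+ d)) refl (∣ a ∣) (∣ b ∣) (∣ c ∣) (∣ d ∣) ⟩
    (∣ a ∣ + ∣ b ∣) * (∣ c ∣ + ∣ d ∣) ∎
    where open ≤-Reasoning

  ‖ι‖≡ : ∀ q → ‖ ι q ‖ ≡ ∣ q ∣
  ‖ι‖≡ q = +-identityʳ ∣ q ∣

  ‖⊕‖≤′ : ∀ z w {x y} → ‖ z ‖ ≤ x → ‖ w ‖ ≤ y → ‖ z ⊕ w ‖ ≤ x + y
  ‖⊕‖≤′ z w z≤x w≤y = ≤-trans (‖⊕‖≤ z w) (+-mono-≤ z≤x w≤y)

  ‖⊛‖≤′ : ∀ z w {x y} → ‖ z ‖ ≤ x → ‖ w ‖ ≤ y → ‖ z ⊛ w ‖ ≤ x * y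
  ‖⊛‖≤′ z w z≤x w≤y = ≤-trans (‖⊛‖≤ z w) (*-mono-≤ (0≤‖‖ z) z≤x (0≤‖‖ w) w≤y)

  Good : Node → Set
  Good (τ , c , _) = 1ℚ ≤ τ × 0ℚ ≤ c

  -- Evaluation at 2 majorises all values at η with ‖η‖ ≤ 2.
  module Majorant where
    open NodePolynomials ℚ-self public

    hat : ∀ {M} → Vec Node M → ℚ
    hat ns = nodal ns 2ℚ

    hatᵢ : ∀ {M} → ℚ → Vec Node M → ℚ
    hatᵢ c₀ ns = interpolant weight c₀ ns 2ℚ
  open Majorant using (hat; hatᵢ)

  0≤2 : 0ℚ ≤ 2ℚ
  0≤2 = 0≤-+ 0≤1 0≤1

  0≤τ : ∀ {τ} → 1ℚ ≤ τ → 0ℚ ≤ τ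
  0≤τ = ≤-trans 0≤1

  0≤2+τ : ∀ {τ} → 1ℚ ≤ τ → 0ℚ ≤ 2ℚ + τ
  0≤2+τ 1≤τ = 0≤-+ 0≤2 (0≤τ 1≤τ)

  1≤hat : ∀ {M} {ns : Vec Node M} → All Good ns → 1ℚ ≤ hat ns
  1≤hat []                = ≤-refl
  1≤hat {ns = (τ , _) ∷ ns} ((1≤τ , _) ∷ good) =
    *-mono-≤ {1ℚ} {2ℚ + τ} {1ℚ} {hat ns} 0≤1 (≤-by (1ℚ + τ) (0≤-+ 0≤1 (0≤τ 1≤τ))
      (Q.solve 1 (λ t → Q.con 1ℚ Q.:+ (Q.con 1ℚ Q.:+ t) Q.:= Q.con 2ℚ Q.:+ t) refl τ)) 0≤1 (1≤hat good)

  0≤hat : ∀ {M} {ns : Vec Node M} → All Good ns → 0ℚ ≤ hat ns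
  0≤hat good = ≤-trans 0≤1 (1≤hat good)

  0≤hatᵢ : ∀ {M c₀} {ns : Vec Node M} → 0ℚ ≤ c₀ → All Good ns → 0ℚ ≤ hatᵢ c₀ ns
  0≤hatᵢ 0≤c₀ []                   = 0≤c₀
  0≤hatᵢ 0≤c₀ ((1≤τ , 0≤c) ∷ good) =
    0≤-+ (0≤-* 0≤c (0≤hat good)) (0≤-* (0≤2+τ 1≤τ) (0≤hatᵢ 0≤c₀ good))

  module _ (η : ℂℚ) (η≤2 : ‖ η ‖ ≤ 2ℚ) where
    open Q

    ‖η+τ‖≤ : ∀ {τ} → 1ℚ ≤ τ → ‖ η ⊕ ι τ ‖ ≤ 2ℚ + τ
    ‖η+τ‖≤ {τ} 1≤τ = ‖⊕‖≤′ η (ι τ) η≤2 (≤-reflexive (trans (‖ι‖≡ τ) (0≤p⇒∣p∣≡p (0≤τ 1≤τ))))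

    nodal≤ : ∀ {M} {ns : Vec Node M} → All Good ns → ‖ K.nodal ns η ‖ ≤ hat ns
    nodal≤ []                                     = ≤-refl
    nodal≤ {ns = (τ , _) ∷ ns} ((1≤τ , _) ∷ good) =
      ‖⊛‖≤′ (η ⊕ ι τ) (K.nodal ns η) (‖η+τ‖≤ 1≤τ) (nodal≤ good)

    -- The derivative has `M` summands, each lacking one factor, and the majorant 2 + τ of that
    -- factor is at least 1.
    nodal′≤ : ∀ {M} {ns : Vec Node M} → All Good ns → ‖ K.nodal′ ns η ‖ ≤ nat M * hat ns
    nodal′≤ []                                     = ≤-refl
    nodal′≤ {suc M} {ns = (τ , _) ∷ ns} ((1≤τ , _) ∷ good) = ≤-trans
      (‖⊕‖≤′ (K.nodal ns η) ((η ⊕ ι τ) ⊛ K.nodal′ ns η) (nodal≤ good)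
        (‖⊛‖≤′ (η ⊕ ι τ) (K.nodal′ ns η) (‖η+τ‖≤ 1≤τ) (nodal′≤ good)))
      (≤-by ((1ℚ + τ) * hat ns) (0≤-* (0≤-+ 0≤1 (0≤τ 1≤τ)) (0≤hat good))
        (solve 3 (λ t m p → p :+ (con 2ℚ :+ t) :* (m :* p) :+ (con 1ℚ :+ t) :* p
          := (con 1ℚ :+ m) :* ((con 2ℚ :+ t) :* p)) refl τ (nat M) (hat ns)))

    module _ (w : Node → ℚ) (w₀ c₀ Λ : ℚ) (0≤c₀ : 0ℚ ≤ c₀) (0≤Λ : 0ℚ ≤ Λ) (w₀≤ : ∣ w₀ ∣ ≤ Λ * c₀) where

      -- Serves for `weight` with factor 1, bounding f, and for `defect` with constant 0 and factor
      -- Λ, bounding F minus its leading multiple of the nodal polynomial.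
      interpolant≤ : ∀ {M} {ns : Vec Node M} → All Good ns → All (λ n → ∣ w n ∣ ≤ Λ * weight n) ns →
        ‖ K.interpolant w w₀ ns η ‖ ≤ Λ * hatᵢ c₀ ns
      interpolant≤ [] [] = subst (_≤ Λ * c₀) (sym (‖ι‖≡ w₀)) w₀≤
      interpolant≤ {ns = n@(τ , c , _) ∷ ns} ((1≤τ , 0≤c) ∷ good) (w≤ ∷ ws≤) = ≤-trans
        (‖⊕‖≤′ (ι (w n) ⊛ K.nodal ns η) ((η ⊕ ι τ) ⊛ K.interpolant w w₀ ns η)
          (‖⊛‖≤′ (ι (w n)) (K.nodal ns η) (subst (_≤ Λ * c) (sym (‖ι‖≡ (w n))) w≤) (nodal≤ good))
          (‖⊛‖≤′ (η ⊕ ι τ) (K.interpolant w w₀ ns η) (‖η+τ‖≤ 1≤τ) (interpolant≤ good ws≤)))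
        (≤-reflexive (solve 5 (λ l c p t g →
          l :* c :* p :+ (con 2ℚ :+ t) :* (l :* g) := l :* (c :* p :+ (con 2ℚ :+ t) :* g))
          refl Λ c (hat ns) τ (hatᵢ c₀ ns)))

      interpolant′≤ : ∀ {M} {ns : Vec Node M} → All Good ns → All (λ n → ∣ w n ∣ ≤ Λ * weight n) ns →
        ‖ K.interpolant′ w w₀ ns η ‖ ≤ Λ * (nat M * hatᵢ c₀ ns)
      interpolant′≤ [] [] = ≤-reflexive (sym (trans (cong (Λ *_) (*-zeroˡ c₀)) (*-zeroʳ Λ)))
      interpolant′≤ {suc M} {ns = n@(τ , c , _) ∷ ns} ((1≤τ , 0≤c) ∷ good) (w≤ ∷ ws≤) = ≤-trans
        (‖⊕‖≤′ (ι (w n) ⊛ K.nodal′ ns η) (K.interpolant w w₀ ns η ⊕ (η ⊕ ι τ) ⊛ K.interpolant′ w w₀ ns η)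
          (‖⊛‖≤′ (ι (w n)) (K.nodal′ ns η) (subst (_≤ Λ * c) (sym (‖ι‖≡ (w n))) w≤) (nodal′≤ good))
          (‖⊕‖≤′ (K.interpolant w w₀ ns η) ((η ⊕ ι τ) ⊛ K.interpolant′ w w₀ ns η) (interpolant≤ good ws≤)
            (‖⊛‖≤′ (η ⊕ ι τ) (K.interpolant′ w w₀ ns η) (‖η+τ‖≤ 1≤τ) (interpolant′≤ good ws≤))))
        (≤-by (Λ * (c * hat ns + (1ℚ + τ) * hatᵢ c₀ ns))
          (0≤-* 0≤Λ (0≤-+ (0≤-* 0≤c (0≤hat good)) (0≤-* (0≤-+ 0≤1 (0≤τ 1≤τ)) (0≤hatᵢ 0≤c₀ good))))
          (solve 6 (λ l c p t g m →
            l :* c :* (m :* p) :+ (l :* g :+ (con 2ℚ :+ t) :* (l :* (m :* g)))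
              :+ l :* (c :* p :+ (con 1ℚ :+ t) :* g)
            := l :* ((con 1ℚ :+ m) :* (c :* p :+ (con 2ℚ :+ t) :* g)))
            refl Λ c (hat ns) τ (hatᵢ c₀ ns) (nat M)))

  -- Lower bounds in the disc

  1ᴷ : ℂℚ
  1ᴷ = ι 1ℚ

  third : ℚ
  third = + 1 / 3

  27th : ℚ
  27th = third * third * third

  ≤⇒≯ : ∀ {x y} → x ≤ y → ¬ (y < x)
  ≤⇒≯ x≤y y<x = <-irrefl refl (≤-<-trans x≤y y<x)

  by-contradiction : ∀ {x y} → (y < x → x ≤ y) → x ≤ y
  by-contradiction {x} {y} hyp with x ≤? y
  ... | yes x≤y = x≤y
  ... | no x≰y  = hyp (≰⇒> x≰y)

  -- Mirrors _⊛_ on pairs of solver expressions.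
  infixl 8 _:⊛_
  _:⊛_ : ∀ {n} → Q.Polynomial n × Q.Polynomial n → Q.Polynomial n × Q.Polynomial n → Q.Polynomial n × Q.Polynomial n
  (a , b) :⊛ (c , d) = a Q.:* c Q.:+ Q.con (- 1ℚ) Q.:* (b Q.:* d) , a Q.:* d Q.:+ b Q.:* c

  ι-⊛ : ∀ q z → proj₁ (ι q ⊛ z) ≡ q * proj₁ z
  ι-⊛ q (a , b) = Q.solve 3 (λ q a b → q Q.:* a Q.:+ Q.con (- 1ℚ) Q.:* (Q.con 0ℚ Q.:* b) Q.:= q Q.:* a) refl q a b

  ⊛-conjugate : ∀ η τ → (η ⊕ ι τ) ⊛ (conjugate η ⊕ ι τ) ≡ ι (norm² (η ⊕ ι τ))
  ⊛-conjugate (a , b) τ = cong₂ _,_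
    (Q.solve 3 (λ a b t → proj₁ ((a Q.:+ t , b Q.:+ Q.con 0ℚ) :⊛ (a Q.:+ t , Q.:- b Q.:+ Q.con 0ℚ))
      Q.:= (a Q.:+ t) Q.:* (a Q.:+ t) Q.:+ (b Q.:+ Q.con 0ℚ) Q.:* (b Q.:+ Q.con 0ℚ)) refl a b τ)
    (Q.solve 3 (λ a b t → proj₂ ((a Q.:+ t , b Q.:+ Q.con 0ℚ) :⊛ (a Q.:+ t , Q.:- b Q.:+ Q.con 0ℚ))
      Q.:= Q.con 0ℚ) refl a b τ)

  ≤1-of-squares : ∀ x y → x * x + y * y ≤ 1ℚ → x ≤ 1ℚ
  ≤1-of-squares x y sq≤1 = by-contradiction λ 1<x → contradiction
    (<-by ((x - 1ℚ) * (x + 1ℚ) + y * y)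
      (0<-+ˡ (0<-* (<⇒0<- 1<x) (0<-+ˡ (<-trans 0<1 1<x) 0≤1)) (0≤-square y))
      (Q.solve 2 (λ x y → Q.con 1ℚ Q.:+ ((x Q.:- Q.con 1ℚ) Q.:* (x Q.:+ Q.con 1ℚ) Q.:+ y Q.:* y)
        Q.:= x Q.:* x Q.:+ y Q.:* y) refl x y))
    (≤⇒≯ sq≤1)

  ∣∣≤-intro : ∀ {x y} → x ≤ y → - x ≤ y → ∣ x ∣ ≤ y
  ∣∣≤-intro {x} x≤y -x≤y with ∣p∣≡p∨∣p∣≡-p x
  ... | inj₁ eq = subst (_≤ _) (sym eq) x≤y
  ... | inj₂ eq = subst (_≤ _) (sym eq) -x≤y

  module _ where
    open K.Solver

    interchange : ∀ a b c d → (a ⊛ b) ⊛ (c ⊛ d) ≡ (a ⊛ c) ⊛ (b ⊛ d)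
    interchange = solve 4 (λ a b c d → (a :* b) :* (c :* d) := (a :* c) :* (b :* d)) refl

    rotate : ∀ o c d p t f t̄ p̄ →
      o ⊛ (c ⊛ (d ⊛ (p ⊛ p)) ⊕ t ⊛ t ⊛ f) ⊛ ((t̄ ⊛ p̄) ⊛ (t̄ ⊛ p̄))
        ≡ c ⊛ ((p ⊛ p̄) ⊛ ((p ⊛ p̄) ⊛ (o ⊛ d ⊛ (t̄ ⊛ t̄)))) ⊕ (t ⊛ t̄) ⊛ ((t ⊛ t̄) ⊛ (o ⊛ f ⊛ (p̄ ⊛ p̄)))
    rotate = solve 8 (λ o c d p t f t̄ p̄ →
      o :* (c :* (d :* (p :* p)) :+ t :* t :* f) :* ((t̄ :* p̄) :* (t̄ :* p̄))
      := c :* ((p :* p̄) :* ((p :* p̄) :* (o :* d :* (t̄ :* t̄)))) :+ (t :* t̄) :* ((t :* t̄) :* (o :* f :* (p̄ :* p̄)))) refl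

  -- Since 1 - 2h ≤ (1 - h)², the point η keeps distance at least h from the unit circle; bounding
  -- the square avoids a root.
  module Disc (h : ℚ) (0<h : 0ℚ < h) (h≤1 : h ≤ 1ℚ)
              (η : ℂℚ) (N≤ : norm² η ≤ 1ℚ - 2ℚ * h) where
    open Q
    private
      a b : ℚ
      a = proj₁ η
      b = proj₂ η
      0≤h : 0ℚ ≤ h
      0≤h = <⇒≤ 0<h

    norm²≤1 : a * a + b * b ≤ 1ℚ
    norm²≤1 = ≤-trans N≤ (≤-by (2ℚ * h) (0≤-* 0≤2 0≤h)
      (solve 1 (λ h → con 1ℚ :- h :+ h := con 1ℚ) refl (2ℚ * h)))

    -- If 1 + a < h, then -a exceeds 1 - h ≥ 0, so a² would exceed (1 - h)², which is 1 - 2h + h².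
    h≤1+a : h ≤ 1ℚ + a
    h≤1+a = by-contradiction λ 1+a<h → contradiction
      (<-by (h * h + (2ℚ * ((h - (1ℚ + a)) * (1ℚ - h)) + ((h - (1ℚ + a)) * (h - (1ℚ + a)) + b * b)))
        (0<-+ˡ (0<-* 0<h 0<h) (0≤-+ (0≤-* 0≤2 (0≤-* (<⇒≤ (<⇒0<- 1+a<h)) (≤⇒0≤- h≤1)))
          (0≤-+ (0≤-square (h - (1ℚ + a))) (0≤-square b))))
        (solve 3 (λ h a b → let d = h :- (con 1ℚ :+ a) in
          con 1ℚ :- con 2ℚ :* h :+ (h :* h :+ (con 2ℚ :* (d :* (con 1ℚ :- h)) :+ (d :* d :+ b :* b)))
          := a :* a :+ b :* b) refl h a b))
      (≤⇒≯ N≤)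

    a≤1 : a ≤ 1ℚ
    a≤1 = ≤1-of-squares a b norm²≤1

    ‖η‖≤2 : ‖ η ‖ ≤ 2ℚ
    ‖η‖≤2 = +-mono-≤
      (∣∣≤-intro a≤1 (≤1-of-squares (- a) b (subst (_≤ 1ℚ)
        (solve 2 (λ a b → a :* a :+ b :* b := (:- a) :* (:- a) :+ b :* b) refl a b) norm²≤1)))
      (∣∣≤-intro (≤1-of-squares b a (subst (_≤ 1ℚ) (+-comm (a * a) (b * b)) norm²≤1))
        (≤1-of-squares (- b) a (subst (_≤ 1ℚ)
          (solve 2 (λ a b → a :* a :+ b :* b := (:- b) :* (:- b) :+ a :* a) refl a b) norm²≤1)))

    ‖η̄‖≤2 : ‖ conjugate η ‖ ≤ 2ℚ
    ‖η̄‖≤2 = subst (λ x → ∣ a ∣ + x ≤ 2ℚ) (sym (∣-p∣≡∣p∣ b)) ‖η‖≤2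

    -- At τ = 1 the majorant 2 + τ equals 3: there `k` (2 + τ)³ is h³ and `κ` (2 + τ)² is h².
    H k κ : ℚ
    H = h * h * h
    k = 27th * H
    κ = (third * h) * (third * h)

    private
      0≤h² : 0ℚ ≤ h * h
      0≤h² = 0≤-square h
      h²≤h : h * h ≤ h
      h²≤h = subst (h * h ≤_) (*-identityʳ h) (*-monoˡ h 0≤h h≤1)
      H≤h² : H ≤ h * h
      H≤h² = subst (H ≤_) (*-identityʳ (h * h)) (*-monoˡ (h * h) 0≤h² h≤1)
      H≤h : H ≤ h
      H≤h = ≤-trans H≤h² h²≤h
      0<H : 0ℚ < H
      0<H = 0<-* (0<-* 0<h 0<h) 0<h
      0≤H : 0ℚ ≤ H
      0≤H = <⇒≤ 0<H
      0<third : 0ℚ < third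
      0<third = positive⁻¹ third
      0≤27th : 0ℚ ≤ 27th
      0≤27th = <⇒≤ (positive⁻¹ 27th)

    0<k : 0ℚ < k
    0<k = 0<-* (positive⁻¹ 27th) 0<H

    0<κ : 0ℚ < κ
    0<κ = 0<-* (0<-* 0<third 0<h) (0<-* 0<third 0<h)

    k≤h : k ≤ h
    k≤h = ≤-trans (≤-by ((+ 26 / 27) * H) (0≤-* (<⇒≤ (positive⁻¹ (+ 26 / 27))) 0≤H)
      (solve 1 (λ H → con 27th :* H :+ con (+ 26 / 27) :* H := H) refl H)) H≤h

    κ≤1 : κ ≤ 1ℚ
    κ≤1 = *-mono-≤ {third * h} {1ℚ} {third * h} {1ℚ} 0≤j j≤1 0≤j j≤1
      where
      0≤j = <⇒≤ (0<-* 0<third 0<h)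
      j≤1 = ≤-trans (*-monoˡ third (<⇒≤ 0<third) h≤1) (≤-by (+ 2 / 3) (<⇒≤ (positive⁻¹ (+ 2 / 3))) refl)

    -- Both sides are cubics in u = τ - 1 ≥ 0, compared coefficientwise: on the left `H`, `H`, `H`/3
    -- and `H`/27, on the right numbers that are all at least `H`. The constant term on the right is
    -- |1 + η|² (1 - |η|²), since at τ = 1 the factor 1 + η meets its conjugate.
    real-part-lower : ∀ {τ} → 1ℚ ≤ τ →
      k * ((2ℚ + τ) * (2ℚ + τ) * (2ℚ + τ))
        ≤ proj₁ ((1ᴷ ⊕ η) ⊛ (ι τ ⊖ η) ⊛ ((conjugate η ⊕ ι τ) ⊛ (conjugate η ⊕ ι τ)))
    real-part-lower {τ} 1≤τ = begin
      k * ((2ℚ + τ) * (2ℚ + τ) * (2ℚ + τ))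
        ≤⟨ ≤-by (27th * (H * (+ 18 / 1 * (u * u) + + 26 / 1 * (u * u * u))))
             (0≤-* 0≤27th (0≤-* 0≤H (0≤-+ (0≤-* (<⇒≤ (positive⁻¹ (+ 18 / 1))) 0≤u²)
               (0≤-* (<⇒≤ (positive⁻¹ (+ 26 / 1))) 0≤u³))))
             (solve 2 (λ H t → let u = t :- con 1ℚ ; s = con 2ℚ :+ t in
               con 27th :* H :* (s :* s :* s)
                 :+ con 27th :* (H :* (con (+ 18 / 1) :* (u :* u) :+ con (+ 26 / 1) :* (u :* u :* u)))
               := H :+ u :* H :+ u :* u :* H :+ u :* u :* u :* H) refl H τ) ⟩
      H + u * H + u * u * H + u * u * u * H
        ≤⟨ +-mono-≤ (+-mono-≤ (+-mono-≤ e₀ (*-monoˡ u 0≤u e₁)) (*-monoˡ (u * u) 0≤u² e₂)) (*-monoˡ (u * u * u) 0≤u³ e₃) ⟩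
      (1ℚ - N) * s + u * ((+ 3 / 1 - a) * s) + u * u * ((1ℚ + a) * (+ 3 / 1 + a) + + 3 / 1 * (b * b)) + u * u * u * (1ℚ + a)
        ≡⟨ solve 3 (λ a b t →
             let u = t :- con 1ℚ ; α = con 1ℚ :+ a ; s = α :* α :+ b :* b
                 t̄ = (a :+ t , :- b :+ con 0ℚ) in
             (con 1ℚ :- (a :* a :+ b :* b)) :* s :+ u :* ((con (+ 3 / 1) :- a) :* s)
               :+ u :* u :* (α :* (con (+ 3 / 1) :+ a) :+ con (+ 3 / 1) :* (b :* b)) :+ u :* u :* u :* α
             := proj₁ ((con 1ℚ :+ a , con 0ℚ :+ b) :⊛ (t :+ (:- a) , con 0ℚ :+ (:- b)) :⊛ (t̄ :⊛ t̄)))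
             refl a b τ ⟩
      proj₁ ((1ᴷ ⊕ η) ⊛ (ι τ ⊖ η) ⊛ ((conjugate η ⊕ ι τ) ⊛ (conjugate η ⊕ ι τ))) ∎
      where
      open ≤-Reasoning
      u = τ - 1ℚ
      N = a * a + b * b
      s = (1ℚ + a) * (1ℚ + a) + b * b
      0≤u : 0ℚ ≤ u
      0≤u = ≤⇒0≤- 1≤τ
      0≤u² : 0ℚ ≤ u * u
      0≤u² = 0≤-* 0≤u 0≤u
      0≤u³ : 0ℚ ≤ u * u * u
      0≤u³ = 0≤-* 0≤u² 0≤u
      h²≤s : h * h ≤ s
      h²≤s = ≤-trans (*-mono-≤ 0≤h h≤1+a 0≤h h≤1+a) (≤-by (b * b) (0≤-square b) refl)
      e₀ : H ≤ (1ℚ - N) * s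
      e₀ = begin
        h * h * h  ≡⟨ *-comm (h * h) h ⟩
        h * (h * h)  ≤⟨ *-mono-≤ 0≤h (≤-by (h + (1ℚ - 2ℚ * h - N)) (0≤-+ 0≤h (≤⇒0≤- N≤))
                             (solve 2 (λ h N → h :+ (h :+ (con 1ℚ :- con 2ℚ :* h :- N)) := con 1ℚ :- N) refl h N))
                             0≤h² h²≤s ⟩
        (1ℚ - N) * s  ∎
      e₁ : H ≤ (+ 3 / 1 - a) * s
      e₁ = begin
        H  ≤⟨ H≤h² ⟩
        h * h  ≡⟨ *-identityˡ (h * h) ⟨
        1ℚ * (h * h)  ≤⟨ *-mono-≤ 0≤1 (≤-by (1ℚ + (1ℚ - a)) (0≤-+ 0≤1 (≤⇒0≤- a≤1))
                                  (solve 1 (λ a → con 1ℚ :+ (con 1ℚ :+ (con 1ℚ :- a)) := con (+ 3 / 1) :- a) refl a))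
                                  0≤h² h²≤s ⟩
        (+ 3 / 1 - a) * s  ∎
      e₂ : H ≤ (1ℚ + a) * (+ 3 / 1 + a) + + 3 / 1 * (b * b)
      e₂ = begin
        H  ≤⟨ H≤h ⟩
        h  ≡⟨ *-identityʳ h ⟨
        h * 1ℚ  ≤⟨ *-mono-≤ 0≤h h≤1+a 0≤1 (≤-by (1ℚ + (1ℚ + a)) (0≤-+ 0≤1 (≤-trans 0≤h h≤1+a))
                                  (solve 1 (λ a → con 1ℚ :+ (con 1ℚ :+ (con 1ℚ :+ a)) := con (+ 3 / 1) :+ a) refl a)) ⟩
        (1ℚ + a) * (+ 3 / 1 + a)  ≤⟨ ≤-by (+ 3 / 1 * (b * b)) (0≤-* (<⇒≤ (positive⁻¹ (+ 3 / 1))) (0≤-square b)) refl ⟩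
        (1ℚ + a) * (+ 3 / 1 + a) + + 3 / 1 * (b * b)  ∎
      e₃ : H ≤ 1ℚ + a
      e₃ = ≤-trans H≤h h≤1+a

    norm²-lower : ∀ {τ} → 1ℚ ≤ τ → κ * ((2ℚ + τ) * (2ℚ + τ)) ≤ norm² (η ⊕ ι τ)
    norm²-lower {τ} 1≤τ = begin
      κ * ((2ℚ + τ) * (2ℚ + τ))
        ≡⟨ solve 2 (λ j s → j :* j :* (s :* s) := j :* s :* (j :* s)) refl j (2ℚ + τ) ⟩
      j * (2ℚ + τ) * (j * (2ℚ + τ))
        ≤⟨ *-mono-≤ 0≤js js≤ 0≤js js≤ ⟩
      (a + τ) * (a + τ)
        ≤⟨ ≤-by ((b + 0ℚ) * (b + 0ℚ)) (0≤-square (b + 0ℚ)) refl ⟩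
      norm² (η ⊕ ι τ) ∎
      where
      open ≤-Reasoning
      j = third * h
      0≤js : 0ℚ ≤ j * (2ℚ + τ)
      0≤js = 0≤-* (0≤-* (<⇒≤ 0<third) 0≤h) (0≤2+τ 1≤τ)
      js≤ : j * (2ℚ + τ) ≤ a + τ
      js≤ = ≤-by ((1ℚ + a - h) + ((1ℚ - h) * (τ - 1ℚ) + (+ 2 / 3) * (h * (τ - 1ℚ))))
        (0≤-+ (≤⇒0≤- h≤1+a) (0≤-+ (0≤-* (≤⇒0≤- h≤1) (≤⇒0≤- 1≤τ)) (0≤-* (<⇒≤ (positive⁻¹ (+ 2 / 3))) (0≤-* 0≤h (≤⇒0≤- 1≤τ)))))
        (solve 3 (λ a h t → con third :* h :* (con 2ℚ :+ t) :+ ((con 1ℚ :+ a :- h)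
          :+ ((con 1ℚ :- h) :* (t :- con 1ℚ) :+ con (+ 2 / 3) :* (h :* (t :- con 1ℚ))))
          := a :+ t) refl a h τ)

    ν : ∀ {M} → Vec Node M → ℚ
    ν []             = 1ℚ
    ν ((τ , _) ∷ ns) = norm² (η ⊕ ι τ) * ν ns

    nodal-conjugate : ∀ {M} (ns : Vec Node M) → K.nodal ns η ⊛ K.nodal ns (conjugate η) ≡ ι (ν ns)
    nodal-conjugate []             = refl
    nodal-conjugate ((τ , _) ∷ ns) = begin
      (t ⊛ p) ⊛ (t̄ ⊛ p̄)  ≡⟨ interchange t p t̄ p̄ ⟩
      (t ⊛ t̄) ⊛ (p ⊛ p̄)  ≡⟨ cong₂ _⊛_ (⊛-conjugate η τ) (nodal-conjugate ns) ⟩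
      ι (norm² t) ⊛ ι (ν ns)  ≡⟨ ℚ-Algebra.ι-* ℚ[i] (norm² t) (ν ns) ⟨
      ι (norm² t * ν ns)  ∎
      where
      open ≡-Reasoning
      t = η ⊕ ι τ
      t̄ = conjugate η ⊕ ι τ
      p = K.nodal ns η
      p̄ = K.nodal ns (conjugate η)

    γ : ℕ → ℚ
    γ = Evaluation.power ℚ-self κ

    0<γ : ∀ M → 0ℚ < γ M
    0<γ zero    = 0<1
    0<γ (suc M) = 0<-* 0<κ (0<γ M)

    ν-lower : ∀ {M} {ns : Vec Node M} → All Good ns → γ M * (hat ns * hat ns) ≤ ν ns
    ν-lower [] = ≤-refl
    ν-lower {suc M} {ns = (τ , _) ∷ ns} ((1≤τ , _) ∷ good) = begin
      κ * γ M * ((2ℚ + τ) * hat ns * ((2ℚ + τ) * hat ns))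
        ≡⟨ solve 4 (λ κ g s p → κ :* g :* (s :* p :* (s :* p))
             := κ :* (s :* s) :* (g :* (p :* p))) refl κ (γ M) (2ℚ + τ) (hat ns) ⟩
      κ * ((2ℚ + τ) * (2ℚ + τ)) * (γ M * (hat ns * hat ns))
        ≤⟨ *-mono-≤ (0≤-* (<⇒≤ 0<κ) (0≤-square (2ℚ + τ))) (norm²-lower 1≤τ)
             (0≤-* (<⇒≤ (0<γ M)) (0≤-square (hat ns))) (ν-lower good) ⟩
      norm² (η ⊕ ι τ) * ν ns ∎
      where open ≤-Reasoning

    -- The squared conjugate of the nodal polynomial turns the j-th summand of `form` into c_j (τ_j
    -- - η)(η̄ + τ_j)² times the positive real ∏_{i≠j} |η + τ_i|⁴. After multiplication by 1 + η all
    -- real parts are nonnegative, so the summands cannot cancel.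
    rotated : ∀ {M} → ℚ → Vec Node M → ℚ
    rotated c₀ ns = proj₁ ((1ᴷ ⊕ η) ⊛ K.form c₀ ns η ⊛ (K.nodal ns (conjugate η) ⊛ K.nodal ns (conjugate η)))

    rotated-∷ : ∀ {M} c₀ τ c e (ns : Vec Node M) → rotated c₀ ((τ , c , e) ∷ ns) ≡
      c * (ν ns * ν ns * proj₁ ((1ᴷ ⊕ η) ⊛ (ι τ ⊖ η) ⊛ ((conjugate η ⊕ ι τ) ⊛ (conjugate η ⊕ ι τ))))
        + norm² (η ⊕ ι τ) * (norm² (η ⊕ ι τ) * rotated c₀ ns)
    rotated-∷ c₀ τ c e ns = begin
      proj₁ ((1ᴷ ⊕ η) ⊛ (ι c ⊛ ((ι τ ⊖ η) ⊛ (p ⊛ p)) ⊕ t ⊛ t ⊛ f) ⊛ ((t̄ ⊛ p̄) ⊛ (t̄ ⊛ p̄)))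
        ≡⟨ cong proj₁ (rotate (1ᴷ ⊕ η) (ι c) (ι τ ⊖ η) p t f t̄ p̄) ⟩
      proj₁ (ι c ⊛ ((p ⊛ p̄) ⊛ ((p ⊛ p̄) ⊛ E)) ⊕ (t ⊛ t̄) ⊛ ((t ⊛ t̄) ⊛ X))
        ≡⟨ cong₂ (λ x y → proj₁ (ι c ⊛ (x ⊛ (x ⊛ E)) ⊕ y ⊛ (y ⊛ X))) (nodal-conjugate ns) (⊛-conjugate η τ) ⟩
      proj₁ (ι c ⊛ (ι (ν ns) ⊛ (ι (ν ns) ⊛ E))) + proj₁ (ι (norm² t) ⊛ (ι (norm² t) ⊛ X))
        ≡⟨ cong₂ _+_
             (trans (ι-⊛ c (ι (ν ns) ⊛ (ι (ν ns) ⊛ E))) (cong (c *_)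
               (trans (trans (ι-⊛ (ν ns) (ι (ν ns) ⊛ E)) (cong (ν ns *_) (ι-⊛ (ν ns) E))) (sym (*-assoc (ν ns) (ν ns) (proj₁ E))))))
             (trans (ι-⊛ (norm² t) (ι (norm² t) ⊛ X)) (cong (norm² t *_) (ι-⊛ (norm² t) X))) ⟩
      c * (ν ns * ν ns * proj₁ E) + norm² t * (norm² t * rotated c₀ ns) ∎
      where
      open ≡-Reasoning
      t = η ⊕ ι τ
      t̄ = conjugate η ⊕ ι τ
      p = K.nodal ns η
      p̄ = K.nodal ns (conjugate η)
      f = K.form c₀ ns η
      E = (1ᴷ ⊕ η) ⊛ (ι τ ⊖ η) ⊛ (t̄ ⊛ t̄)
      X = (1ᴷ ⊕ η) ⊛ f ⊛ (p̄ ⊛ p̄)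

    rotated-lower : ∀ {M c₀} {ns : Vec Node M} → 0ℚ ≤ c₀ → All Good ns →
      k * (γ M * γ M) * (hatᵢ c₀ ns * (hat ns * hat ns * hat ns)) ≤ rotated c₀ ns
    rotated-lower {c₀ = c₀} 0≤c₀ [] = begin
      k * (1ℚ * 1ℚ) * (c₀ * (1ℚ * 1ℚ * 1ℚ))
        ≡⟨ solve 2 (λ k c → k :* (con 1ℚ :* con 1ℚ) :* (c :* (con 1ℚ :* con 1ℚ :* con 1ℚ)) := c :* k) refl k c₀ ⟩
      c₀ * k
        ≤⟨ *-monoˡ c₀ 0≤c₀ (≤-trans k≤h h≤1+a) ⟩
      c₀ * (1ℚ + a)
        ≡⟨ solve 3 (λ c a b → c :* (con 1ℚ :+ a)
             := proj₁ ((con 1ℚ :+ a , con 0ℚ :+ b) :⊛ (c , con 0ℚ)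
               :⊛ ((con 1ℚ , con 0ℚ) :⊛ (con 1ℚ , con 0ℚ)))) refl c₀ a b ⟩
      rotated c₀ [] ∎
      where open ≤-Reasoning
    rotated-lower {suc M} {c₀} {ns = (τ , c , e) ∷ ns} 0≤c₀ ((1≤τ , 0≤c) ∷ good) = begin
      k * (κ * g * (κ * g)) * ((c * p̂ + s * ĝ) * (s * p̂ * (s * p̂) * (s * p̂)))
        ≡⟨ solve 7 (λ k κ g c p s q →
             k :* (κ :* g :* (κ :* g)) :* ((c :* p :+ s :* q) :* (s :* p :* (s :* p) :* (s :* p)))
             := κ :* κ :* (c :* (g :* (p :* p) :* (g :* (p :* p)) :* (k :* (s :* s :* s))))
               :+ κ :* (s :* s) :* (κ :* (s :* s) :* (k :* (g :* g) :* (q :* (p :* p :* p)))))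
             refl k κ g c p̂ s ĝ ⟩
      κ * κ * (c * (g * (p̂ * p̂) * (g * (p̂ * p̂)) * (k * (s * s * s))))
        + κ * (s * s) * (κ * (s * s) * (k * (g * g) * (ĝ * (p̂ * p̂ * p̂))))
        ≤⟨ +-mono-≤
             -- The norm of the new node does not occur in its own summand, so the factor κ² is
             -- estimated there by 1.
             (*-mono-≤ {κ * κ} {1ℚ} (0≤-square κ) (*-mono-≤ {κ} {1ℚ} {κ} {1ℚ} (<⇒≤ 0<κ) κ≤1 (<⇒≤ 0<κ) κ≤1)
               (0≤-* 0≤c (0≤-* (0≤-* 0≤gp² 0≤gp²) 0≤ks³))
               (*-monoˡ c 0≤c (*-mono-≤ (0≤-* 0≤gp² 0≤gp²) (*-mono-≤ 0≤gp² (ν-lower good) 0≤gp² (ν-lower good))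
                 0≤ks³ (real-part-lower 1≤τ))))
             (*-mono-≤ 0≤κs² (norm²-lower 1≤τ) (0≤-* 0≤κs² 0≤rest)
               (*-mono-≤ 0≤κs² (norm²-lower 1≤τ) 0≤rest (rotated-lower 0≤c₀ good))) ⟩
      1ℚ * (c * (ν ns * ν ns * E)) + N * (N * rotated c₀ ns)
        ≡⟨ cong (_+ N * (N * rotated c₀ ns)) (*-identityˡ (c * (ν ns * ν ns * E))) ⟩
      c * (ν ns * ν ns * E) + N * (N * rotated c₀ ns)
        ≡⟨ rotated-∷ c₀ τ c e ns ⟨
      rotated c₀ ((τ , c , e) ∷ ns) ∎
      where
      open ≤-Reasoning
      g = γ M
      p̂ = hat ns
      ĝ = hatᵢ c₀ ns
      s = 2ℚ + τ
      N = norm² (η ⊕ ι τ)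
      E = proj₁ ((1ᴷ ⊕ η) ⊛ (ι τ ⊖ η) ⊛ ((conjugate η ⊕ ι τ) ⊛ (conjugate η ⊕ ι τ)))
      0≤s : 0ℚ ≤ s
      0≤s = 0≤2+τ 1≤τ
      0≤p̂ : 0ℚ ≤ p̂
      0≤p̂ = 0≤hat good
      0≤gp² : 0ℚ ≤ g * (p̂ * p̂)
      0≤gp² = 0≤-* (<⇒≤ (0<γ M)) (0≤-square p̂)
      0≤ks³ : 0ℚ ≤ k * (s * s * s)
      0≤ks³ = 0≤-* (<⇒≤ 0<k) (0≤-* (0≤-* 0≤s 0≤s) 0≤s)
      0≤κs² : 0ℚ ≤ κ * (s * s)
      0≤κs² = 0≤-* (<⇒≤ 0<κ) (0≤-square s)
      0≤rest : 0ℚ ≤ k * (g * g) * (ĝ * (p̂ * p̂ * p̂))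
      0≤rest = 0≤-* (0≤-* (<⇒≤ 0<k) (0≤-square g)) (0≤-* (0≤hatᵢ 0≤c₀ good) (0≤-* (0≤-square p̂) 0≤p̂))

    -- The squared conjugate factor costs at most two of the three powers of `hat ns` in
    -- `rotated-lower`, and the third is at least 1.
    form-lower : ∀ {M c₀} {ns : Vec Node M} → 0ℚ ≤ c₀ → All Good ns →
      k * (γ M * γ M) * hatᵢ c₀ ns ≤ ‖ (1ᴷ ⊕ η) ⊛ K.form c₀ ns η ‖
    form-lower {M} {c₀} {ns} 0≤c₀ good = *-cancelˡ-≤ (p̂ * p̂) (0<-* 0<p̂ 0<p̂) (begin
      p̂ * p̂ * (Γ * ĝ)
        ≡⟨ *-identityʳ (p̂ * p̂ * (Γ * ĝ)) ⟨
      p̂ * p̂ * (Γ * ĝ) * 1ℚ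
        ≤⟨ *-monoˡ (p̂ * p̂ * (Γ * ĝ)) (0≤-* (0≤-square p̂) (0≤-* (0≤-* (<⇒≤ 0<k) (0≤-square (γ M))) (0≤hatᵢ 0≤c₀ good))) (1≤hat good) ⟩
      p̂ * p̂ * (Γ * ĝ) * p̂
        ≡⟨ solve 3 (λ p G g → p :* p :* (G :* g) :* p := G :* (g :* (p :* p :* p))) refl p̂ Γ ĝ ⟩
      Γ * (ĝ * (p̂ * p̂ * p̂))
        ≤⟨ rotated-lower 0≤c₀ good ⟩
      rotated c₀ ns
        ≤⟨ p≤∣p∣ (rotated c₀ ns) ⟩
      ∣ rotated c₀ ns ∣
        ≤⟨ ∣re∣≤‖‖ (L ⊛ (p̄ ⊛ p̄)) ⟩
      ‖ L ⊛ (p̄ ⊛ p̄) ‖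
        ≤⟨ ‖⊛‖≤′ L (p̄ ⊛ p̄) ≤-refl (‖⊛‖≤′ p̄ p̄ (nodal≤ (conjugate η) ‖η̄‖≤2 good) (nodal≤ (conjugate η) ‖η̄‖≤2 good)) ⟩
      ‖ L ‖ * (p̂ * p̂)
        ≡⟨ *-comm (‖ L ‖) (p̂ * p̂) ⟩
      p̂ * p̂ * ‖ L ‖ ∎)
      where
      open ≤-Reasoning
      Γ = k * (γ M * γ M)
      p̂ = hat ns
      ĝ = hatᵢ c₀ ns
      p̄ = K.nodal ns (conjugate η)
      L = (1ᴷ ⊕ η) ⊛ K.form c₀ ns η
      0<p̂ : 0ℚ < p̂
      0<p̂ = <-≤-trans 0<1 (1≤hat good)
      p≤∣p∣ : ∀ p → p ≤ ∣ p ∣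
      p≤∣p∣ p with ≤-total 0ℚ p
      ... | inj₁ 0≤p = ≤-reflexive (sym (0≤p⇒∣p∣≡p 0≤p))
      ... | inj₂ p≤0 = ≤-trans p≤0 (0≤∣p∣ p)

  -- The Turán form stays away from 0

  evalᴷ derivativeᴷ : ∀ {N} → Vec ℚ N → ℂℚ → ℂℚ
  evalᴷ       = Evaluation.eval ℚ[i]
  derivativeᴷ = derivative ℚ[i]

  turánForm : ∀ {M N} → Vec ℚ M → Vec ℚ N → ℂℚ → ℂℚ
  turánForm f F η =
    (1ᴷ ⊕ η) ⊛ (ι 2ℚ ⊛ (η ⊛ (derivativeᴷ F η ⊛ evalᴷ f η ⊖ evalᴷ F η ⊛ derivativeᴷ f η)) ⊖ evalᴷ f η ⊛ evalᴷ F η)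

  ‖ι⊛‖≡ : ∀ q z → ‖ ι q ⊛ z ‖ ≡ ∣ q ∣ * ‖ z ‖
  ‖ι⊛‖≡ q (a , b) = begin
    ∣ q * a + - 1ℚ * (0ℚ * b) ∣ + ∣ q * b + 0ℚ * a ∣
      ≡⟨ cong₂ (λ x y → ∣ x ∣ + ∣ y ∣)
           (ι-⊛ q (a , b)) (Q.solve 3 (λ q a b → q Q.:* b Q.:+ Q.con 0ℚ Q.:* a Q.:= q Q.:* b) refl q a b) ⟩
    ∣ q * a ∣ + ∣ q * b ∣  ≡⟨ cong₂ _+_ (∣p*q∣≡∣p∣*∣q∣ q a) (∣p*q∣≡∣p∣*∣q∣ q b) ⟩
    ∣ q ∣ * ∣ a ∣ + ∣ q ∣ * ∣ b ∣  ≡⟨ *-distribˡ-+ (∣ q ∣) (∣ a ∣) (∣ b ∣) ⟨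
    ∣ q ∣ * (∣ a ∣ + ∣ b ∣)  ∎
    where open ≡-Reasoning

  admissible⇒good : ∀ {Λ M} {τs : Vec ℚ M} {ns} → All (1ℚ ≤_) τs → Admissible Λ τs ns → All Good ns
  admissible⇒good []           []               = []
  admissible⇒good (1≤τ ∷ 1≤τs) (next 0≤c _ adm) = (1≤τ , 0≤c) ∷ admissible⇒good 1≤τs adm

  admissible⇒defect≤ : ∀ {Λ M} {τs : Vec ℚ M} {ns} → Admissible Λ τs ns →
    All (λ n → ∣ defect n ∣ ≤ Λ * weight n) ns
  admissible⇒defect≤ []               = []
  admissible⇒defect≤ (next _ e≤c adm) = e≤c ∷ admissible⇒defect≤ adm

  good⇒weight≤ : ∀ {M} {ns : Vec Node M} → All Good ns → All (λ n → ∣ weight n ∣ ≤ 1ℚ * weight n) ns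
  good⇒weight≤ = All.map λ {n} (_ , 0≤c) → ≤-reflexive (trans (0≤p⇒∣p∣≡p 0≤c) (sym (*-identityˡ (weight n))))

  represents-dual : ∀ {M} w (f : Vec ℚ (suc M)) ns → Represents w f ns → ∀ η →
    evalᴷ f η ≡ K.interpolant w (last f) ns η × derivativeᴷ f η ≡ K.interpolant′ w (last f) ns η
  represents-dual w f ns repr η =
    trans (sym (eval-dual ℚ[i] f η)) (cong proj₁ eq) , cong proj₂ eq
    where eq = trans (repr (quadratic 0ℚ ℚ[i]) (η , ι 1ℚ)) (K.interpolant-dual w (last f) ns η)

  module Estimate {M} (h : ℚ) (0<h : 0ℚ < h) (h≤1 : h ≤ 1ℚ) (Λ c₀ d₀ : ℚ) (0≤Λ : 0ℚ ≤ Λ)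
                  (0≤c₀ : 0ℚ ≤ c₀) (0≤d₀ : 0ℚ ≤ d₀) (τs : Vec ℚ M) (1≤τs : All (1ℚ ≤_) τs)
                  (ns : Vec Node M) (adm : Admissible Λ τs ns) (η : ℂℚ) (N≤ : norm² η ≤ 1ℚ - 2ℚ * h) where
    open Disc h 0<h h≤1 η N≤

    private
      good = admissible⇒good 1≤τs adm
      ĝ = hatᵢ c₀ ns
      m = nat M
      p p′ g g′ e e′ F F′ Error : ℂℚ
      p  = K.nodal ns η
      p′ = K.nodal′ ns η
      g  = K.interpolant weight c₀ ns η
      g′ = K.interpolant′ weight c₀ ns η
      e  = K.interpolant defect 0ℚ ns η
      e′ = K.interpolant′ defect 0ℚ ns η
      F  = K.interpolant defect d₀ ns η
      F′ = K.interpolant′ defect d₀ ns η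
      Error = ι 2ℚ ⊛ (η ⊛ (e′ ⊛ g ⊖ e ⊛ g′)) ⊖ g ⊛ e

      1*≤ : ∀ {x y} → x ≤ 1ℚ * y → x ≤ y
      1*≤ {x} {y} = subst (x ≤_) (*-identityˡ y)

      c₀≤ : ∣ c₀ ∣ ≤ 1ℚ * c₀
      c₀≤ = ≤-reflexive (trans (0≤p⇒∣p∣≡p 0≤c₀) (sym (*-identityˡ c₀)))

      g≤ : ‖ g ‖ ≤ ĝ
      g≤ = 1*≤ (interpolant≤ η ‖η‖≤2 weight c₀ c₀ 1ℚ 0≤c₀ 0≤1 c₀≤ good (good⇒weight≤ good))
      g′≤ : ‖ g′ ‖ ≤ m * ĝ
      g′≤ = 1*≤ (interpolant′≤ η ‖η‖≤2 weight c₀ c₀ 1ℚ 0≤c₀ 0≤1 c₀≤ good (good⇒weight≤ good))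
      e≤ : ‖ e ‖ ≤ Λ * ĝ
      e≤ = interpolant≤ η ‖η‖≤2 defect 0ℚ c₀ Λ 0≤c₀ 0≤Λ (0≤-* 0≤Λ 0≤c₀) good (admissible⇒defect≤ adm)
      e′≤ : ‖ e′ ‖ ≤ Λ * (m * ĝ)
      e′≤ = interpolant′≤ η ‖η‖≤2 defect 0ℚ c₀ Λ 0≤c₀ 0≤Λ (0≤-* 0≤Λ 0≤c₀) good (admissible⇒defect≤ adm)

      ‖⊖‖≤ : ∀ z w {x y} → ‖ z ‖ ≤ x → ‖ w ‖ ≤ y → ‖ z ⊖ w ‖ ≤ x + y
      ‖⊖‖≤ z w z≤ w≤ = ‖⊕‖≤′ z (⊝ w) z≤ (subst (_≤ _) (sym (‖⊝‖≡ w)) w≤)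

      ‖1+η‖≤ : ‖ 1ᴷ ⊕ η ‖ ≤ 1ℚ + 2ℚ
      ‖1+η‖≤ = ‖⊕‖≤′ 1ᴷ η (≤-reflexive (‖ι‖≡ 1ℚ)) ‖η‖≤2

      error≤ : ‖ (1ᴷ ⊕ η) ⊛ Error ‖ ≤ (1ℚ + 2ℚ) * (2ℚ * (2ℚ * (Λ * (m * ĝ) * ĝ + Λ * ĝ * (m * ĝ))) + ĝ * (Λ * ĝ))
      error≤ = ‖⊛‖≤′ (1ᴷ ⊕ η) Error ‖1+η‖≤
        (‖⊖‖≤ (ι 2ℚ ⊛ (η ⊛ (e′ ⊛ g ⊖ e ⊛ g′))) (g ⊛ e)
          (‖⊛‖≤′ (ι 2ℚ) (η ⊛ (e′ ⊛ g ⊖ e ⊛ g′)) (≤-reflexive (‖ι‖≡ 2ℚ))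
            (‖⊛‖≤′ η (e′ ⊛ g ⊖ e ⊛ g′) ‖η‖≤2
              (‖⊖‖≤ (e′ ⊛ g) (e ⊛ g′) (‖⊛‖≤′ e′ g e′≤ g≤) (‖⊛‖≤′ e g′ e≤ g′≤))))
          (‖⊛‖≤′ g e g≤ e≤))

      T : ℂℚ
      T = (1ᴷ ⊕ η) ⊛ (ι 2ℚ ⊛ (η ⊛ (F′ ⊛ g ⊖ F ⊛ g′)) ⊖ g ⊛ F)

      -- Write F = d₀ P + e with P the nodal polynomial. By `form-identity` the part d₀ P accounts
      -- for -d₀ (1 + η) `form`, and only `e`, whose size is controlled by Λ, enters `Error`.
      main : ι d₀ ⊛ ((1ᴷ ⊕ η) ⊛ K.form c₀ ns η) ≡ (1ᴷ ⊕ η) ⊛ Error ⊖ T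
      main = trans
        (cong (λ v → ι d₀ ⊛ ((1ᴷ ⊕ η) ⊛ v)) (sym (K.form-identity c₀ ns η)))
        (trans
          (solve 8 (λ x d p p′ g g′ e e′ →
            d :* ((con 1ℚ :+ x) :* (g :* p :- con 2ℚ :* (x :* (p′ :* g :- p :* g′))))
            := (con 1ℚ :+ x) :* (con 2ℚ :* (x :* (e′ :* g :- e :* g′)) :- g :* e)
              :- (con 1ℚ :+ x) :* (con 2ℚ :* (x :* ((d :* p′ :+ e′) :* g :- (d :* p :+ e) :* g′)) :- g :* (d :* p :+ e)))
            refl η (ι d₀) p p′ g g′ e e′)
          (cong₂ (λ u v → (1ᴷ ⊕ η) ⊛ Error ⊖ (1ᴷ ⊕ η) ⊛ (ι 2ℚ ⊛ (η ⊛ (v ⊛ g ⊖ u ⊛ g′)) ⊖ g ⊛ u))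
            (sym (K.interpolant-split defect d₀ ns η)) (sym (K.interpolant-split′ defect d₀ ns η))))
        where open K.Solver

    estimate : d₀ * (k * (γ M * γ M) * ĝ) ≤ Λ * ((1ℚ + 2ℚ) * (2ℚ * 2ℚ * 2ℚ * m + 1ℚ) * (ĝ * ĝ)) + ‖ T ‖
    estimate = begin
      d₀ * (k * (γ M * γ M) * ĝ)
        ≤⟨ *-monoˡ d₀ 0≤d₀ (form-lower 0≤c₀ good) ⟩
      d₀ * ‖ (1ᴷ ⊕ η) ⊛ K.form c₀ ns η ‖
        ≡⟨ cong (_* ‖ (1ᴷ ⊕ η) ⊛ K.form c₀ ns η ‖) (0≤p⇒∣p∣≡p 0≤d₀) ⟨
      ∣ d₀ ∣ * ‖ (1ᴷ ⊕ η) ⊛ K.form c₀ ns η ‖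
        ≡⟨ ‖ι⊛‖≡ d₀ ((1ᴷ ⊕ η) ⊛ K.form c₀ ns η) ⟨
      ‖ ι d₀ ⊛ ((1ᴷ ⊕ η) ⊛ K.form c₀ ns η) ‖
        ≡⟨ cong ‖_‖ main ⟩
      ‖ (1ᴷ ⊕ η) ⊛ Error ⊖ T ‖
        ≤⟨ ‖⊖‖≤ ((1ᴷ ⊕ η) ⊛ Error) T error≤ ≤-refl ⟩
      (1ℚ + 2ℚ) * (2ℚ * (2ℚ * (Λ * (m * ĝ) * ĝ + Λ * ĝ * (m * ĝ))) + ĝ * (Λ * ĝ)) + ‖ T ‖
        ≡⟨ cong (_+ ‖ T ‖) (Q.solve 3 (λ l m g → let 2q = Q.con 2ℚ ; 3q = Q.con (1ℚ + 2ℚ) in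
             3q Q.:* (2q Q.:* (2q Q.:* (l Q.:* (m Q.:* g) Q.:* g Q.:+ l Q.:* g Q.:* (m Q.:* g))) Q.:+ g Q.:* (l Q.:* g))
             Q.:= l Q.:* (3q Q.:* (2q Q.:* 2q Q.:* 2q Q.:* m Q.:+ Q.con 1ℚ) Q.:* (g Q.:* g))) refl Λ m ĝ) ⟩
      Λ * ((1ℚ + 2ℚ) * (2ℚ * 2ℚ * 2ℚ * m + 1ℚ) * (ĝ * ĝ)) + ‖ T ‖ ∎
      where open ≤-Reasoning

  -- `ε` is built from `h`, `M`, the leading coefficient of `F` and f(2), none of which involves the
  -- nodes. The tolerance Λ can therefore be adapted to `ε` before nodes are requested.
  turánForm-lower : ∀ {M} (f F : Vec ℚ (suc M)) → 0ℚ ≤ last f → 0ℚ < last F → 0ℚ < evalℚ f 2ℚ →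
    (∀ Λ → 0ℚ < Λ → Σ[ τs ∈ Vec ℚ M ] (All (1ℚ ≤_) τs ×
       ∃[ t ] Alternating Λ (λ x → evalℚ f (- x)) (λ x → evalℚ F (- x)) t τs)) →
    ∀ h → 0ℚ < h → h ≤ 1ℚ →
    ∃[ ε ] (0ℚ < ε × (∀ η → norm² η ≤ 1ℚ - 2ℚ * h → ε ≤ ‖ turánForm f F η ‖))
  turánForm-lower {M} f F 0≤c₀ 0<d₀ 0<v nodes h 0<h h≤1 = ε , 0<ε , bound
    where
    open Q
    v = evalℚ f 2ℚ
    κ = (third * h) * (third * h)
    γ = Evaluation.power ℚ-self κ M
    Γ = 27th * (h * h * h) * (γ * γ)
    0<third*h : 0ℚ < third * h
    0<third*h = 0<-* (positive⁻¹ third) 0<h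
    0<power : ∀ n → 0ℚ < Evaluation.power ℚ-self κ n
    0<power zero    = 0<1
    0<power (suc n) = 0<-* (0<-* 0<third*h 0<third*h) (0<power n)
    0<Γ : 0ℚ < Γ
    0<Γ = 0<-* (0<-* (positive⁻¹ 27th) (0<-* (0<-* 0<h 0<h) 0<h)) (0<-* (0<power M) (0<power M))
    -- Half of the main term; the other half absorbs the error Λ `C`.
    ε = ½ * (last F * (Γ * v))
    0<ε : 0ℚ < ε
    0<ε = 0<-* (positive⁻¹ ½) (0<-* 0<d₀ (0<-* 0<Γ 0<v))
    C = (1ℚ + 2ℚ) * (2ℚ * 2ℚ * 2ℚ * nat M + 1ℚ) * (v * v)
    0≤C : 0ℚ ≤ C
    0≤C = 0≤-* (0≤-* (0≤-+ 0≤1 0≤2) (0≤-+ (0≤-* (0≤-* (0≤-* 0≤2 0≤2) 0≤2) (0≤nat M)) 0≤1)) (0≤-square v)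
    inverse = reciprocal (1ℚ + C) (0<-+ˡ 0<1 0≤C)
    r : ℚ
    r = proj₁ inverse
    0<r : 0ℚ < r
    0<r = proj₁ (proj₂ inverse)
    Λ = ε * r
    0<Λ : 0ℚ < Λ
    0<Λ = 0<-* 0<ε 0<r
    ΛC≤ε : Λ * C ≤ ε
    ΛC≤ε = ≤-by (ε * r) (<⇒≤ 0<Λ) (trans
      (solve 3 (λ e r c → e :* r :* c :+ e :* r := e :* ((con 1ℚ :+ c) :* r)) refl ε r C)
      (trans (cong (ε *_) (proj₂ (proj₂ inverse))) (*-identityʳ ε)))
    found = nodes Λ 0<Λ
    τs : Vec ℚ M
    τs = proj₁ found
    interpolated = interpolate τs f F (proj₂ (proj₂ (proj₂ found)))
    ns : Vec Node M
    ns = proj₁ interpolated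
    adm = proj₁ (proj₂ interpolated)
    repr = proj₁ (proj₂ (proj₂ interpolated))
    repr′ = proj₂ (proj₂ (proj₂ interpolated))
    -- The interpolant reproduces `f` itself, so its majorant is f(2) for every choice of nodes.
    v≡ : v ≡ hatᵢ (last f) ns
    v≡ = repr ℚ-self 2ℚ
    bound : ∀ η → norm² η ≤ 1ℚ - 2ℚ * h → ε ≤ ‖ turánForm f F η ‖
    bound η N≤ = ≤-by (ε - Λ * C + (Λ * C + ‖ T ‖ - last F * (Γ * v)))
      (0≤-+ (≤⇒0≤- ΛC≤ε) (≤⇒0≤- estimate′))
      (trans (solve 3 (λ d c t → let e = con ½ :* d in
        e :+ (e :- c :+ (c :+ t :- d)) := t) refl (last F * (Γ * v)) (Λ * C) (‖ T ‖)) T≡)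
      where
      T : ℂℚ
      T = (1ᴷ ⊕ η) ⊛ (ι 2ℚ ⊛ (η ⊛ (K.interpolant′ defect (last F) ns η ⊛ K.interpolant weight (last f) ns η
            ⊖ K.interpolant defect (last F) ns η ⊛ K.interpolant′ weight (last f) ns η))
            ⊖ K.interpolant weight (last f) ns η ⊛ K.interpolant defect (last F) ns η)
      fᴷ = represents-dual weight f ns repr η
      Fᴷ = represents-dual defect F ns repr′ η
      T≡ : ‖ T ‖ ≡ ‖ turánForm f F η ‖
      T≡ = sym (trans
        (cong₂ (λ a a′ → ‖ (1ᴷ ⊕ η) ⊛ (ι 2ℚ ⊛ (η ⊛ (derivativeᴷ F η ⊛ a ⊖ evalᴷ F η ⊛ a′)) ⊖ a ⊛ evalᴷ F η) ‖)
          (proj₁ fᴷ) (proj₂ fᴷ))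
        (cong₂ (λ b b′ → ‖ (1ᴷ ⊕ η) ⊛ (ι 2ℚ ⊛ (η ⊛ (b′ ⊛ K.interpolant weight (last f) ns η
            ⊖ b ⊛ K.interpolant′ weight (last f) ns η)) ⊖ K.interpolant weight (last f) ns η ⊛ b) ‖)
          (proj₁ Fᴷ) (proj₂ Fᴷ)))
      estimate′ : last F * (Γ * v) ≤ Λ * C + ‖ T ‖
      estimate′ = subst (λ w → last F * (Γ * w) ≤ Λ * ((1ℚ + 2ℚ) * (2ℚ * 2ℚ * 2ℚ * nat M + 1ℚ) * (w * w)) + ‖ T ‖)
        (sym v≡)
        (Estimate.estimate h 0<h h≤1 Λ (last f) (last F) (<⇒≤ 0<Λ) 0≤c₀ (<⇒≤ 0<d₀) τs (proj₁ (proj₂ found)) ns adm η N≤)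

-- Smooth functions on [0 , 1] and bisection

module RolleNodes where
  open import Data.Rational.Base
  open import Data.Rational.Properties
  open Q
  open Estimates

  i≤∣i∣ : ∀ i → i ℤ.≤ + ℤ.∣ i ∣
  i≤∣i∣ (+ n)      = ℤ.≤-refl
  i≤∣i∣ ℤ.-[1+ n ] = ℤ.-≤+

  <nat : ∀ q → ∃[ n ] q < nat n
  <nat q@(mkℚ i d _) = suc ℤ.∣ i ∣ , subst (q <_) (trans (sym (/1≡mkℚ (+ suc ℤ.∣ i ∣))) (/1-nat (suc ℤ.∣ i ∣)))
    (*<* (begin-strict
      i ℤ.* + 1  ≡⟨ ℤ.*-identityʳ i ⟩
      i  ≤⟨ i≤∣i∣ i ⟩
      + ℤ.∣ i ∣  <⟨ +<+ (ℕ.n<1+n ℤ.∣ i ∣) ⟩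
      + suc ℤ.∣ i ∣  ≤⟨ +≤+ (ℕ.m≤m*n (suc ℤ.∣ i ∣) (suc d)) ⟩
      + (suc ℤ.∣ i ∣ ℕ.* suc d)  ≡⟨ ℤ.pos-* (suc ℤ.∣ i ∣) (suc d) ⟩
      + suc ℤ.∣ i ∣ ℤ.* + suc d  ∎))
    where open ℤ.≤-Reasoning

  1≤2^ : ∀ k → 1ℚ ≤ 2^ k
  1≤2^ zero    = ≤-refl
  1≤2^ (suc k) = *-mono-≤ {1ℚ} {2ℚ} {1ℚ} {2^ k} 0≤1 (≤-by 1ℚ 0≤1 refl) 0≤1 (1≤2^ k)

  0<2^ : ∀ k → 0ℚ < 2^ k
  0<2^ k = <-≤-trans 0<1 (1≤2^ k)

  nat≤2^ : ∀ k → nat k ≤ 2^ k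
  nat≤2^ zero    = 0≤1
  nat≤2^ (suc k) = ≤-trans (+-mono-≤ (1≤2^ k) (nat≤2^ k))
    (≤-reflexive (solve 1 (λ x → x :+ x := con 2ℚ :* x) refl (2^ k)))

  archimedean : ∀ q m → 0ℚ < m → ∃[ k ] q < m * 2^ k
  archimedean q m 0<m =
    let r , 0<r , mr≡1 = reciprocal m 0<m
        n , qr<n = <nat (q * r)
    in n , (begin-strict
      q  ≡⟨ *-identityʳ q ⟨
      q * 1ℚ  ≡⟨ cong (q *_) mr≡1 ⟨
      q * (m * r)  ≡⟨ solve 3 (λ q m r → q :* (m :* r) := m :* (q :* r)) refl q m r ⟩
      m * (q * r)  <⟨ *-monoʳ-<-pos m {{positive 0<m}} qr<n ⟩
      m * nat n  ≤⟨ *-monoˡ m (<⇒≤ 0<m) (nat≤2^ n) ⟩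
      m * 2^ n  ∎)
    where open ≤-Reasoning

  Unit : ℚ → Set
  Unit w = 0ℚ ≤ w × w ≤ 1ℚ

  -- Explicit rational constants replace continuity and compactness: from them each bisection below
  -- knows in advance how many halvings it takes. The derivative enters only through a quadratic
  -- Taylor remainder.
  record Smooth (φ φ′ : ℚ → ℚ) : Set where
    field
      bound lipschitz taylor : ℚ
      0≤bound     : 0ℚ ≤ bound
      0≤lipschitz : 0ℚ ≤ lipschitz
      0≤taylor    : 0ℚ ≤ taylor
      ∣φ∣≤   : ∀ {w} → Unit w → ∣ φ w ∣ ≤ bound
      ∣Δφ∣≤  : ∀ {v w} → Unit v → Unit w → ∣ φ v - φ w ∣ ≤ lipschitz * ∣ v - w ∣
      ∣Δ²φ∣≤ : ∀ {v w} → Unit v → Unit w →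
        ∣ φ v - φ w - (v - w) * φ′ w ∣ ≤ taylor * (∣ v - w ∣ * ∣ v - w ∣)

  ∣+∣≤ : ∀ x y {a b} → ∣ x ∣ ≤ a → ∣ y ∣ ≤ b → ∣ x + y ∣ ≤ a + b
  ∣+∣≤ x y x≤a y≤b = ≤-trans (∣p+q∣≤∣p∣+∣q∣ x y) (+-mono-≤ x≤a y≤b)

  ∣*∣≤ : ∀ x y {a b} → ∣ x ∣ ≤ a → ∣ y ∣ ≤ b → ∣ x * y ∣ ≤ a * b
  ∣*∣≤ x y x≤a y≤b = subst (_≤ _) (sym (∣p*q∣≡∣p∣*∣q∣ x y)) (*-mono-≤ (0≤∣p∣ x) x≤a (0≤∣p∣ y) y≤b)

  smooth-const : ∀ c → Smooth (λ _ → c) (λ _ → 0ℚ)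
  smooth-const c = record
    { bound = ∣ c ∣ ; lipschitz = 0ℚ ; taylor = 0ℚ
    ; 0≤bound = 0≤∣p∣ c ; 0≤lipschitz = ≤-refl ; 0≤taylor = ≤-refl
    ; ∣φ∣≤   = λ _ → ≤-refl
    ; ∣Δφ∣≤  = λ {v} {w} _ _ → ≤-reflexive (trans (cong ∣_∣ (+-inverseʳ c)) (sym (*-zeroˡ ∣ v - w ∣)))
    ; ∣Δ²φ∣≤ = λ {v} {w} _ _ → ≤-reflexive (trans
        (cong ∣_∣ (solve 2 (λ c x → c :- c :- x :* con 0ℚ := con 0ℚ) refl c (v - w)))
        (sym (*-zeroˡ (∣ v - w ∣ * ∣ v - w ∣)))) }

  smooth-linear : ∀ {φ φ′ ψ ψ′} p q → Smooth φ φ′ → Smooth ψ ψ′ →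
    Smooth (λ w → p * φ w + q * ψ w) (λ w → p * φ′ w + q * ψ′ w)
  smooth-linear {φ} {φ′} {ψ} {ψ′} p q sφ sψ = record
    { bound     = ∣ p ∣ * φ.bound + ∣ q ∣ * ψ.bound
    ; lipschitz = ∣ p ∣ * φ.lipschitz + ∣ q ∣ * ψ.lipschitz
    ; taylor    = ∣ p ∣ * φ.taylor + ∣ q ∣ * ψ.taylor
    ; 0≤bound     = combine φ.0≤bound ψ.0≤bound
    ; 0≤lipschitz = combine φ.0≤lipschitz ψ.0≤lipschitz
    ; 0≤taylor    = combine φ.0≤taylor ψ.0≤taylor
    ; ∣φ∣≤   = λ {w} Iw → ∣+∣≤ (p * φ w) (q * ψ w)
        (∣*∣≤ p (φ w) ≤-refl (φ.∣φ∣≤ Iw)) (∣*∣≤ q (ψ w) ≤-refl (ψ.∣φ∣≤ Iw))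
    ; ∣Δφ∣≤  = λ {v} {w} Iv Iw → subst (_≤ _)
        (cong ∣_∣ (solve 6 (λ p q a b c d → p :* (a :- b) :+ q :* (c :- d)
          := p :* a :+ q :* c :- (p :* b :+ q :* d)) refl p q (φ v) (φ w) (ψ v) (ψ w)))
        (≤-trans (∣+∣≤ (p * (φ v - φ w)) (q * (ψ v - ψ w))
          (∣*∣≤ p (φ v - φ w) ≤-refl (φ.∣Δφ∣≤ Iv Iw)) (∣*∣≤ q (ψ v - ψ w) ≤-refl (ψ.∣Δφ∣≤ Iv Iw)))
        (≤-reflexive (factor (∣ p ∣) (∣ q ∣) φ.lipschitz ψ.lipschitz (∣ v - w ∣))))
    ; ∣Δ²φ∣≤ = λ {v} {w} Iv Iw → subst (_≤ _)
        (cong ∣_∣ (solve 9 (λ p q a b c d x a′ c′ →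
          p :* (a :- b :- x :* a′) :+ q :* (c :- d :- x :* c′)
          := p :* a :+ q :* c :- (p :* b :+ q :* d) :- x :* (p :* a′ :+ q :* c′))
          refl p q (φ v) (φ w) (ψ v) (ψ w) (v - w) (φ′ w) (ψ′ w)))
        (≤-trans (∣+∣≤ (p * (φ v - φ w - (v - w) * φ′ w)) (q * (ψ v - ψ w - (v - w) * ψ′ w))
          (∣*∣≤ p (φ v - φ w - (v - w) * φ′ w) ≤-refl (φ.∣Δ²φ∣≤ Iv Iw))
          (∣*∣≤ q (ψ v - ψ w - (v - w) * ψ′ w) ≤-refl (ψ.∣Δ²φ∣≤ Iv Iw)))
        (≤-reflexive (factor (∣ p ∣) (∣ q ∣) φ.taylor ψ.taylor (∣ v - w ∣ * ∣ v - w ∣))))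
    }
    where
    module φ = Smooth sφ
    module ψ = Smooth sψ
    combine : ∀ {a b} → 0ℚ ≤ a → 0ℚ ≤ b → 0ℚ ≤ ∣ p ∣ * a + ∣ q ∣ * b
    combine 0≤a 0≤b = 0≤-+ (0≤-* (0≤∣p∣ p) 0≤a) (0≤-* (0≤∣p∣ q) 0≤b)
    factor : ∀ p q a b x → p * (a * x) + q * (b * x) ≡ (p * a + q * b) * x
    factor = solve 5 (λ p q a b x → p :* (a :* x) :+ q :* (b :* x) := (p :* a :+ q :* b) :* x) refl

  smooth-times : ∀ {φ φ′} → Smooth φ φ′ → Smooth (λ w → w * φ w) (λ w → φ w + w * φ′ w)
  smooth-times {φ} {φ′} s = record
    { bound     = 1ℚ * bound
    ; lipschitz = 1ℚ * lipschitz + bound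
    ; taylor    = 1ℚ * taylor + lipschitz
    ; 0≤bound     = 0≤-* 0≤1 0≤bound
    ; 0≤lipschitz = 0≤-+ (0≤-* 0≤1 0≤lipschitz) 0≤bound
    ; 0≤taylor    = 0≤-+ (0≤-* 0≤1 0≤taylor) 0≤lipschitz
    ; ∣φ∣≤   = λ {w} Iw → ∣*∣≤ w (φ w) (∣w∣≤1 Iw) (∣φ∣≤ Iw)
    ; ∣Δφ∣≤  = λ {v} {w} Iv Iw → subst (_≤ _)
        (cong ∣_∣ (solve 4 (λ v w a b → v :* (a :- b) :+ (v :- w) :* b
          := v :* a :- w :* b) refl v w (φ v) (φ w)))
        (≤-trans (∣+∣≤ (v * (φ v - φ w)) ((v - w) * φ w)
          (∣*∣≤ v (φ v - φ w) (∣w∣≤1 Iv) (∣Δφ∣≤ Iv Iw)) (∣*∣≤ (v - w) (φ w) ≤-refl (∣φ∣≤ Iw)))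
        (≤-reflexive (solve 4 (λ o l x b → o :* (l :* x) :+ x :* b := (o :* l :+ b) :* x)
          refl 1ℚ lipschitz (∣ v - w ∣) bound)))
    ; ∣Δ²φ∣≤ = λ {v} {w} Iv Iw → subst (_≤ _)
        (cong ∣_∣ (solve 5 (λ v w a b b′ →
          w :* (a :- b :- (v :- w) :* b′) :+ (v :- w) :* (a :- b)
          := v :* a :- w :* b :- (v :- w) :* (b :+ w :* b′)) refl v w (φ v) (φ w) (φ′ w)))
        (≤-trans (∣+∣≤ (w * (φ v - φ w - (v - w) * φ′ w)) ((v - w) * (φ v - φ w))
          (∣*∣≤ w (φ v - φ w - (v - w) * φ′ w) (∣w∣≤1 Iw) (∣Δ²φ∣≤ Iv Iw))
          (∣*∣≤ (v - w) (φ v - φ w) ≤-refl (∣Δφ∣≤ Iv Iw)))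
        (≤-reflexive (solve 4 (λ o t x l → o :* (t :* (x :* x)) :+ x :* (l :* x)
          := (o :* t :+ l) :* (x :* x)) refl 1ℚ taylor (∣ v - w ∣) lipschitz)))
    }
    where
    open Smooth s
    ∣w∣≤1 : ∀ {w} → Unit w → ∣ w ∣ ≤ 1ℚ
    ∣w∣≤1 (0≤w , w≤1) = subst (_≤ 1ℚ) (sym (0≤p⇒∣p∣≡p 0≤w)) w≤1

  smooth-cong : ∀ {φ φ′ ψ ψ′} → φ ≗ ψ → φ′ ≗ ψ′ → Smooth φ φ′ → Smooth ψ ψ′
  smooth-cong φ≗ψ φ′≗ψ′ s = record
    { bound = bound ; lipschitz = lipschitz ; taylor = taylor
    ; 0≤bound = 0≤bound ; 0≤lipschitz = 0≤lipschitz ; 0≤taylor = 0≤taylor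
    ; ∣φ∣≤   = λ {w} Iw → subst (λ x → ∣ x ∣ ≤ bound) (φ≗ψ w) (∣φ∣≤ Iw)
    ; ∣Δφ∣≤  = λ {v} {w} Iv Iw → subst (λ x → ∣ x ∣ ≤ lipschitz * ∣ v - w ∣)
        (cong₂ _-_ (φ≗ψ v) (φ≗ψ w)) (∣Δφ∣≤ Iv Iw)
    ; ∣Δ²φ∣≤ = λ {v} {w} Iv Iw → subst (λ x → ∣ x ∣ ≤ taylor * (∣ v - w ∣ * ∣ v - w ∣))
        (cong₂ _-_ (cong₂ _-_ (φ≗ψ v) (φ≗ψ w)) (cong ((v - w) *_) (φ′≗ψ′ w))) (∣Δ²φ∣≤ Iv Iw) }
    where open Smooth s

  smooth-neg : ∀ {φ φ′} → Smooth φ φ′ → Smooth (λ w → - φ w) (λ w → - φ′ w)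
  smooth-neg {φ} {φ′} s = smooth-cong (λ w → eq (φ w)) (λ w → eq (φ′ w)) (smooth-linear (- 1ℚ) 0ℚ s (smooth-const 0ℚ))
    where
    eq : ∀ x → - 1ℚ * x + 0ℚ * 0ℚ ≡ - x
    eq = solve 1 (λ x → con (- 1ℚ) :* x :+ con 0ℚ :* con 0ℚ := :- x) refl

  mid : ℚ → ℚ → ℚ
  mid x y = ½ * (x + y)

  module _ {x y : ℚ} (x<y : x < y) where
    private
      0<d : 0ℚ < ½ * (y - x)
      0<d = 0<-* (positive⁻¹ ½) (<⇒0<- x<y)

    x<mid : x < mid x y
    x<mid = <-by (½ * (y - x)) 0<d (solve 2 (λ x y → x :+ con ½ :* (y :- x) := con ½ :* (x :+ y)) refl x y)

    mid<y : mid x y < y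
    mid<y = <-by (½ * (y - x)) 0<d (solve 2 (λ x y → con ½ :* (x :+ y) :+ con ½ :* (y :- x) := y) refl x y)

  halve-< : ∀ K m {z} k → K * z < m * 2^ (suc k) → K * (½ * z) < m * 2^ k
  halve-< K m {z} k hyp = begin-strict
    K * (½ * z)  ≡⟨ solve 2 (λ K z → K :* (con ½ :* z) := con ½ :* (K :* z)) refl K z ⟩
    ½ * (K * z)  <⟨ *-monoʳ-<-pos ½ hyp ⟩
    ½ * (m * (2ℚ * 2^ k))  ≡⟨ solve 2 (λ m x → con ½ :* (m :* (con 2ℚ :* x)) := m :* x) refl m (2^ k) ⟩
    m * 2^ k  ∎
    where open ≤-Reasoning

  mid-x : ∀ x y → mid x y - x ≡ ½ * (y - x)
  mid-x = solve 2 (λ x y → con ½ :* (x :+ y) :- x := con ½ :* (y :- x)) refl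

  y-mid : ∀ x y → y - mid x y ≡ ½ * (y - x)
  y-mid = solve 2 (λ x y → y :- con ½ :* (x :+ y) := con ½ :* (y :- x)) refl

  ∣∣-lower : ∀ {x y} → ∣ x ∣ ≤ y → - x ≤ y
  ∣∣-lower {x} {y} x≤y with ∣p∣≡p∨∣p∣≡-p x | ≤-total 0ℚ x
  ... | _ | inj₁ 0≤x = ≤-trans (neg-antimono-≤ 0≤x) (≤-trans (0≤∣p∣ x) x≤y)
  ... | inj₁ eq | inj₂ x≤0 = ≤-trans (≤-reflexive (cong -_ (≤-antisym x≤0 (subst (0ℚ ≤_) eq (0≤∣p∣ x))))) (≤-trans (0≤∣p∣ x) x≤y)
  ... | inj₂ eq | inj₂ _   = subst (_≤ y) eq x≤y

  ∣∣-upper : ∀ {x y} → ∣ x ∣ ≤ y → x ≤ y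
  ∣∣-upper {x} {y} x≤y = subst (_≤ y) (solve 1 (λ x → :- (:- x) := x) refl x)
    (∣∣-lower (subst (_≤ y) (sym (∣-p∣≡∣p∣ x)) x≤y))

  ∣-∣² : ∀ x → ∣ x ∣ * ∣ x ∣ ≡ x * x
  ∣-∣² x = trans (sym (∣p*q∣≡∣p∣*∣q∣ x x)) (0≤p⇒∣p∣≡p (0≤-square x))

  module _ {φ φ′ : ℚ → ℚ} (s : Smooth φ φ′) where
    open Smooth s

    taylor-upper : ∀ {v w} → Unit v → Unit w → φ v ≤ φ w + (v - w) * φ′ w + taylor * ((v - w) * (v - w))
    taylor-upper {v} {w} Iv Iw = ≤-by (T * D - E)
      (≤⇒0≤- (subst (λ z → E ≤ T * z) (∣-∣² (v - w)) (∣∣-upper (∣Δ²φ∣≤ Iv Iw))))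
      (solve 4 (λ a b x t → a :+ (t :- (a :- b :- x)) := b :+ x :+ t) refl (φ v) (φ w) ((v - w) * φ′ w) (T * D))
      where
      T = taylor
      D = (v - w) * (v - w)
      E = φ v - φ w - (v - w) * φ′ w

    taylor-lower : ∀ {v w} → Unit v → Unit w → φ w + (v - w) * φ′ w ≤ φ v + taylor * ((v - w) * (v - w))
    taylor-lower {v} {w} Iv Iw = ≤-by (T * D - - E)
      (≤⇒0≤- (subst (λ z → - E ≤ T * z) (∣-∣² (v - w)) (∣∣-lower (∣Δ²φ∣≤ Iv Iw))))
      (solve 4 (λ a b x t → b :+ x :+ (t :- (:- (a :- b :- x))) := a :+ t) refl (φ v) (φ w) ((v - w) * φ′ w) (T * D))
      where
      T = taylor
      D = (v - w) * (v - w)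
      E = φ v - φ w - (v - w) * φ′ w

    private
      inside : ∀ {x y z} → Unit x → Unit y → x ≤ z → z ≤ y → Unit z
      inside (0≤x , _) (_ , y≤1) x≤z z≤y = ≤-trans 0≤x x≤z , ≤-trans z≤y y≤1

    -- Bisection keeps a half on which φ still falls with mean slope at least m. Once taylor · (y -
    -- x) < m, the Taylor bounds between the midpoint and both ends give φ′ ≤ ½ · taylor · (y - x) -
    -- m < 0 at the midpoint.
    mean-value-bisect : ∀ k m x y → 0ℚ < m → Unit x → Unit y → x < y →
      m * (y - x) ≤ φ x - φ y → taylor * (y - x) < m * 2^ k →
      ∃[ t ] (x < t × t < y × φ′ t < 0ℚ)
    mean-value-bisect zero m x y 0<m Ix Iy x<y slope small =
      c , x<mid x<y , mid<y x<y , φ′c<0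
      where
      c = mid x y
      d = y - x
      T = taylor
      0<d : 0ℚ < d
      0<d = <⇒0<- x<y
      Ic = inside Ix Iy (<⇒≤ (x<mid x<y)) (<⇒≤ (mid<y x<y))
      at-x : φ x ≤ φ c + (x - c) * φ′ c + T * ((x - c) * (x - c))
      at-x = taylor-upper Ix Ic
      at-y : φ c + (y - c) * φ′ c ≤ φ y + T * ((y - c) * (y - c))
      at-y = taylor-lower Iy Ic
      φ′c<0 : φ′ c < 0ℚ
      φ′c<0 = *-cancelˡ-<-nonNeg d {{nonNegative (<⇒≤ 0<d)}} (begin-strict
        d * φ′ c
          ≤⟨ ≤-by ((φ x - φ y - m * d) + ((φ c + (x - c) * φ′ c + T * ((x - c) * (x - c)) - φ x)
                   + (φ y + T * ((y - c) * (y - c)) - (φ c + (y - c) * φ′ c))))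
               (0≤-+ (≤⇒0≤- slope) (0≤-+ (≤⇒0≤- at-x) (≤⇒0≤- at-y)))
               (solve 8 (λ x y m T a b f g → let c = con ½ :* (x :+ y) ; d = y :- x in
                 d :* g :+ ((a :- b :- m :* d)
                   :+ ((f :+ (x :- c) :* g :+ T :* ((x :- c) :* (x :- c)) :- a)
                   :+ (b :+ T :* ((y :- c) :* (y :- c)) :- (f :+ (y :- c) :* g))))
                 := d :* (con ½ :* (T :* d) :- m)) refl x y m T (φ x) (φ y) (φ c) (φ′ c)) ⟩
        d * (½ * (T * d) - m)
          <⟨ *-monoʳ-<-pos d {{positive 0<d}} (<-by (½ * (T * d) + (m * 1ℚ - T * d))
               (subst (0ℚ <_) (+-comm (m * 1ℚ - T * d) (½ * (T * d)))
                 (0<-+ˡ (<⇒0<- small) (0≤-* (<⇒≤ (positive⁻¹ ½)) (0≤-* 0≤taylor (<⇒≤ 0<d)))))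
               (solve 2 (λ z m → con ½ :* z :- m :+ (con ½ :* z :+ (m :* con 1ℚ :- z)) := con 0ℚ) refl (T * d) m)) ⟩
        d * 0ℚ ∎)
        where open ≤-Reasoning
    mean-value-bisect (suc k) m x y 0<m Ix Iy x<y slope small = choose (≤-total (m * (c - x)) (φ x - φ c))
      where
      c = mid x y
      Ic = inside Ix Iy (<⇒≤ (x<mid x<y)) (<⇒≤ (mid<y x<y))
      choose : m * (c - x) ≤ φ x - φ c ⊎ φ x - φ c ≤ m * (c - x) → ∃[ t ] (x < t × t < y × φ′ t < 0ℚ)
      choose (inj₁ left) =
        let t , x<t , t<c , neg = mean-value-bisect k m x c 0<m Ix Ic (x<mid x<y) left
              (subst (λ z → taylor * z < m * 2^ k) (sym (mid-x x y)) (halve-< taylor m k small))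
        in t , x<t , <-trans t<c (mid<y x<y) , neg
      choose (inj₂ right) =
        let t , c<t , t<y , neg = mean-value-bisect k m c y 0<m Ic Iy (mid<y x<y)
              (≤-by ((φ x - φ y - m * (y - x)) + (m * (c - x) - (φ x - φ c)))
                (0≤-+ (≤⇒0≤- slope) (≤⇒0≤- right))
                (solve 7 (λ m c x y a b f → m :* (y :- c) :+ ((a :- b :- m :* (y :- x))
                  :+ (m :* (c :- x) :- (a :- f))) := f :- b) refl m c x y (φ x) (φ y) (φ c)))
              (subst (λ z → taylor * z < m * 2^ k) (sym (y-mid x y)) (halve-< taylor m k small))
        in t , <-trans (x<mid x<y) c<t , t<y , neg

    mean-value : ∀ x y → Unit x → Unit y → x < y → φ y < φ x → ∃[ t ] (x < t × t < y × φ′ t < 0ℚ)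
    mean-value x y Ix Iy x<y φy<φx =
      let r , 0<r , dr≡1 = reciprocal (y - x) (<⇒0<- x<y)
          m = (φ x - φ y) * r
          0<m = 0<-* (<⇒0<- φy<φx) 0<r
          k , small = archimedean (taylor * (y - x)) m 0<m
      in mean-value-bisect k m x y 0<m Ix Iy x<y
        (≤-reflexive (trans (solve 3 (λ f r d → f :* r :* d := d :* r :* f) refl (φ x - φ y) r (y - x))
          (trans (cong (_* (φ x - φ y)) dr≡1) (*-identityˡ (φ x - φ y)))))
        small

    -- The target is a band and not a value, as exact preimages need not be rational. With no
    -- halvings left, the Lipschitz bound rules out a climb from `lo` to `hi` over so short an
    -- interval.
    intermediate-bisect : ∀ k lo hi x y → lo < hi → Unit x → Unit y → x < y → φ x ≤ lo → hi ≤ φ y →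
      lipschitz * (y - x) < (hi - lo) * 2^ k →
      ∃[ b ] (x < b × b < y × lo ≤ φ b × φ b ≤ hi)
    intermediate-bisect zero lo hi x y lo<hi Ix Iy x<y x≤lo hi≤y small = contradiction
      (begin-strict
        hi - lo  ≤⟨ +-mono-≤ hi≤y (neg-antimono-≤ x≤lo) ⟩
        φ y - φ x  ≤⟨ ∣∣-upper (∣Δφ∣≤ Iy Ix) ⟩
        lipschitz * ∣ y - x ∣  ≡⟨ cong (lipschitz *_) (0≤p⇒∣p∣≡p (<⇒≤ (<⇒0<- x<y))) ⟩
        lipschitz * (y - x)  <⟨ small ⟩
        (hi - lo) * 1ℚ  ≡⟨ *-identityʳ (hi - lo) ⟩
        hi - lo  ∎)
      (<-irrefl refl)
      where open ≤-Reasoning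
    intermediate-bisect (suc k) lo hi x y lo<hi Ix Iy x<y x≤lo hi≤y small =
      choose (≤-total lo (φ c)) (≤-total (φ c) hi)
      where
      c = mid x y
      Ic = inside Ix Iy (<⇒≤ (x<mid x<y)) (<⇒≤ (mid<y x<y))
      choose : lo ≤ φ c ⊎ φ c ≤ lo → φ c ≤ hi ⊎ hi ≤ φ c → ∃[ b ] (x < b × b < y × lo ≤ φ b × φ b ≤ hi)
      choose (inj₁ lo≤) (inj₁ ≤hi) = c , x<mid x<y , mid<y x<y , lo≤ , ≤hi
      choose (inj₁ lo≤) (inj₂ hi≤) =
        let b , x<b , b<c , between = intermediate-bisect k lo hi x c lo<hi Ix Ic (x<mid x<y) x≤lo hi≤
              (subst (λ z → lipschitz * z < (hi - lo) * 2^ k) (sym (mid-x x y)) (halve-< lipschitz (hi - lo) k small))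
        in b , x<b , <-trans b<c (mid<y x<y) , between
      choose (inj₂ ≤lo) _ =
        let b , c<b , b<y , between = intermediate-bisect k lo hi c y lo<hi Ic Iy (mid<y x<y) ≤lo hi≤y
              (subst (λ z → lipschitz * z < (hi - lo) * 2^ k) (sym (y-mid x y)) (halve-< lipschitz (hi - lo) k small))
        in b , <-trans (x<mid x<y) c<b , b<y , between

    intermediate : ∀ x y → Unit x → Unit y → x < y → φ x < φ y →
      ∃[ b ] (x < b × b < y × φ x ≤ φ b × φ b ≤ φ y)
    intermediate x y Ix Iy x<y φx<φy =
      let k , small = archimedean (lipschitz * (y - x)) (φ y - φ x) (<⇒0<- φx<φy)
      in intermediate-bisect k (φ x) (φ y) x y φx<φy Ix Iy x<y ≤-refl ≤-refl small

    -- The middle point of the triple always carries the largest value; replacing an end by a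
    -- midpoint halves the distances.
    near-maximum-bisect : ∀ k δ z x c y → Unit x → Unit y → x < c → c < y → φ x ≤ φ c → φ y ≤ φ c →
      c - x ≤ z → y - c ≤ z → taylor * z < δ * 2^ k →
      ∃[ t ] (x < t × t < y × φ c ≤ φ t × ∣ φ′ t ∣ ≤ δ)
    near-maximum-bisect zero δ z x c y Ix Iy x<c c<y φx≤ φy≤ l≤ r≤ small =
      c , x<c , c<y , ≤-refl , ∣∣≤-intro right left
      where
      open ≤-Reasoning
      T = taylor
      Ic = inside Ix Iy (<⇒≤ x<c) (<⇒≤ c<y)
      T*≤δ : ∀ {d} → d ≤ z → T * d ≤ δ
      T*≤δ {d} d≤z = begin
        T * d  ≤⟨ *-monoˡ T 0≤taylor d≤z ⟩
        T * z  ≤⟨ <⇒≤ small ⟩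
        δ * 1ℚ  ≡⟨ *-identityʳ δ ⟩
        δ  ∎
      -- As φ y ≤ φ c, the Taylor bound at y leaves (y - c) φ′ c ≤ taylor · (y - c)²; the left end
      -- gives the opposite sign.
      right : φ′ c ≤ δ
      right = ≤-trans (*-cancelˡ-≤ (y - c) (<⇒0<- c<y)
        (≤-by ((φ y + T * ((y - c) * (y - c)) - (φ c + (y - c) * φ′ c)) + (φ c - φ y))
          (0≤-+ (≤⇒0≤- (taylor-lower Iy Ic)) (≤⇒0≤- φy≤))
          (solve 5 (λ d T a f g → d :* g :+ ((a :+ T :* (d :* d) :- (f :+ d :* g)) :+ (f :- a))
            := d :* (T :* d)) refl (y - c) T (φ y) (φ c) (φ′ c)))) (T*≤δ r≤)
      left : - φ′ c ≤ δ
      left = ≤-trans (*-cancelˡ-≤ (c - x) (<⇒0<- x<c)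
        (≤-by ((φ x + T * ((x - c) * (x - c)) - (φ c + (x - c) * φ′ c)) + (φ c - φ x))
          (0≤-+ (≤⇒0≤- (taylor-lower Ix Ic)) (≤⇒0≤- φx≤))
          (solve 6 (λ c x T a f g → (c :- x) :* (:- g)
            :+ ((a :+ T :* ((x :- c) :* (x :- c)) :- (f :+ (x :- c) :* g)) :+ (f :- a))
            := (c :- x) :* (T :* (c :- x))) refl c x T (φ x) (φ c) (φ′ c)))) (T*≤δ l≤)
    near-maximum-bisect (suc k) δ z x c y Ix Iy x<c c<y φx≤ φy≤ l≤ r≤ small =
      choose (≤-total (φ c) (φ p)) (≤-total (φ c) (φ q))
      where
      p = mid x c
      q = mid c y
      Ic = inside Ix Iy (<⇒≤ x<c) (<⇒≤ c<y)
      small′ = halve-< taylor δ k small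
      half≤ : ∀ {d e} → d ≤ z → e ≡ ½ * d → e ≤ ½ * z
      half≤ d≤z refl = *-monoˡ ½ (<⇒≤ (positive⁻¹ ½)) d≤z
      choose : φ c ≤ φ p ⊎ φ p ≤ φ c → φ c ≤ φ q ⊎ φ q ≤ φ c → ∃[ t ] (x < t × t < y × φ c ≤ φ t × ∣ φ′ t ∣ ≤ δ)
      choose (inj₁ c≤p) _ =
        let t , x<t , t<c , p≤t , flat = near-maximum-bisect k δ (½ * z) x p c Ix Ic (x<mid x<c) (mid<y x<c)
              (≤-trans φx≤ c≤p) c≤p (half≤ l≤ (mid-x x c)) (half≤ l≤ (y-mid x c)) small′
        in t , x<t , <-trans t<c c<y , ≤-trans c≤p p≤t , flat
      choose (inj₂ p≤c) (inj₁ c≤q) =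
        let t , c<t , t<y , q≤t , flat = near-maximum-bisect k δ (½ * z) c q y Ic Iy (x<mid c<y) (mid<y c<y)
              c≤q (≤-trans φy≤ c≤q) (half≤ r≤ (mid-x c y)) (half≤ r≤ (y-mid c y)) small′
        in t , <-trans x<c c<t , t<y , ≤-trans c≤q q≤t , flat
      choose (inj₂ p≤c) (inj₂ q≤c) =
        let t , p<t , t<q , c≤t , flat = near-maximum-bisect k δ (½ * z) p c q
              (inside Ix Ic (<⇒≤ (x<mid x<c)) (<⇒≤ (mid<y x<c))) (inside Ic Iy (<⇒≤ (x<mid c<y)) (<⇒≤ (mid<y c<y)))
              (mid<y x<c) (x<mid c<y) p≤c q≤c (half≤ l≤ (y-mid x c)) (half≤ r≤ (mid-x c y)) small′
        in t , <-trans (x<mid x<c) p<t , <-trans t<q (mid<y c<y) , c≤t , flat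

    near-maximum : ∀ δ x c y → 0ℚ < δ → Unit x → Unit y → x < c → c < y → φ x ≤ φ c → φ y ≤ φ c →
      ∃[ t ] (x < t × t < y × φ c ≤ φ t × ∣ φ′ t ∣ ≤ δ)
    near-maximum δ x c y 0<δ Ix Iy x<c c<y φx≤ φy≤ =
      let k , small = archimedean (taylor * (y - x)) δ 0<δ
      in near-maximum-bisect k δ (y - x) x c y Ix Iy x<c c<y φx≤ φy≤
        (+-monoˡ-≤ (- x) (<⇒≤ c<y)) (+-monoʳ-≤ y (neg-antimono-≤ (<⇒≤ x<c))) small

  -- The functions σ and their derivatives

  _^_ : ℚ → ℕ → ℚ
  _^_ = Evaluation.power ℚ-self
  infixr 8 _^_

  0<^ : ∀ {w} → 0ℚ < w → ∀ n → 0ℚ < w ^ n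
  0<^ 0<w zero    = 0<1
  0<^ 0<w (suc n) = 0<-* 0<w (0<^ 0<w n)

  smooth-^ : ∀ e → Smooth (_^ e) (λ w → nat e * w ^ (e ∸ 1))
  smooth-^ zero    = smooth-cong (λ _ → refl) (λ _ → refl) (smooth-const 1ℚ)
  smooth-^ (suc e) = smooth-cong (λ _ → refl) (derivative-^ e) (smooth-times (smooth-^ e))
    where
    derivative-^ : ∀ e w → w ^ e + w * (nat e * w ^ (e ∸ 1)) ≡ nat (suc e) * w ^ e
    derivative-^ zero    = solve 1 (λ w → con 1ℚ :+ w :* (con 0ℚ :* con 1ℚ)
      := (con 1ℚ :+ con 0ℚ) :* con 1ℚ) refl
    derivative-^ (suc e) w = solve 3 (λ w n p → w :* p :+ w :* ((con 1ℚ :+ n) :* p)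
      := (con 1ℚ :+ (con 1ℚ :+ n)) :* (w :* p)) refl w (nat e) (w ^ e)

  -- Σ_b (−1)^b a(b) w^(e−2b) and its derivative; they are only used when a(b) = 0 for 2b > e.
  S S′ : ℕ → (ℕ → ℚ) → ℕ → ℚ → ℚ
  S e a zero    w = 0ℚ
  S e a (suc N) w = a 0 * w ^ e - S (e ∸ 2) (a ∘ suc) N w
  S′ e a zero    w = 0ℚ
  S′ e a (suc N) w = a 0 * (nat e * w ^ (e ∸ 1)) - S′ (e ∸ 2) (a ∘ suc) N w

  smooth-S : ∀ e a N → Smooth (S e a N) (S′ e a N)
  smooth-S e a zero    = smooth-const 0ℚ
  smooth-S e a (suc N) = smooth-cong
    (λ w → eq (a 0) (w ^ e) (S (e ∸ 2) (a ∘ suc) N w))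
    (λ w → eq (a 0) (nat e * w ^ (e ∸ 1)) (S′ (e ∸ 2) (a ∘ suc) N w))
    (smooth-linear (a 0) (- 1ℚ) (smooth-^ e) (smooth-S (e ∸ 2) (a ∘ suc) N))
    where
    eq : ∀ a x y → a * x + - 1ℚ * y ≡ a * x - y
    eq = solve 3 (λ a x y → a :* x :+ con (- 1ℚ) :* y := a :* x :- y) refl

  -- Makes the truncated exponent e ∸ 2 in `S` harmless: once e < 2, all further coefficients are 0.
  Fits : ℕ → (ℕ → ℚ) → Set
  Fits e a = ∀ k → e ℕ.< k ℕ.+ k → a k ≡ 0ℚ

  fits-suc : ∀ {e a} → Fits e a → Fits (e ∸ 2) (a ∘ suc)
  fits-suc {e} fits k e-2<2k = fits (suc k) (subst (e ℕ.<_) (sym (cong suc (ℕ.+-suc k k)))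
    (ℕ.≤-<-trans (ℕ.m≤n+m∸n e 2) (ℕ.+-monoʳ-< 2 e-2<2k)))

  fits-<2 : ∀ {e a} → e ℕ.< 2 → Fits e a → a ∘ suc ≗ (λ _ → 0ℚ)
  fits-<2 {e} e<2 fits k = fits (suc k) (ℕ.<-≤-trans e<2 (s≤s (subst (1 ℕ.≤_) (sym (ℕ.+-suc k k)) (s≤s z≤n))))

  S-cong : ∀ {a b} → a ≗ b → ∀ e N w → S e a N w ≡ S e b N w
  S-cong a≗b e zero    w = refl
  S-cong a≗b e (suc N) w =
    cong₂ (λ x y → x * w ^ e - y) (a≗b 0) (S-cong (λ k → a≗b (suc k)) (e ∸ 2) N w)

  S-0 : ∀ {a} → a ≗ (λ _ → 0ℚ) → ∀ e N w → S e a N w ≡ 0ℚ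
  S-0 a≗0 e zero    w = refl
  S-0 a≗0 e (suc N) w = trans
    (cong₂ (λ x y → x * w ^ e - y) (a≗0 0) (S-0 (λ k → a≗0 (suc k)) (e ∸ 2) N w))
    (solve 1 (λ p → con 0ℚ :* p :- con 0ℚ := con 0ℚ) refl (w ^ e))

  S-+ : ∀ e a b N w → S e (λ k → a k + b k) N w ≡ S e a N w + S e b N w
  S-+ e a b zero    w = refl
  S-+ e a b (suc N) w = trans
    (cong (λ y → (a 0 + b 0) * w ^ e - y) (S-+ (e ∸ 2) (a ∘ suc) (b ∘ suc) N w))
    (solve 5 (λ a b p x y → (a :+ b) :* p :- (x :+ y) := a :* p :- x :+ (b :* p :- y))
      refl (a 0) (b 0) (w ^ e) (S (e ∸ 2) (a ∘ suc) N w) (S (e ∸ 2) (b ∘ suc) N w))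

  S-top : ∀ e a N w → a N ≡ 0ℚ → S e a (suc N) w ≡ S e a N w
  S-top e a zero    w a≡0 = trans (cong (λ x → x * w ^ e - 0ℚ) a≡0)
    (solve 1 (λ p → con 0ℚ :* p :- con 0ℚ := con 0ℚ) refl (w ^ e))
  S-top e a (suc N) w a≡0 = cong (λ y → a 0 * w ^ e - y) (S-top (e ∸ 2) (a ∘ suc) N w a≡0)

  θ-suc : ∀ e a → Fits e a → θ (nat (e ∸ 2)) (a ∘ suc) ≗ θ (nat e) a ∘ suc
  θ-suc zero          a fits k = trans (θ-vanishes 0ℚ (a ∘ suc) k (fits-<2 (s≤s z≤n) fits k))
    (sym (θ-vanishes 0ℚ a (suc k) (fits-<2 (s≤s z≤n) fits k)))
  θ-suc (suc zero)    a fits k = trans (θ-vanishes 0ℚ (a ∘ suc) k (fits-<2 (s≤s (s≤s z≤n)) fits k))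
    (sym (θ-vanishes (nat 1) a (suc k) (fits-<2 (s≤s (s≤s z≤n)) fits k)))
  θ-suc (suc (suc e)) a fits k = solve 3 (λ n k a → (n :- con 2ℚ :* k) :* a
    := (con 1ℚ :+ (con 1ℚ :+ n) :- con 2ℚ :* (con 1ℚ :+ k)) :* a)
    refl (nat e) (nat k) (a (suc k))

  ∸-swap : ∀ e → e ∸ 2 ∸ 1 ≡ e ∸ 1 ∸ 2
  ∸-swap e = trans (ℕ.∸-+-assoc e 2 1) (sym (ℕ.∸-+-assoc e 1 2))

  -- Termwise differentiation multiplies a(b) by the exponent e - 2b, which is the action of `θ`.
  S′≡S : ∀ e a N w → Fits e a → S′ e a N w ≡ S (e ∸ 1) (θ (nat e) a) N w
  S′≡S e a zero    w fits = refl
  S′≡S e a (suc N) w fits = cong₂ _-_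
    (solve 3 (λ n a p → a :* (n :* p) := (n :- con 2ℚ :* con 0ℚ) :* a :* p) refl (nat e) (a 0) (w ^ (e ∸ 1)))
    (begin
      S′ (e ∸ 2) (a ∘ suc) N w  ≡⟨ S′≡S (e ∸ 2) (a ∘ suc) N w (fits-suc fits) ⟩
      S (e ∸ 2 ∸ 1) (θ (nat (e ∸ 2)) (a ∘ suc)) N w  ≡⟨ S-cong (θ-suc e a fits) (e ∸ 2 ∸ 1) N w ⟩
      S (e ∸ 2 ∸ 1) (θ (nat e) a ∘ suc) N w  ≡⟨ cong (λ d → S d (θ (nat e) a ∘ suc) N w) (∸-swap e) ⟩
      S (e ∸ 1 ∸ 2) (θ (nat e) a ∘ suc) N w  ∎)
    where open ≡-Reasoning

  S-2+∸2 : ∀ e a N w → Fits e a → S (2 ℕ.+ (e ∸ 2)) (a ∘ suc) N w ≡ S e (a ∘ suc) N w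
  S-2+∸2 zero          a N w fits = trans (S-0 (fits-<2 (s≤s z≤n) fits) 2 N w) (sym (S-0 (fits-<2 (s≤s z≤n) fits) 0 N w))
  S-2+∸2 (suc zero)    a N w fits =
    trans (S-0 (fits-<2 (s≤s (s≤s z≤n)) fits) 2 N w) (sym (S-0 (fits-<2 (s≤s (s≤s z≤n)) fits) 1 N w))
  S-2+∸2 (suc (suc e)) a N w fits = refl

  S-raise : ∀ e a N w → Fits e a → w * w * S e a N w ≡ S (2 ℕ.+ e) a N w
  S-raise e a zero    w fits = *-zeroʳ (w * w)
  S-raise e a (suc N) w fits = begin
    w * w * (a 0 * w ^ e - S (e ∸ 2) (a ∘ suc) N w)
      ≡⟨ solve 4 (λ w a p s → w :* w :* (a :* p :- s) := a :* (w :* (w :* p)) :- w :* w :* s)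
           refl w (a 0) (w ^ e) (S (e ∸ 2) (a ∘ suc) N w) ⟩
    a 0 * w ^ (2 ℕ.+ e) - w * w * S (e ∸ 2) (a ∘ suc) N w
      ≡⟨ cong (λ y → a 0 * w ^ (2 ℕ.+ e) - y) (trans (S-raise (e ∸ 2) (a ∘ suc) N w (fits-suc fits)) (S-2+∸2 e a N w fits)) ⟩
    a 0 * w ^ (2 ℕ.+ e) - S e (a ∘ suc) N w ∎
    where open ≡-Reasoning

  -- For τ w² = 1 the power w^(e-2b) is w^e τ^b.
  S-horner : ∀ e a N w τ → Fits e a → τ * (w * w) ≡ 1ℚ → S e a N w ≡ w ^ e * evalℚ (coeffs a N) (- τ)
  S-horner e a zero    w τ fits τw²≡1 = sym (*-zeroʳ (w ^ e))
  S-horner e a (suc N) w τ fits τw²≡1 = begin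
    a 0 * w ^ e - S (e ∸ 2) (a ∘ suc) N w
      ≡⟨ cong (λ y → a 0 * w ^ e - y) lower ⟩
    a 0 * w ^ e - τ * (w ^ e * v)
      ≡⟨ solve 4 (λ a p t v → a :* p :- t :* (p :* v) := p :* (a :+ (:- t) :* v)) refl (a 0) (w ^ e) τ v ⟩
    w ^ e * (a 0 + - τ * v) ∎
    where
    open ≡-Reasoning
    v = evalℚ (coeffs (a ∘ suc) N) (- τ)
    lower : S (e ∸ 2) (a ∘ suc) N w ≡ τ * (w ^ e * v)
    lower = begin
      S (e ∸ 2) (a ∘ suc) N w
        ≡⟨ *-identityˡ _ ⟨
      1ℚ * S (e ∸ 2) (a ∘ suc) N w
        ≡⟨ cong (_* S (e ∸ 2) (a ∘ suc) N w) τw²≡1 ⟨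
      τ * (w * w) * S (e ∸ 2) (a ∘ suc) N w
        ≡⟨ *-assoc τ (w * w) (S (e ∸ 2) (a ∘ suc) N w) ⟩
      τ * (w * w * S (e ∸ 2) (a ∘ suc) N w)
        ≡⟨ cong (τ *_) (trans (S-raise (e ∸ 2) (a ∘ suc) N w (fits-suc fits)) (S-2+∸2 e a N w fits)) ⟩
      τ * S e (a ∘ suc) N w
        ≡⟨ cong (τ *_) (S-horner e (a ∘ suc) N w τ
             (λ k e<2k → fits (suc k) (ℕ.<-≤-trans e<2k (ℕ.+-mono-≤ (ℕ.n≤1+n k) (ℕ.n≤1+n k)))) τw²≡1) ⟩
      τ * (w ^ e * v) ∎

  S-odd-0 : ∀ j a N → Fits (suc (j ℕ.+ j)) a → S (suc (j ℕ.+ j)) a N 0ℚ ≡ 0ℚ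
  S-odd-0 j       a zero    fits = refl
  S-odd-0 zero    a (suc N) fits = trans (cong (λ y → a 0 * (0ℚ * 1ℚ) - y) (S-0 (fits-<2 (s≤s (s≤s z≤n)) fits) 0 N 0ℚ))
    (solve 1 (λ a → a :* (con 0ℚ :* con 1ℚ) :- con 0ℚ := con 0ℚ) refl (a 0))
  S-odd-0 (suc j) a (suc N) fits = trans
    (cong (λ y → a 0 * (0ℚ * 0ℚ ^ (suc j ℕ.+ suc j)) - y)
      (subst (λ i → S i (a ∘ suc) N 0ℚ ≡ 0ℚ) (sym (ℕ.+-suc j j))
        (S-odd-0 j (a ∘ suc) N (subst (λ i → Fits i (a ∘ suc)) (ℕ.+-suc j j) (fits-suc fits)))))
    (solve 2 (λ a p → a :* (con 0ℚ :* p) :- con 0ℚ := con 0ℚ) refl (a 0) (0ℚ ^ (suc j ℕ.+ suc j)))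

  -- Positive just below 1. The zeros of σ m in (0 , 1) are the w for which −1/w² is a zero of ρ m.
  σ σ′ : ℕ → ℚ → ℚ
  σ m w = - S (2 ℕ.+ m) (ρ m) (1 ℕ.+ m) w
  σ′ m w = - S′ (2 ℕ.+ m) (ρ m) (1 ℕ.+ m) w

  smooth-σ : ∀ m → Smooth (σ m) (σ′ m)
  smooth-σ m = smooth-neg (smooth-S (2 ℕ.+ m) (ρ m) (1 ℕ.+ m))

  -- Put x = -1/w². Then w d/dw of w^e a(x) is w^e (e - 2x d/dx) a(x), so `θ` becomes
  -- differentiation in w. The factor 1 + x becomes w² - 1 by taking two powers of w from the
  -- exponent.
  σ-suc : ∀ m w → σ (suc m) w ≡ (w * w - 1ℚ) * σ′ m w
  σ-suc m w = begin
    - S (3 ℕ.+ m) ([1+x] u) (2 ℕ.+ m) w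
      ≡⟨ cong (λ y → - (u 0 * w ^ (3 ℕ.+ m) - y)) (S-+ (1 ℕ.+ m) (u ∘ suc) u (1 ℕ.+ m) w) ⟩
    - (u 0 * w ^ (3 ℕ.+ m) - (S (1 ℕ.+ m) (u ∘ suc) (1 ℕ.+ m) w + s))
      ≡⟨ solve 3 (λ x y s → :- (x :- (y :+ s)) := s :- (x :- y)) refl
           (u 0 * w ^ (3 ℕ.+ m)) (S (1 ℕ.+ m) (u ∘ suc) (1 ℕ.+ m) w) s ⟩
    s - S (3 ℕ.+ m) u (2 ℕ.+ m) w
      ≡⟨ cong (λ y → s - y) (trans (S-top (3 ℕ.+ m) u (1 ℕ.+ m) w (θ-vanishes (nat (2 ℕ.+ m)) (ρ m) (1 ℕ.+ m) (ρ-degree m)))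
           (sym (S-raise (1 ℕ.+ m) u (1 ℕ.+ m) w (θρ-vanishes m)))) ⟩
    s - w * w * s
      ≡⟨ solve 2 (λ w s → s :- w :* w :* s := (w :* w :- con 1ℚ) :* (:- s)) refl w s ⟩
    (w * w - 1ℚ) * - s
      ≡⟨ cong (λ y → (w * w - 1ℚ) * - y) (S′≡S (2 ℕ.+ m) (ρ m) (1 ℕ.+ m) w (ρ-vanishes m)) ⟨
    (w * w - 1ℚ) * σ′ m w ∎
    where
    open ≡-Reasoning
    u = θ (nat (2 ℕ.+ m)) (ρ m)
    s = S (1 ℕ.+ m) u (1 ℕ.+ m) w

  σ-1 : ∀ m → σ (suc m) 1ℚ ≡ 0ℚ
  σ-1 m = trans (σ-suc m 1ℚ) (*-zeroˡ (σ′ m 1ℚ))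

  -- Interlacing by Rolle's theorem

  -- The sign at the last point is only weak, so that the zero of σ m at 0 can be used for odd m.
  data Chain : (ℚ → ℚ) → ℚ → ℕ → Set where
    end  : ∀ {φ u e} → 0ℚ ≤ e → e < u → 0ℚ ≤ φ e → Chain φ u 0
    cons : ∀ {φ u a n} → a < u → 0ℚ < φ a → Chain (λ w → - φ w) a n → Chain φ u (suc n)

  data Strict : (ℚ → ℚ) → ℚ → ℕ → Set where
    end  : ∀ {φ u a} → 0ℚ < a → a < u → 0ℚ < φ a → Strict φ u 0
    cons : ∀ {φ u a n} → a < u → 0ℚ < φ a → Strict (λ w → - φ w) a n → Strict φ u (suc n)

  chain-positive : ∀ {φ u n} → Chain φ u n → 0ℚ < u
  chain-positive (end 0≤e e<u _)    = ≤-<-trans 0≤e e<u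
  chain-positive (cons a<u _ chain) = <-trans (chain-positive chain) a<u

  strict-weaken : ∀ {φ u v n} → u < v → Strict φ u n → Strict φ v n
  strict-weaken u<v (end 0<a a<u 0<φ)    = end 0<a (<-trans a<u u<v) 0<φ
  strict-weaken u<v (cons a<u 0<φ chain) = cons (<-trans a<u u<v) 0<φ chain

  drop-last : ∀ {φ u n} → Strict φ u n → Chain φ u n
  drop-last (end 0<a a<u 0<φ)    = end (<⇒≤ 0<a) a<u (<⇒≤ 0<φ)
  drop-last (cons a<u 0<φ chain) = cons a<u 0<φ (drop-last chain)

  append-0 : ∀ {φ u n} → φ 0ℚ ≡ 0ℚ → Strict φ u n → Chain φ u (suc n)
  append-0 φ0≡0 (end 0<a a<u 0<φ)    =
    cons a<u 0<φ (end ≤-refl 0<a (≤-reflexive (sym (cong -_ φ0≡0))))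
  append-0 φ0≡0 (cons a<u 0<φ chain) = cons a<u 0<φ (append-0 (cong -_ φ0≡0) chain)

  neg-flip : ∀ {x} → 0ℚ < - x → x < 0ℚ
  neg-flip {x} 0<-x = subst (_< 0ℚ) (solve 1 (λ x → :- (:- x) := x) refl x) (neg-antimono-< 0<-x)

  neg-flip-≤ : ∀ {x} → 0ℚ ≤ - x → x ≤ 0ℚ
  neg-flip-≤ {x} 0≤-x = subst (_≤ 0ℚ) (solve 1 (λ x → :- (:- x) := x) refl x) (neg-antimono-≤ 0≤-x)

  positive-between : ∀ {t d} → 0ℚ < t → t < 1ℚ → d < 0ℚ → 0ℚ < (t * t - 1ℚ) * d
  positive-between {t} {d} 0<t t<1 d<0 = subst (0ℚ <_)
    (solve 2 (λ t d → (con 1ℚ :- t) :* (t :+ con 1ℚ) :* (:- d)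
      := (t :* t :- con 1ℚ) :* d) refl t d)
    (0<-* (0<-* (<⇒0<- t<1) (0<-+ˡ 0<t 0≤1)) (neg-antimono-< d<0))

  module _ where
    private
      negate-relation : ∀ {φ′ χ : ℚ → ℚ} → (∀ w → χ w ≡ (w * w - 1ℚ) * φ′ w) →
        ∀ w → - χ w ≡ (w * w - 1ℚ) * - φ′ w
      negate-relation {φ′} rel w = trans (cong -_ (rel w)) (neg-distribʳ-* (w * w - 1ℚ) (φ′ w))

    -- Between consecutive points the suitably signed φ falls, so its derivative is negative
    -- somewhere in between, and χ is positive there because w² - 1 < 0 on (0 , 1). Together with
    -- `u` the chain has n + 2 points and hence n + 1 gaps, as many as `Strict χ u n` has points.
    rolle : ∀ {φ φ′ χ u n} → Smooth φ φ′ → (∀ w → χ w ≡ (w * w - 1ℚ) * φ′ w) →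
      u ≤ 1ℚ → φ u < 0ℚ → Chain φ u n → Strict χ u n
    rolle-cons : ∀ {φ φ′ χ u a n} → Smooth φ φ′ → (∀ w → χ w ≡ (w * w - 1ℚ) * φ′ w) →
      u ≤ 1ℚ → φ u ≤ 0ℚ → a < u → 0ℚ < φ a → Chain (λ w → - φ w) a n → Strict χ u (suc n)
    rolle s rel u≤1 φu<0 (end {u = u} {e = e} 0≤e e<u 0≤φe) =
      let t , e<t , t<u , φ′t<0 = mean-value s e u (0≤e , <⇒≤ (<-≤-trans e<u u≤1)) (≤-trans 0≤e (<⇒≤ e<u) , u≤1)
            e<u (<-≤-trans φu<0 0≤φe)
          0<t = ≤-<-trans 0≤e e<t
      in end 0<t t<u (subst (0ℚ <_) (sym (rel t)) (positive-between 0<t (<-≤-trans t<u u≤1) φ′t<0))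
    rolle s rel u≤1 φu<0 (cons a<u 0<φa chain) = rolle-cons s rel u≤1 (<⇒≤ φu<0) a<u 0<φa chain
    rolle-cons {φ = φ} {φ′ = φ′} {u = u} {a = a} s rel u≤1 φu≤0 a<u 0<φa chain =
      let 0<a = chain-positive chain
          t , a<t , t<u , φ′t<0 = mean-value s a u (<⇒≤ 0<a , <⇒≤ (<-≤-trans a<u u≤1)) (<⇒≤ (<-trans 0<a a<u) , u≤1)
            a<u (≤-<-trans φu≤0 0<φa)
          0<t = <-trans 0<a a<t
      in cons t<u (subst (0ℚ <_) (sym (rel t)) (positive-between 0<t (<-≤-trans t<u u≤1) φ′t<0))
           (strict-weaken a<t (rolle (smooth-neg s) (negate-relation {φ′} rel) (<⇒≤ (<-≤-trans a<u u≤1)) (neg-antimono-< 0<φa) chain))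

    -- At the top end 1 the function vanishes instead of being negative, which suffices since the
    -- next value is strictly positive.
    rolle-top : ∀ m {n} → Chain (σ (suc m)) 1ℚ (suc n) → Strict (σ (2 ℕ.+ m)) 1ℚ (suc n)
    rolle-top m (cons a<1 0<φa chain) =
      rolle-cons (smooth-σ (suc m)) (σ-suc (suc m)) ≤-refl (≤-reflexive (σ-1 m)) a<1 0<φa chain

  double : ℕ → ℕ
  double zero    = zero
  double (suc j) = suc (suc (double j))

  double≡+ : ∀ j → double j ≡ j ℕ.+ j
  double≡+ zero    = refl
  double≡+ (suc j) = cong suc (trans (cong suc (double≡+ j)) (sym (ℕ.+-suc j j)))

  ⌊double/2⌋ : ∀ j → ⌊ double j /2⌋ ≡ j
  ⌊double/2⌋ zero    = refl
  ⌊double/2⌋ (suc j) = cong suc (⌊double/2⌋ j)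

  ⌊1+double/2⌋ : ∀ j → ⌊ suc (double j) /2⌋ ≡ j
  ⌊1+double/2⌋ zero    = refl
  ⌊1+double/2⌋ (suc j) = cong suc (⌊1+double/2⌋ j)

  parity : ∀ m → ∃[ j ] (double j ≡ m ⊎ suc (double j) ≡ m)
  parity zero    = 0 , inj₁ refl
  parity (suc m) with parity m
  ... | j , inj₁ eq = j , inj₂ (cong suc eq)
  ... | j , inj₂ eq = suc j , inj₁ (cong suc eq)

  σ-odd-0 : ∀ j → σ (suc (double j)) 0ℚ ≡ 0ℚ
  σ-odd-0 j = cong -_ (subst (λ i → Fits (suc i) a → S (suc i) a N 0ℚ ≡ 0ℚ)
    (sym (double≡+ (suc j))) (S-odd-0 (suc j) a N) (ρ-vanishes (suc (double j))))
    where
    a = ρ (suc (double j))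
    N = 2 ℕ.+ double j

  -- A Rolle step preserves the number of points. Every second step gains one at 0, because for odd
  -- index only odd powers of w occur in σ.
  chain-odd : ∀ j → Chain (σ (suc (double j))) 1ℚ (suc j)
  -- σ 1 is 2w(1 - w²).
  chain-odd zero    = cons {a = ½} (positive-<1) 0<σ½ (end ≤-refl (positive⁻¹ ½) (≤-reflexive refl))
    where
    positive-<1 : ½ < 1ℚ
    positive-<1 = <-by ½ (positive⁻¹ ½) refl
    0<σ½ : 0ℚ < σ 1 ½
    0<σ½ = positive⁻¹ (σ 1 ½)
  chain-odd (suc j) = append-0 (σ-odd-0 (suc j))
    (rolle-top (suc (double j)) (drop-last (rolle-top (double j) (chain-odd j))))

  chain : ∀ m → Chain (σ (suc m)) 1ℚ (suc ⌊ m /2⌋)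
  chain m with parity m
  ... | j , inj₁ refl = subst (λ i → Chain (σ (suc (double j))) 1ℚ (suc i)) (sym (⌊double/2⌋ j)) (chain-odd j)
  ... | j , inj₂ refl = subst (λ i → Chain (σ (2 ℕ.+ double j)) 1ℚ (suc i)) (sym (⌊1+double/2⌋ j))
                          (drop-last (rolle-top (double j) (chain-odd j)))

  -- Positivity of the coefficients of ρ

  nat-monus : ∀ {k n} → k ℕ.+ k ℕ.≤ n → nat n - 2ℚ * nat k ≡ nat (n ∸ (k ℕ.+ k))
  nat-monus {k} {n} 2k≤n = begin
    nat n - 2ℚ * nat k
      ≡⟨ cong (λ i → nat i - 2ℚ * nat k) (ℕ.m+[n∸m]≡n 2k≤n) ⟨
    nat (k ℕ.+ k ℕ.+ (n ∸ (k ℕ.+ k))) - 2ℚ * nat k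
      ≡⟨ cong (_- 2ℚ * nat k) (trans (nat-+ (k ℕ.+ k) (n ∸ (k ℕ.+ k))) (cong (_+ nat (n ∸ (k ℕ.+ k))) (nat-+ k k))) ⟩
    nat k + nat k + nat (n ∸ (k ℕ.+ k)) - 2ℚ * nat k
      ≡⟨ solve 2 (λ k d → k :+ k :+ d :- con 2ℚ :* k := d) refl (nat k) (nat (n ∸ (k ℕ.+ k))) ⟩
    nat (n ∸ (k ℕ.+ k)) ∎
    where open ≡-Reasoning

  -- The factor m + 2 - 2k turns negative only where `ρ m k` is already 0.
  0≤ρ : ∀ m k → 0ℚ ≤ ρ m k
  0≤θρ : ∀ m k → 0ℚ ≤ θ (nat (2 ℕ.+ m)) (ρ m) k
  0≤ρ zero    zero    = 0≤1
  0≤ρ zero    (suc k) = ≤-refl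
  0≤ρ (suc m) zero    = 0≤θρ m zero
  0≤ρ (suc m) (suc k) = 0≤-+ (0≤θρ m (suc k)) (0≤θρ m k)
  0≤θρ m k with ℕ.≤-total (k ℕ.+ k) (2 ℕ.+ m)
  ... | inj₁ 2k≤ = 0≤-* (subst (0ℚ ≤_) (sym (nat-monus {k} 2k≤)) (0≤nat (2 ℕ.+ m ∸ (k ℕ.+ k)))) (0≤ρ m k)
  ... | inj₂ ≤2k = ≤-reflexive (sym (θρ-vanishes m k ≤2k))

  0<nat-monus : ∀ {k n} → k ℕ.+ k ℕ.< n → 0ℚ < nat n - 2ℚ * nat k
  0<nat-monus {k} {n} 2k<n = subst (0ℚ <_) (sym (nat-monus {k} (ℕ.<⇒≤ 2k<n))) (0<nat (ℕ.m<n⇒0<n∸m 2k<n))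
    where
    0<nat : ∀ {i} → 0 ℕ.< i → 0ℚ < nat i
    0<nat {suc i} _ = 0<-+ˡ 0<1 (0≤nat i)

  -- As ρ 0 = 1 has no linear term, a bound valid for all m must stop at 2k ≤ m + 1. At index
  -- `suc m` the shift in `[1+x]` carries positivity on to 2k ≤ m + 3, which makes the leading
  -- coefficient of F positive.
  ρ-positive : ∀ m k → k ℕ.+ k ℕ.≤ 3 ℕ.+ m → 0ℚ < ρ (suc m) k
  0<ρ : ∀ m k → k ℕ.+ k ℕ.≤ suc m → 0ℚ < ρ m k
  0<ρ zero    zero    _    = 0<1
  0<ρ zero    (suc k) 2k≤1 = contradiction (subst (ℕ._≤ 1) (cong suc (ℕ.+-suc k k)) 2k≤1) λ { (s≤s ()) }
  0<ρ (suc m) k       2k≤  = ρ-positive m k (ℕ.m≤n⇒m≤1+n 2k≤)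
  ρ-positive m zero    _   = 0<-* (0<nat-monus {0} {2 ℕ.+ m} (s≤s z≤n)) (0<ρ m zero z≤n)
  ρ-positive m (suc k) 2k≤ = subst (0ℚ <_) (+-comm (θ (nat (2 ℕ.+ m)) (ρ m) k) (θ (nat (2 ℕ.+ m)) (ρ m) (suc k)))
    (0<-+ˡ (0<-* (0<nat-monus {k} (s≤s 2k≤1+m)) (0<ρ m k 2k≤1+m)) (0≤θρ m (suc k)))
    where
    2k≤1+m : k ℕ.+ k ℕ.≤ suc m
    2k≤1+m = ℕ.s≤s⁻¹ (ℕ.s≤s⁻¹ (subst (ℕ._≤ 3 ℕ.+ m) (cong suc (ℕ.+-suc k k)) 2k≤))

  -- Near-maxima of σ as nodes

  -- As φ is no larger at the two neighbouring b's than at a, up to the sign that alternates with a,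
  -- each interval between consecutive b's contains a local maximum of ±φ.
  data Separated (μ ω : ℚ) : (ℚ → ℚ) → ℚ → ℕ → Set where
    []   : ∀ {φ u} → Separated μ ω φ u 0
    cons : ∀ {φ u a b n} → b < a → a < u → ω ≤ b → φ b ≤ φ a → φ u ≤ φ a → μ ≤ φ a →
      Separated μ ω (λ w → - φ w) b n → Separated μ ω φ u (suc n)

  relax : ∀ {μ ω μ′ ω′ φ u n} → μ′ ≤ μ → ω′ ≤ ω → Separated μ ω φ u n → Separated μ′ ω′ φ u n
  relax μ′≤μ ω′≤ω []                               = []
  relax μ′≤μ ω′≤ω (cons b<a a<u ω≤b b≤a u≤a μ≤ sep) =
    cons b<a a<u (≤-trans ω′≤ω ω≤b) b≤a u≤a (≤-trans μ′≤μ μ≤) (relax μ′≤μ ω′≤ω sep)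

  0<⊓ : ∀ {x y} → 0ℚ < x → 0ℚ < y → 0ℚ < x ⊓ y
  0<⊓ {x} {y} 0<x 0<y with ⊓-sel x y
  ... | inj₁ eq = subst (0ℚ <_) (sym eq) 0<x
  ... | inj₂ eq = subst (0ℚ <_) (sym eq) 0<y

  -- Each b lies between two consecutive chain points and its value lies between theirs, so with the
  -- alternating sign both of them dominate it. `μ` and `ω` are finite minima, fixed before any
  -- tolerance is chosen.
  separate : ∀ {φ φ′ u a n} → Smooth φ φ′ → u ≤ 1ℚ → φ u ≤ φ a → a < u → 0ℚ < φ a → Chain (λ w → - φ w) a n →
    ∃[ μ ] ∃[ ω ] (0ℚ < μ × 0ℚ < ω × Separated μ ω φ u (suc n))
  separate {φ} {u = u} {a = a} s u≤1 u≤a a<u 0<φa (end {e = e} 0≤e e<a 0≤-φe) =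
    let b , e<b , b<a , _ , b≤a = intermediate s e a (0≤e , ≤-trans (<⇒≤ e<a) a≤1) (≤-trans 0≤e (<⇒≤ e<a) , a≤1)
          e<a (≤-<-trans (neg-flip-≤ 0≤-φe) 0<φa)
    in φ a , b , 0<φa , ≤-<-trans 0≤e e<b , cons b<a a<u ≤-refl b≤a u≤a ≤-refl []
    where
    a≤1 : a ≤ 1ℚ
    a≤1 = <⇒≤ (<-≤-trans a<u u≤1)
  separate {φ} {u = u} {a = a} s u≤1 u≤a a<u 0<φa (cons {a = c} c<a 0<-φc chain) =
    let 0<c = chain-positive chain
        b , c<b , b<a , c≤b , b≤a = intermediate s c a (<⇒≤ 0<c , ≤-trans (<⇒≤ c<a) a≤1) (<⇒≤ (<-trans 0<c c<a) , a≤1)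
          c<a (<-trans (neg-flip 0<-φc) 0<φa)
        μ , ω , 0<μ , 0<ω , sep = separate (smooth-neg s) (≤-trans (<⇒≤ b<a) a≤1) (neg-antimono-≤ c≤b) c<b 0<-φc chain
    in μ ⊓ φ a , ω ⊓ b , 0<⊓ 0<μ 0<φa , 0<⊓ 0<ω (<-trans 0<c c<b)
     , cons b<a a<u (p⊓q≤q ω b) b≤a u≤a (p⊓q≤q μ (φ a)) (relax (p⊓q≤p μ (φ a)) (p⊓q≤p ω b) sep)
    where
    a≤1 : a ≤ 1ℚ
    a≤1 = <⇒≤ (<-≤-trans a<u u≤1)

  separated-σ : ∀ m → ∃[ μ ] ∃[ ω ] (0ℚ < μ × 0ℚ < ω × Separated μ ω (σ (suc m)) 1ℚ (suc ⌊ m /2⌋))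
  separated-σ m = start (chain m)
    where
    start : ∀ {n} → Chain (σ (suc m)) 1ℚ (suc n) → ∃[ μ ] ∃[ ω ] (0ℚ < μ × 0ℚ < ω × Separated μ ω (σ (suc m)) 1ℚ (suc n))
    start (cons a<1 0<φa chain) =
      separate (smooth-σ (suc m)) ≤-refl (≤-trans (≤-reflexive (σ-1 m)) (<⇒≤ 0<φa)) a<1 0<φa chain

  alternating-weaken : ∀ {Λ φ Φ s t M} {τs : Vec ℚ M} → s ≤ t → Alternating Λ φ Φ t τs → Alternating Λ φ Φ s τs
  alternating-weaken s≤t []                        = []
  alternating-weaken s≤t (next t<τ 0≤φ Φ≤φ alt) = next (≤-<-trans s≤t t<τ) 0≤φ Φ≤φ alt

  inverse-square-anti : ∀ {s τ t u} → 0ℚ < t → t < u → s * (u * u) ≡ 1ℚ → τ * (t * t) ≡ 1ℚ → 0ℚ < s → 0ℚ < τ → s < τ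
  inverse-square-anti {s} {τ} {t} {u} 0<t t<u su²≡1 τt²≡1 0<s 0<τ = <-by (s * τ * ((u - t) * (t + u)))
    (0<-* (0<-* 0<s 0<τ) (0<-* (<⇒0<- t<u) (0<-+ˡ 0<t (<⇒≤ (<-trans 0<t t<u)))))
    (begin
      s + s * τ * ((u - t) * (t + u))
        ≡⟨ solve 4 (λ s τ t u → s :+ s :* τ :* ((u :- t) :* (t :+ u))
             := s :+ (τ :* (s :* (u :* u)) :- s :* (τ :* (t :* t)))) refl s τ t u ⟩
      s + (τ * (s * (u * u)) - s * (τ * (t * t)))
        ≡⟨ cong₂ (λ x y → s + (τ * x - s * y)) su²≡1 τt²≡1 ⟩
      s + (τ * 1ℚ - s * 1ℚ)
        ≡⟨ solve 2 (λ s τ → s :+ (τ :* con 1ℚ :- s :* con 1ℚ) := τ) refl s τ ⟩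
      τ ∎)
    where open ≡-Reasoning

  module Nodes (Λ μ ω : ℚ) (0<Λ : 0ℚ < Λ) (0<μ : 0ℚ < μ) (0<ω : 0ℚ < ω) (e : ℕ) where

    Transported : (φ φ′ ψ Ψ : ℚ → ℚ) → Set
    Transported φ φ′ ψ Ψ = ∀ w τ → 0ℚ < w → τ * (w * w) ≡ 1ℚ →
      w ^ e * ψ τ ≡ φ w × w ^ suc e * Ψ τ ≡ (w * w - 1ℚ) * φ′ w

    transported-neg : ∀ {φ φ′ ψ Ψ} → Transported φ φ′ ψ Ψ →
      Transported (λ w → - φ w) (λ w → - φ′ w) (λ τ → - ψ τ) (λ τ → - Ψ τ)
    transported-neg {φ} {φ′} {ψ} {Ψ} rel w τ 0<w eq =
      let eq₁ , eq₂ = rel w τ 0<w eq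
      in trans (sym (neg-distribʳ-* (w ^ e) (ψ τ))) (cong -_ eq₁)
       , trans (sym (neg-distribʳ-* (w ^ suc e) (Ψ τ)))
           (trans (cong -_ eq₂) (neg-distribʳ-* (w * w - 1ℚ) (φ′ w)))

    -- At a near-maximum t, Ψ and ψ are compared after multiplication by t^(e+1). There Λ t φ(t) ≥ Λ
    -- ω μ, and the factor t² - 1 in front of φ′ has modulus at most 1.
    δ : ℚ
    δ = Λ * (ω * μ)
    0<δ : 0ℚ < δ
    0<δ = 0<-* 0<Λ (0<-* 0<ω 0<μ)

    -- The intervals (b , u) descend towards 0, so the nodes τ = 1/t² ascend; `s` stands for 1/u².
    nodes : ∀ {φ φ′ ψ Ψ u s n} → Smooth φ φ′ → Transported φ φ′ ψ Ψ → 0ℚ < u → u ≤ 1ℚ → 0ℚ < s → s * (u * u) ≡ 1ℚ →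
      Separated μ ω φ u n → Σ[ τs ∈ Vec ℚ n ] Alternating Λ ψ Ψ s τs
    nodes sm rel 0<u u≤1 0<s su²≡1 [] = [] , []
    nodes {φ} {φ′} {ψ} {Ψ} {u} sm rel 0<u u≤1 0<s su²≡1 (cons {a = a} {b = b} b<a a<u ω≤b b≤a u≤a μ≤ sep) =
      let t , b<t , t<u , a≤t , flat = near-maximum sm δ b a u 0<δ (<⇒≤ 0<b , b≤1) (<⇒≤ 0<u , u≤1) b<a a<u b≤a u≤a
          0<t = <-trans 0<b b<t
          τ , 0<τ , t²τ≡1 = reciprocal (t * t) (0<-* 0<t 0<t)
          σ , 0<σ , b²σ≡1 = reciprocal (b * b) (0<-* 0<b 0<b)
          τt²≡1 = trans (*-comm τ (t * t)) t²τ≡1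
          σb²≡1 = trans (*-comm σ (b * b)) b²σ≡1
          τs , alt = nodes (smooth-neg sm) (transported-neg {ψ = ψ} {Ψ = Ψ} rel) 0<b b≤1 0<σ σb²≡1 sep
          eq₁ , eq₂ = rel t τ 0<t τt²≡1
      in τ ∷ τs , next (inverse-square-anti 0<t t<u su²≡1 τt²≡1 0<s 0<τ)
           (0≤-cancel (t ^ e) (0<^ 0<t e) (subst (0ℚ ≤_) (sym eq₁) (≤-trans (<⇒≤ 0<μ) (≤-trans μ≤ a≤t))))
           (∣∣≤-cancel Λ (Ψ τ) (ψ τ) (t ^ suc e) (0<^ 0<t (suc e))
             (bound t (ψ τ) (Ψ τ) 0<t (<-≤-trans t<u u≤1) (≤-trans ω≤b (<⇒≤ b<t)) (≤-trans μ≤ a≤t) flat eq₁ eq₂))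
           -- The nodes of the recursive call lie beyond 1/b², which exceeds 1/t².
           (alternating-weaken (<⇒≤ (inverse-square-anti 0<b b<t τt²≡1 σb²≡1 0<τ 0<σ)) alt)
      where
      0<b : 0ℚ < b
      0<b = <-≤-trans 0<ω ω≤b
      b≤1 : b ≤ 1ℚ
      b≤1 = <⇒≤ (<-≤-trans (<-trans b<a a<u) u≤1)
      bound : ∀ t v V → 0ℚ < t → t < 1ℚ → ω ≤ t → μ ≤ φ t → ∣ φ′ t ∣ ≤ δ →
        t ^ e * v ≡ φ t → t ^ suc e * V ≡ (t * t - 1ℚ) * φ′ t →
        ∣ t ^ suc e * V ∣ ≤ Λ * (t ^ suc e * v)
      bound t v V 0<t t<1 ω≤t μ≤t flat eq₁ eq₂ = begin
        ∣ t ^ suc e * V ∣  ≡⟨ cong ∣_∣ eq₂ ⟩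
        ∣ (t * t - 1ℚ) * φ′ t ∣  ≤⟨ ∣*∣≤ (t * t - 1ℚ) (φ′ t) t²-1≤1 flat ⟩
        1ℚ * δ  ≡⟨ *-identityˡ δ ⟩
        Λ * (ω * μ)  ≤⟨ *-monoˡ Λ (<⇒≤ 0<Λ) (*-mono-≤ (<⇒≤ 0<ω) ω≤t (<⇒≤ 0<μ) μ≤t) ⟩
        Λ * (t * φ t)  ≡⟨ cong (λ x → Λ * (t * x)) eq₁ ⟨
        Λ * (t * (t ^ e * v))  ≡⟨ cong (Λ *_) (*-assoc t (t ^ e) v) ⟨
        Λ * (t ^ suc e * v)  ∎
        where
        open ≤-Reasoning
        t²-1≤1 : ∣ t * t - 1ℚ ∣ ≤ 1ℚ
        t²-1≤1 = ∣∣≤-intro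
          (≤-by (1ℚ + (1ℚ - t) * (1ℚ + t)) (0≤-+ 0≤1 (0≤-* (≤⇒0≤- (<⇒≤ t<1)) (0≤-+ 0≤1 (<⇒≤ 0<t))))
            (solve 1 (λ t → t :* t :- con 1ℚ :+ (con 1ℚ :+ (con 1ℚ :- t) :* (con 1ℚ :+ t)) := con 1ℚ) refl t))
          (≤-by (t * t) (0≤-square t) (solve 1 (λ t → :- (t :* t :- con 1ℚ) :+ t :* t := con 1ℚ) refl t))

  -- Coefficient vectors of f and F, and the complete list of nodes

  horner-extend : ∀ (A : ℚ-Algebra) a {N N′} x → N ℕ.≤′ N′ → (∀ k → N ℕ.≤ k → a k ≡ 0ℚ) →
    Evaluation.horner A a N′ x ≡ Evaluation.horner A a N x
  horner-extend A a x (ℕ.≤′-reflexive refl)       vanishes = refl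
  horner-extend A a x (ℕ.≤′-step {n = N′} N≤′N′)  vanishes =
    trans (horner-top A a N′ x (vanishes N′ (ℕ.≤′⇒≤ N≤′N′))) (horner-extend A a x N≤′N′ vanishes)

  horner-agree : ∀ (A : ℚ-Algebra) a N N′ x → (∀ k → N ℕ.≤ k → a k ≡ 0ℚ) → (∀ k → N′ ℕ.≤ k → a k ≡ 0ℚ) →
    Evaluation.horner A a N x ≡ Evaluation.horner A a N′ x
  horner-agree A a N N′ x v v′ with ℕ.≤-total N N′
  ... | inj₁ N≤N′ = sym (horner-extend A a x (ℕ.≤⇒≤′ N≤N′) v)
  ... | inj₂ N′≤N = horner-extend A a x (ℕ.≤⇒≤′ N′≤N) v′

  ρ-vanishes-degree : ∀ m k → suc m ℕ.≤ k → ρ m k ≡ 0ℚ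
  ρ-vanishes-degree zero    (suc k) _   = refl
  ρ-vanishes-degree (suc m) k       m<k = ρ-vanishes (suc m) k (ℕ.+-mono-≤ {2} {k} {2 ℕ.+ m} {k} (ℕ.≤-trans (s≤s (s≤s z≤n)) m<k) m<k)

  n≤⌊n/2⌋+⌊n/2⌋+1 : ∀ n → n ℕ.≤ suc (⌊ n /2⌋ ℕ.+ ⌊ n /2⌋)
  n≤⌊n/2⌋+⌊n/2⌋+1 zero          = z≤n
  n≤⌊n/2⌋+⌊n/2⌋+1 (suc zero)    = s≤s z≤n
  n≤⌊n/2⌋+⌊n/2⌋+1 (suc (suc n)) = s≤s (s≤s (subst (n ℕ.≤_) (sym (ℕ.+-suc ⌊ n /2⌋ ⌊ n /2⌋)) (n≤⌊n/2⌋+⌊n/2⌋+1 n)))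

  ⌊n/2⌋+⌊n/2⌋≤n : ∀ n → ⌊ n /2⌋ ℕ.+ ⌊ n /2⌋ ℕ.≤ n
  ⌊n/2⌋+⌊n/2⌋≤n zero          = z≤n
  ⌊n/2⌋+⌊n/2⌋≤n (suc zero)    = z≤n
  ⌊n/2⌋+⌊n/2⌋≤n (suc (suc n)) = s≤s (subst (ℕ._≤ suc n) (sym (ℕ.+-suc ⌊ n /2⌋ ⌊ n /2⌋)) (s≤s (⌊n/2⌋+⌊n/2⌋≤n n)))

  -- The common degree bound for ρ m and ρ (suc m).
  degree : ℕ → ℕ
  degree m = suc ⌊ suc m /2⌋

  ρ-suc-vanishes-half : ∀ m k → suc (degree m) ℕ.≤ k → 3 ℕ.+ m ℕ.< k ℕ.+ k
  ρ-suc-vanishes-half m k hyp = ℕ.≤-trans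
    (s≤s (s≤s (s≤s (ℕ.≤-trans (n≤⌊n/2⌋+⌊n/2⌋+1 (suc m)) (ℕ.≤-reflexive (sym (ℕ.+-suc ⌊ suc m /2⌋ ⌊ suc m /2⌋)))))))
    (ℕ.≤-trans (ℕ.≤-reflexive (cong (λ i → suc (suc i))
        (sym (ℕ.+-suc ⌊ suc m /2⌋ (suc ⌊ suc m /2⌋))))) (ℕ.+-mono-≤ hyp hyp))

  ρ-vanishes-half : ∀ m k → suc (degree m) ℕ.≤ k → ρ m k ≡ 0ℚ
  ρ-vanishes-half m k hyp = ρ-vanishes m k (ℕ.<-trans (ℕ.n<1+n _) (ρ-suc-vanishes-half m k hyp))

  f-coeffs F-coeffs : ∀ m → Vec ℚ (suc (degree m))
  f-coeffs m = coeffs (ρ m) (suc (degree m))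
  F-coeffs m = coeffs (ρ (suc m)) (suc (degree m))

  eval-f : ∀ (A : ℚ-Algebra) m x → Evaluation.eval A (f-coeffs m) x ≡ Evaluation.horner A (ρ m) (suc m) x
  eval-f A m x = horner-agree A (ρ m) (suc (degree m)) (suc m) x (ρ-vanishes-half m) (ρ-vanishes-degree m)

  eval-F : ∀ (A : ℚ-Algebra) m x → Evaluation.eval A (F-coeffs m) x ≡ Evaluation.horner A (ρ (suc m)) (2 ℕ.+ m) x
  eval-F A m x = horner-agree A (ρ (suc m)) (suc (degree m)) (2 ℕ.+ m) x
    (λ k hyp → ρ-vanishes (suc m) k (ρ-suc-vanishes-half m k hyp)) (ρ-vanishes-degree (suc m))

  last-coeffs : ∀ a N → last (coeffs a (suc N)) ≡ a N
  last-coeffs a zero    = refl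
  last-coeffs a (suc N) = last-coeffs (a ∘ suc) N

  -- Not strict: for odd m the degree of ρ m falls short of `degree m`.
  last-f : ∀ m → 0ℚ ≤ last (f-coeffs m)
  last-f m = subst (0ℚ ≤_) (sym (last-coeffs (ρ m) (degree m))) (0≤ρ m (degree m))

  last-F : ∀ m → 0ℚ < last (F-coeffs m)
  last-F m = subst (0ℚ <_) (sym (last-coeffs (ρ (suc m)) (degree m)))
    (ρ-positive m (degree m) (s≤s (subst (ℕ._≤ 2 ℕ.+ m) (sym (ℕ.+-suc ⌊ suc m /2⌋ ⌊ suc m /2⌋)) (s≤s (⌊n/2⌋+⌊n/2⌋≤n (suc m))))))

  0≤horner : ∀ a N {x} → 0ℚ ≤ x → (∀ k → 0ℚ ≤ a k) → 0ℚ ≤ Evaluation.horner ℚ-self a N x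
  0≤horner a zero    0≤x 0≤a = ≤-refl
  0≤horner a (suc N) 0≤x 0≤a = 0≤-+ (0≤a 0) (0≤-* 0≤x (0≤horner (a ∘ suc) N 0≤x (λ k → 0≤a (suc k))))

  f-positive : ∀ m → 0ℚ < evalℚ (f-coeffs m) 2ℚ
  f-positive m = 0<-+ˡ (0<ρ m 0 z≤n) (0≤-* 0≤2 (0≤horner (ρ m ∘ suc) (degree m) 0≤2 (λ k → 0≤ρ m (suc k))))

  transport : ∀ m w τ → τ * (w * w) ≡ 1ℚ → w ^ (2 ℕ.+ m) * - evalℚ (f-coeffs m) (- τ) ≡ σ m w
  transport m w τ τw²≡1 = trans (sym (neg-distribʳ-* (w ^ (2 ℕ.+ m)) (evalℚ (f-coeffs m) (- τ))))
    (cong -_ (trans (cong (w ^ (2 ℕ.+ m) *_) (eval-f ℚ-self m (- τ)))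
      (sym (S-horner (2 ℕ.+ m) (ρ m) (1 ℕ.+ m) w τ (ρ-vanishes m) τw²≡1))))

  transport′ : ∀ m w τ → τ * (w * w) ≡ 1ℚ → w ^ (3 ℕ.+ m) * - evalℚ (F-coeffs m) (- τ) ≡ (w * w - 1ℚ) * σ′ m w
  transport′ m w τ τw²≡1 = trans
    (trans (sym (neg-distribʳ-* (w ^ (3 ℕ.+ m)) (evalℚ (F-coeffs m) (- τ))))
      (cong -_ (trans (cong (w ^ (3 ℕ.+ m) *_) (eval-F ℚ-self m (- τ)))
        (sym (S-horner (3 ℕ.+ m) (ρ (suc m)) (2 ℕ.+ m) w τ (ρ-vanishes (suc m)) τw²≡1)))))
    (σ-suc m w)

  1^ : ∀ e → 1ℚ ^ e ≡ 1ℚ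
  1^ zero    = refl
  1^ (suc e) = trans (*-identityˡ (1ℚ ^ e)) (1^ e)

  root-1 : ∀ e {x} → 1ℚ ^ e * - x ≡ 0ℚ → x ≡ 0ℚ
  root-1 e {x} eq = trans (solve 1 (λ x → x := :- (con 1ℚ :* (:- x))) refl x)
    (cong -_ (trans (cong (_* - x) (sym (1^ e))) eq))

  F-root : ∀ m → evalℚ (F-coeffs m) (- 1ℚ) ≡ 0ℚ
  F-root m = root-1 (3 ℕ.+ m) (trans (transport′ m 1ℚ 1ℚ refl) (*-zeroˡ (σ′ m 1ℚ)))

  -- The factor 1 + x of F makes -1 an exact zero, so τ = 1 is a node without defect, and for m = 0
  -- it is the only one. For m > 0, f vanishes there too. The other nodes come from σ m = -w^(m+2)
  -- f(-1/w²), whose positive sign next to 1 fits the negated second place of `Alternating`.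
  alternating-nodes : ∀ m Λ → 0ℚ < Λ → Σ[ τs ∈ Vec ℚ (degree m) ] (All (1ℚ ≤_) τs ×
    ∃[ t ] Alternating Λ (λ x → evalℚ (f-coeffs m) (- x)) (λ x → evalℚ (F-coeffs m) (- x)) t τs)
  alternating-nodes m Λ 0<Λ = 1ℚ ∷ proj₁ (rest m)
    , ≤-refl ∷ All.map <⇒≤ (nodes-above ≤-refl (proj₂ (rest m)))
    , 0ℚ , next 0<1 0≤f F≤f (proj₂ (rest m))
    where
    0≤f′ : ∀ m → 0ℚ ≤ evalℚ (f-coeffs m) (- 1ℚ)
    0≤f′ zero    = ≤-trans 0≤1 (≤-reflexive refl)
    0≤f′ (suc m) = ≤-reflexive (sym (root-1 (3 ℕ.+ m) (trans (transport (suc m) 1ℚ 1ℚ refl) (σ-1 m))))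
    0≤f : 0ℚ ≤ evalℚ (f-coeffs m) (- 1ℚ)
    0≤f = 0≤f′ m
    F≤f : ∣ evalℚ (F-coeffs m) (- 1ℚ) ∣ ≤ Λ * evalℚ (f-coeffs m) (- 1ℚ)
    F≤f = subst (λ x → ∣ x ∣ ≤ Λ * evalℚ (f-coeffs m) (- 1ℚ)) (sym (F-root m)) (0≤-* (<⇒≤ 0<Λ) 0≤f)
    rest : ∀ m → Σ[ τs ∈ Vec ℚ ⌊ suc m /2⌋ ]
      Alternating Λ (λ x → - evalℚ (f-coeffs m) (- x)) (λ x → - evalℚ (F-coeffs m) (- x)) 1ℚ τs
    rest zero    = [] , []
    rest (suc m) =
      let μ , ω , 0<μ , 0<ω , sep = separated-σ m
      in Nodes.nodes Λ μ ω 0<Λ 0<μ 0<ω (3 ℕ.+ m)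
        {ψ = λ x → - evalℚ (f-coeffs (suc m)) (- x)} {Ψ = λ x → - evalℚ (F-coeffs (suc m)) (- x)}
        (smooth-σ (suc m))
        (λ w τ _ eq → transport (suc m) w τ eq , transport′ (suc m) w τ eq)
        0<1 ≤-refl 0<1 refl sep

-- From the disc back to the half plane

module Transfer where
  open import Data.Rational.Base
  open import Data.Rational.Properties
  open Estimates
  open RolleNodes
  open K using (ℂℚ; ι; _⊕_; _⊛_; _⊖_; ⊝_)

  power : ℂℚ → ℕ → ℂℚ
  power = Evaluation.power ℚ[i]

  horner : (ℕ → ℚ) → ℕ → ℂℚ → ℂℚ
  horner = Evaluation.horner ℚ[i]

  ρ-eval : ℕ → ℂℚ → ℂℚ
  ρ-eval m = horner (ρ m) (suc m)

  ρ-recurrence : ∀ m η → ρ-eval (suc m) η ≡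
    (1ᴷ ⊕ η) ⊛ (ι (nat (2 ℕ.+ m)) ⊛ ρ-eval m η ⊖ ι 2ℚ ⊛ (η ⊛ derivativeᴷ (coeffs (ρ m) (suc m)) η))
  ρ-recurrence m η = trans
    (horner-[1+x] ℚ[i] (θ (nat (2 ℕ.+ m)) (ρ m)) (suc m) η (θ-vanishes (nat (2 ℕ.+ m)) (ρ m) (suc m) (ρ-degree m)))
    (cong ((1ᴷ ⊕ η) ⊛_) (horner-θ ℚ[i] (nat (2 ℕ.+ m)) (ρ m) (suc m) η))

  -- Both ρ (m + 1) and ρ (m + 2) are expanded by the recurrence. Its parameters m + 2 and m + 3
  -- differ by 1, so of the undifferentiated terms only -(1 + η) f F is left.
  turánForm-ρ : ∀ m η → turánForm (f-coeffs m) (F-coeffs m) η ≡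
    ρ-eval (suc m) η ⊛ ρ-eval (suc m) η ⊖ ρ-eval (2 ℕ.+ m) η ⊛ ρ-eval m η
  turánForm-ρ m η = begin
    turánForm (f-coeffs m) (F-coeffs m) η
      ≡⟨ cong₂ (λ a a′ → (1ᴷ ⊕ η) ⊛ (ι 2ℚ ⊛ (η ⊛ (derivativeᴷ (F-coeffs m) η ⊛ a ⊖ evalᴷ (F-coeffs m) η ⊛ a′))
           ⊖ a ⊛ evalᴷ (F-coeffs m) η))
           (eval-f ℚ[i] m η) (cong proj₂ (eval-f (quadratic 0ℚ ℚ[i]) m (η , ι 1ℚ))) ⟩
    (1ᴷ ⊕ η) ⊛ (ι 2ℚ ⊛ (η ⊛ (derivativeᴷ (F-coeffs m) η ⊛ f ⊖ evalᴷ (F-coeffs m) η ⊛ f′)) ⊖ f ⊛ evalᴷ (F-coeffs m) η)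
      ≡⟨ cong₂ (λ b b′ → (1ᴷ ⊕ η) ⊛ (ι 2ℚ ⊛ (η ⊛ (b′ ⊛ f ⊖ b ⊛ f′)) ⊖ f ⊛ b))
           (eval-F ℚ[i] m η) (cong proj₂ (eval-F (quadratic 0ℚ ℚ[i]) m (η , ι 1ℚ))) ⟩
    (1ᴷ ⊕ η) ⊛ (ι 2ℚ ⊛ (η ⊛ (F′ ⊛ f ⊖ F ⊛ f′)) ⊖ f ⊛ F)
      ≡⟨ solve 6 (λ x n f f′ F F′ →
           (con 1ℚ :+ x) :* (con 2ℚ :* (x :* (F′ :* f :- F :* f′)) :- f :* F)
           := F :* ((con 1ℚ :+ x) :* (n :* f :- con 2ℚ :* (x :* f′)))
             :- (con 1ℚ :+ x) :* ((con 1ℚ :+ n) :* F :- con 2ℚ :* (x :* F′)) :* f)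
           refl η (ι (nat (2 ℕ.+ m))) f f′ F F′ ⟩
    F ⊛ ((1ᴷ ⊕ η) ⊛ (ι (nat (2 ℕ.+ m)) ⊛ f ⊖ ι 2ℚ ⊛ (η ⊛ f′)))
      ⊖ (1ᴷ ⊕ η) ⊛ ((1ᴷ ⊕ ι (nat (2 ℕ.+ m))) ⊛ F ⊖ ι 2ℚ ⊛ (η ⊛ F′)) ⊛ f
      ≡⟨ cong₂ (λ a b → F ⊛ a ⊖ b ⊛ f) (sym (ρ-recurrence m η))
           (trans (cong (λ c → (1ᴷ ⊕ η) ⊛ (c ⊛ F ⊖ ι 2ℚ ⊛ (η ⊛ F′))) (sym (ℚ-Algebra.ι-+ ℚ[i] 1ℚ (nat (2 ℕ.+ m)))))
             (sym (ρ-recurrence (suc m) η))) ⟩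
    F ⊛ F ⊖ ρ-eval (2 ℕ.+ m) η ⊛ f ∎
    where
    open ≡-Reasoning
    open K.Solver
    f f′ F F′ : ℂℚ
    f  = ρ-eval m η
    f′ = derivativeᴷ (coeffs (ρ m) (suc m)) η
    F  = ρ-eval (suc m) η
    F′ = derivativeᴷ (coeffs (ρ (suc m)) (2 ℕ.+ m)) η

  R-eval : ℕ → ℂℚ → ℂℚ
  R-eval m = horner (Rℚ (suc m)) (suc m)

  turán-eval : ℕ → ℂℚ → ℂℚ
  turán-eval m z = R-eval (suc m) z ⊛ R-eval (suc m) z ⊖ R-eval (2 ℕ.+ m) z ⊛ R-eval m z

  R-ρ : ∀ m z η → (1ᴷ ⊕ z) ⊛ η ≡ z ⊖ 1ᴷ → ι (2^ m) ⊛ R-eval m z ≡ power (1ᴷ ⊕ z) m ⊛ ρ-eval m η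
  R-ρ m z η eq = trans (R-basis-change m ℚ[i] z)
    (homogeneous-horner ℚ[i] (ρ m) m (1ᴷ ⊕ z) (z ⊖ 1ᴷ) η eq)

  power-inverse : ∀ p π n → p ⊛ π ≡ 1ᴷ → power p n ⊛ power π n ≡ 1ᴷ
  power-inverse p π zero    eq = refl
  power-inverse p π (suc n) eq = trans
    (solve 4 (λ p q a b → p :* a :* (q :* b) := (p :* q) :* (a :* b)) refl p π (power p n) (power π n))
    (trans (cong₂ _⊛_ eq (power-inverse p π n eq)) (solve 0 (con 1ℚ :* con 1ℚ := con 1ℚ) refl))
    where open K.Solver

  -- Both products in the Turán expression carry the same power 2m + 2 of 1 + z and of 2, so the
  -- change of variable multiplies it by a common factor; π is the inverse of 1 + z.
  turánForm-turán : ∀ m z η π → (1ᴷ ⊕ z) ⊛ η ≡ z ⊖ 1ᴷ → (1ᴷ ⊕ z) ⊛ π ≡ 1ᴷ →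
    turánForm (f-coeffs m) (F-coeffs m) η ≡
      (power π (suc m) ⊛ power π (suc m)) ⊛ ((ι (2^ (suc m)) ⊛ ι (2^ (suc m))) ⊛ turán-eval m z)
  turánForm-turán m z η π η-eq π-eq = begin
    turánForm (f-coeffs m) (F-coeffs m) η
      ≡⟨ turánForm-ρ m η ⟩
    F ⊛ F ⊖ G ⊛ f
      ≡⟨ solve 3 (λ F G f → F :* F :- G :* f := (con 1ℚ :* con 1ℚ) :* (F :* F :- G :* f)) refl F G f ⟩
    (1ᴷ ⊛ 1ᴷ) ⊛ (F ⊛ F ⊖ G ⊛ f)
      ≡⟨ cong (λ u → (u ⊛ u) ⊛ (F ⊛ F ⊖ G ⊛ f)) (power-inverse p π (suc m) π-eq) ⟨
    ((P ⊛ Π) ⊛ (P ⊛ Π)) ⊛ (F ⊛ F ⊖ G ⊛ f)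
      ≡⟨ solve 6 (λ p P Π F G f → (((p :* P) :* Π) :* ((p :* P) :* Π)) :* (F :* F :- G :* f)
           := (Π :* Π) :* ((p :* P :* F) :* (p :* P :* F) :- (p :* (p :* P) :* G) :* (P :* f)))
           refl p (power p m) Π F G f ⟩
    (Π ⊛ Π) ⊛ ((P ⊛ F) ⊛ (P ⊛ F) ⊖ (power p (2 ℕ.+ m) ⊛ G) ⊛ (power p m ⊛ f))
      ≡⟨ cong₂ (λ u v → (Π ⊛ Π) ⊛ (u ⊛ u ⊖ v)) (sym (R-ρ (suc m) z η η-eq))
           (cong₂ _⊛_ (sym (R-ρ (2 ℕ.+ m) z η η-eq)) (sym (R-ρ m z η η-eq))) ⟩
    (Π ⊛ Π) ⊛ ((ι (2ℚ * c) ⊛ R₁) ⊛ (ι (2ℚ * c) ⊛ R₁) ⊖ (ι (2ℚ * (2ℚ * c)) ⊛ R₂) ⊛ (ι c ⊛ R₀))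
      ≡⟨ cong₂ (λ u v → (Π ⊛ Π) ⊛ ((u ⊛ R₁) ⊛ (u ⊛ R₁) ⊖ (v ⊛ R₂) ⊛ (ι c ⊛ R₀)))
           (ι-* 2ℚ c) (trans (ι-* 2ℚ (2ℚ * c)) (cong (ι 2ℚ ⊛_) (ι-* 2ℚ c))) ⟩
    (Π ⊛ Π) ⊛ (((ι 2ℚ ⊛ ι c) ⊛ R₁) ⊛ ((ι 2ℚ ⊛ ι c) ⊛ R₁) ⊖ ((ι 2ℚ ⊛ (ι 2ℚ ⊛ ι c)) ⊛ R₂) ⊛ (ι c ⊛ R₀))
      ≡⟨ solve 6 (λ Π t c R₀ R₁ R₂ →
           (Π :* Π) :* (((t :* c) :* R₁) :* ((t :* c) :* R₁) :- ((t :* (t :* c)) :* R₂) :* (c :* R₀))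
           := (Π :* Π) :* (((t :* c) :* (t :* c)) :* (R₁ :* R₁ :- R₂ :* R₀))) refl Π (ι 2ℚ) (ι c) R₀ R₁ R₂ ⟩
    (Π ⊛ Π) ⊛ (((ι 2ℚ ⊛ ι c) ⊛ (ι 2ℚ ⊛ ι c)) ⊛ turán-eval m z)
      ≡⟨ cong (λ u → (Π ⊛ Π) ⊛ ((u ⊛ u) ⊛ turán-eval m z)) (ι-* 2ℚ c) ⟨
    (Π ⊛ Π) ⊛ ((ι (2^ (suc m)) ⊛ ι (2^ (suc m))) ⊛ turán-eval m z) ∎
    where
    open ≡-Reasoning
    open K.Solver
    ι-* = ℚ-Algebra.ι-* ℚ[i]
    p P Π f F G R₀ R₁ R₂ : ℂℚ
    p = 1ᴷ ⊕ z
    P = power p (suc m)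
    Π = power π (suc m)
    f = ρ-eval m η
    F = ρ-eval (suc m) η
    G = ρ-eval (2 ℕ.+ m) η
    c = 2^ m
    R₀ = R-eval m z
    R₁ = R-eval (suc m) z
    R₂ = R-eval (2 ℕ.+ m) z

  norm²-⊛ : ∀ z w → norm² (z ⊛ w) ≡ norm² z * norm² w
  norm²-⊛ (a , b) (c , d) = Q.solve 4 (λ a b c d → let u = (a , b) :⊛ (c , d) in
    proj₁ u Q.:* proj₁ u Q.:+ proj₂ u Q.:* proj₂ u
    Q.:= (a Q.:* a Q.:+ b Q.:* b) Q.:* (c Q.:* c Q.:+ d Q.:* d)) refl a b c d

  ‖power‖≤ : ∀ π → ‖ π ‖ ≤ 2ℚ → ∀ n → ‖ power π n ‖ ≤ 2^ n
  ‖power‖≤ π π≤2 zero    = ≤-refl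
  ‖power‖≤ π π≤2 (suc n) = ‖⊛‖≤′ π (power π n) π≤2 (‖power‖≤ π π≤2 n)

  module _ where
    open K.Solver

    swap : ∀ p q π → p ⊛ (q ⊛ π) ≡ q ⊛ (p ⊛ π)
    swap = solve 3 (λ p q π → p :* (q :* π) := q :* (p :* π)) refl

    ⊛-identityʳ : ∀ q → q ⊛ 1ᴷ ≡ q
    ⊛-identityʳ = solve 1 (λ q → q :* con 1ℚ := q) refl

  -- From |1 + z|² - |z - 1|² = 4 Re z it follows that |η|² = 1 - 4 Re z / |1 + z|², which is at
  -- most 1 - 4r/D as soon as D bounds |1 + z|² on the box.
  bounded-below : ∀ m r B → 0ℚ < r → 0ℚ < B →
    ∃[ ε ] (0ℚ < ε × (∀ z → r ≤ proj₁ z → ∣ proj₁ z ∣ ≤ B → ∣ proj₂ z ∣ ≤ B → ε ≤ ‖ turán-eval m z ‖))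
  bounded-below m r B 0<r 0<B = ε , 0<ε , bound
    where
    open Q
    -- The first two summands bound |1 + z|² on the box; 2r keeps h = 2r/D at most 1.
    D = (1ℚ + B) * (1ℚ + B) + B * B + 2ℚ * r
    0<2r : 0ℚ < 2ℚ * r
    0<2r = 0<-* (0<-+ˡ 0<1 0≤1) 0<r
    0≤1+B : 0ℚ ≤ 1ℚ + B
    0≤1+B = 0≤-+ 0≤1 (<⇒≤ 0<B)
    0<D : 0ℚ < D
    0<D = +-mono-≤-< (0≤-+ (0≤-* 0≤1+B 0≤1+B) (0≤-square B)) 0<2r
    D⁻¹ = reciprocal D 0<D
    h = 2ℚ * r * proj₁ D⁻¹
    hD≡ : h * D ≡ 2ℚ * r
    hD≡ = trans (solve 3 (λ r i d → r :* i :* d := r :* (d :* i)) refl (2ℚ * r) (proj₁ D⁻¹) D)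
      (trans (cong (2ℚ * r *_) (proj₂ (proj₂ D⁻¹))) (*-identityʳ (2ℚ * r)))
    0<h : 0ℚ < h
    0<h = 0<-* 0<2r (proj₁ (proj₂ D⁻¹))
    h≤1 : h ≤ 1ℚ
    h≤1 = *-cancelˡ-≤ D 0<D (≤-trans (≤-reflexive (trans (*-comm D h) hD≡))
      (≤-by ((1ℚ + B) * (1ℚ + B) + B * B) (0≤-+ (0≤-* 0≤1+B 0≤1+B) (0≤-square B))
        (solve 2 (λ x r → r :+ x := (x :+ r) :* con 1ℚ) refl ((1ℚ + B) * (1ℚ + B) + B * B) (2ℚ * r))))
    form-bound = turánForm-lower (f-coeffs m) (F-coeffs m) (last-f m) (last-F m) (f-positive m) (alternating-nodes m) h 0<h h≤1
    ε₀ : ℚ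
    ε₀ = proj₁ form-bound
    q = 2^ (suc m)
    W = q * q * (q * q)
    0<W : 0ℚ < W
    0<W = 0<-* (0<-* (0<2^ (suc m)) (0<2^ (suc m))) (0<-* (0<2^ (suc m)) (0<2^ (suc m)))
    W⁻¹ = reciprocal W 0<W
    ε = ε₀ * proj₁ W⁻¹
    0<ε : 0ℚ < ε
    0<ε = 0<-* (proj₁ (proj₂ form-bound)) (proj₁ (proj₂ W⁻¹))
    bound : ∀ z → r ≤ proj₁ z → ∣ proj₁ z ∣ ≤ B → ∣ proj₂ z ∣ ≤ B → ε ≤ ‖ turán-eval m z ‖
    bound z@(x , y) r≤x x≤B y≤B = *-cancelˡ-≤ W 0<W (begin
      W * (ε₀ * proj₁ W⁻¹)
        ≡⟨ solve 3 (λ w e i → w :* (e :* i) := e :* (w :* i)) refl W ε₀ (proj₁ W⁻¹) ⟩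
      ε₀ * (W * proj₁ W⁻¹)
        ≡⟨ trans (cong (ε₀ *_) (proj₂ (proj₂ W⁻¹))) (*-identityʳ ε₀) ⟩
      ε₀
        ≤⟨ proj₂ (proj₂ form-bound) η Nη≤ ⟩
      ‖ turánForm (f-coeffs m) (F-coeffs m) η ‖
        ≡⟨ cong ‖_‖ (turánForm-turán m z η π η-eq π-eq) ⟩
      ‖ (Π ⊛ Π) ⊛ ((ι q ⊛ ι q) ⊛ turán-eval m z) ‖
        ≤⟨ ‖⊛‖≤′ (Π ⊛ Π) ((ι q ⊛ ι q) ⊛ turán-eval m z) (‖⊛‖≤′ Π Π Π≤ Π≤)
             (‖⊛‖≤′ (ι q ⊛ ι q) (turán-eval m z) (‖⊛‖≤′ (ι q) (ι q) ιq≤ ιq≤) ≤-refl) ⟩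
      q * q * (q * q * ‖ turán-eval m z ‖)
        ≡⟨ *-assoc (q * q) (q * q) (‖ turán-eval m z ‖) ⟨
      W * ‖ turán-eval m z ‖ ∎)
      where
      open ≤-Reasoning
      p : ℂℚ
      p = 1ᴷ ⊕ z
      N = norm² p
      0≤x : 0ℚ ≤ x
      0≤x = ≤-trans (<⇒≤ 0<r) r≤x
      p₁≥1 : 1ℚ ≤ 1ℚ + x
      p₁≥1 = ≤-by x 0≤x refl
      0<N : 0ℚ < N
      0<N = 0<-+ˡ (0<-* (<-≤-trans 0<1 p₁≥1) (<-≤-trans 0<1 p₁≥1)) (0≤-square (0ℚ + y))
      N⁻¹ = reciprocal N 0<N
      i = proj₁ N⁻¹
      0<i = proj₁ (proj₂ N⁻¹)
      Ni≡1 = proj₂ (proj₂ N⁻¹)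
      π η Π : ℂℚ
      π = (1ℚ + x) * i , - (0ℚ + y) * i
      η = (z ⊖ 1ᴷ) ⊛ π
      Π = power π (suc m)
      π-eq : p ⊛ π ≡ 1ᴷ
      π-eq = cong₂ _,_
        (trans (solve 3 (λ a b i → proj₁ ((a , b) :⊛ (a :* i , (:- b) :* i)) := (a :* a :+ b :* b) :* i)
          refl (1ℚ + x) (0ℚ + y) i) Ni≡1)
        (solve 3 (λ a b i → proj₂ ((a , b) :⊛ (a :* i , (:- b) :* i)) := con 0ℚ) refl (1ℚ + x) (0ℚ + y) i)
      η-eq : p ⊛ η ≡ z ⊖ 1ᴷ
      η-eq = trans (swap p (z ⊖ 1ᴷ) π) (trans (cong ((z ⊖ 1ᴷ) ⊛_) π-eq) (⊛-identityʳ (z ⊖ 1ᴷ)))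
      π≤2 : ‖ π ‖ ≤ 2ℚ
      π≤2 = +-mono-≤ (scaled (1ℚ + x) p₁≤N) (scaled (- (0ℚ + y)) p₂≤N)
        where
        scaled : ∀ a → ∣ a ∣ ≤ N → ∣ a * i ∣ ≤ 1ℚ
        scaled a a≤N = begin
          ∣ a * i ∣  ≡⟨ ∣p*q∣≡∣p∣*∣q∣ a i ⟩
          ∣ a ∣ * ∣ i ∣  ≡⟨ cong (∣ a ∣ *_) (0≤p⇒∣p∣≡p (<⇒≤ 0<i)) ⟩
          ∣ a ∣ * i  ≤⟨ *-mono-≤ (0≤∣p∣ a) a≤N (<⇒≤ 0<i) ≤-refl ⟩
          N * i  ≡⟨ Ni≡1 ⟩
          1ℚ  ∎
        ¾ = ½ + ½ * ½
        a = 1ℚ + x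
        b = 0ℚ + y
        p₁≤N : ∣ a ∣ ≤ N
        p₁≤N = subst (_≤ N) (sym (0≤p⇒∣p∣≡p (≤-trans 0≤1 p₁≥1)))
          (≤-by (x * (1ℚ + x) + b * b) (0≤-+ (0≤-* 0≤x (≤-trans 0≤1 p₁≥1)) (0≤-square b))
            (solve 2 (λ x b → con 1ℚ :+ x :+ (x :* (con 1ℚ :+ x) :+ b)
              := (con 1ℚ :+ x) :* (con 1ℚ :+ x) :+ b) refl x (b * b)))
        -- Completing the square: 1 + c² - c = (c - ½)² + ¾.
        ±b≤N : ∀ c → c * c ≡ b * b → c ≤ N
        ±b≤N c c²≡b² = ≤-by ((c - ½) * (c - ½) + (¾ + (2ℚ * x + x * x)))
          (0≤-+ (0≤-square (c - ½)) (0≤-+ (<⇒≤ (positive⁻¹ ¾)) (0≤-+ (0≤-* 0≤2 0≤x) (0≤-square x))))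
          (trans (solve 2 (λ c x → c :+ ((c :- con ½) :* (c :- con ½)
              :+ (con ¾ :+ (con 2ℚ :* x :+ x :* x)))
            := (con 1ℚ :+ x) :* (con 1ℚ :+ x) :+ c :* c) refl c x)
            (cong (λ u → (1ℚ + x) * (1ℚ + x) + u) c²≡b²))
        p₂≤N : ∣ - b ∣ ≤ N
        p₂≤N = ∣∣≤-intro (±b≤N (- b) (neg² b)) (±b≤N (- - b) (trans (neg² (- b)) (neg² b)))
          where
          neg² : ∀ c → - c * - c ≡ c * c
          neg² = solve 1 (λ c → (:- c) :* (:- c) := c :* c) refl
      Π≤ : ‖ Π ‖ ≤ q
      Π≤ = ‖power‖≤ π π≤2 (suc m)
      ιq≤ : ‖ ι q ‖ ≤ q
      ιq≤ = ≤-reflexive (trans (‖ι‖≡ q) (0≤p⇒∣p∣≡p (<⇒≤ (0<2^ (suc m)))))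
      sq≤ : ∀ a {b} → ∣ a ∣ ≤ b → a * a ≤ b * b
      sq≤ a {b} a≤b = subst (_≤ b * b) (trans (sym (∣p*q∣≡∣p∣*∣q∣ a a)) (0≤p⇒∣p∣≡p (0≤-square a)))
        (*-mono-≤ (0≤∣p∣ a) a≤b (0≤∣p∣ a) a≤b)
      N≤D : N ≤ D
      N≤D = ≤-trans (+-mono-≤
          (sq≤ (1ℚ + x) (≤-trans (∣p+q∣≤∣p∣+∣q∣ 1ℚ x) (+-monoʳ-≤ 1ℚ x≤B)))
          (sq≤ (0ℚ + y) (subst (λ u → ∣ u ∣ ≤ B) (sym (+-identityˡ y)) y≤B)))
        (≤-by (2ℚ * r) (<⇒≤ 0<2r) refl)
      Nη≤ : norm² η ≤ 1ℚ - 2ℚ * h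
      Nη≤ = *-cancelˡ-≤ N 0<N (begin
        N * norm² η
          ≡⟨ trans (sym (norm²-⊛ p η)) (cong norm² η-eq) ⟩
        norm² (z ⊖ 1ᴷ)
          ≤⟨ ≤-by (2ℚ * (2ℚ * (x - r)) + 2ℚ * (h * (D - N)))
               (0≤-+ (0≤-* 0≤2 (0≤-* 0≤2 (≤⇒0≤- r≤x))) (0≤-* 0≤2 (0≤-* (<⇒≤ 0<h) (≤⇒0≤- N≤D))))
               (trans (cong (λ u → norm² (z ⊖ 1ᴷ) + (2ℚ * (2ℚ * (x - r)) + u))
                   (trans (solve 3 (λ h d n → con 2ℚ :* (h :* (d :- n)) := con 2ℚ :* (h :* d) :- con 2ℚ :* h :* n) refl h D N)
                     (cong (λ u → 2ℚ * u - 2ℚ * h * N) hD≡)))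
                 (solve 4 (λ x y r h → let
                     a = con 1ℚ :+ x ; b = con 0ℚ :+ y ; n = a :* a :+ b :* b
                     a′ = x :+ con (- 1ℚ) ; b′ = y :+ con (- 0ℚ) in
                   a′ :* a′ :+ b′ :* b′ :+ (con 2ℚ :* (con 2ℚ :* (x :- r))
                     :+ (con 2ℚ :* (con 2ℚ :* r) :- con 2ℚ :* h :* n))
                   := n :* (con 1ℚ :- con 2ℚ :* h)) refl x y r h)) ⟩
        N * (1ℚ - 2ℚ * h) ∎)

  -- Evaluation of integer polynomials

  module _ (A : ℚ-Algebra) where
    open ℚ-Algebra A using (Carrier; module Solver; ι-+; ι-*; ι-neg)
      renaming (ι to ιᴬ; _+_ to _+ᴬ_; _*_ to _*ᴬ_; _-_ to _-ᴬ_; -_ to -ᴬ_)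
    open Solver
    open ℤ[x] using (_⊗_) renaming (_⊕_ to _⊞_; _⊖_ to _⊟_)

    evalℤ : List ℤ → Carrier → Carrier
    evalℤ []      x = ιᴬ 0ℚ
    evalℤ (a ∷ p) x = ιᴬ (a / 1) +ᴬ x *ᴬ evalℤ p x

    evalℤ-⊞ : ∀ p q x → evalℤ (p ⊞ q) x ≡ evalℤ p x +ᴬ evalℤ q x
    evalℤ-⊞ []      q       x = solve 1 (λ v → v := con 0ℚ :+ v) refl (evalℤ q x)
    evalℤ-⊞ (a ∷ p) []      x = solve 1 (λ v → v := v :+ con 0ℚ) refl (evalℤ (a ∷ p) x)
    evalℤ-⊞ (a ∷ p) (b ∷ q) x = trans
      (cong₂ (λ u v → u +ᴬ x *ᴬ v) (trans (cong ιᴬ (/1-+ a b)) (ι-+ (a / 1) (b / 1))) (evalℤ-⊞ p q x))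
      (solve 5 (λ a b x u v → a :+ b :+ x :* (u :+ v) := a :+ x :* u :+ (b :+ x :* v)) refl
        (ιᴬ (a / 1)) (ιᴬ (b / 1)) x (evalℤ p x) (evalℤ q x))

    evalℤ-neg : ∀ p x → evalℤ (map (ℤ.-_) p) x ≡ -ᴬ evalℤ p x
    evalℤ-neg []      x = solve 0 (con 0ℚ := :- con 0ℚ) refl
    evalℤ-neg (a ∷ p) x = trans
      (cong₂ (λ u v → u +ᴬ x *ᴬ v) (trans (cong ιᴬ (/1-neg a)) (ι-neg (a / 1))) (evalℤ-neg p x))
      (solve 3 (λ a x v → :- a :+ x :* :- v := :- (a :+ x :* v)) refl (ιᴬ (a / 1)) x (evalℤ p x))

    evalℤ-scale : ∀ a p x → evalℤ (map (a ℤ.*_) p) x ≡ ιᴬ (a / 1) *ᴬ evalℤ p x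
    evalℤ-scale a []      x = solve 1 (λ a → con 0ℚ := a :* con 0ℚ) refl (ιᴬ (a / 1))
    evalℤ-scale a (b ∷ p) x = trans
      (cong₂ (λ u v → u +ᴬ x *ᴬ v) (trans (cong ιᴬ (/1-* a b)) (ι-* (a / 1) (b / 1))) (evalℤ-scale a p x))
      (solve 4 (λ a b x v → a :* b :+ x :* (a :* v) := a :* (b :+ x :* v)) refl (ιᴬ (a / 1)) (ιᴬ (b / 1)) x (evalℤ p x))

    evalℤ-⊗ : ∀ p q x → evalℤ (p ⊗ q) x ≡ evalℤ p x *ᴬ evalℤ q x
    evalℤ-⊗ []      q x = solve 1 (λ v → con 0ℚ := con 0ℚ :* v) refl (evalℤ q x)
    evalℤ-⊗ (a ∷ p) q x = trans (evalℤ-⊞ (map (a ℤ.*_) q) (ℤ.0ℤ ∷ (p ⊗ q)) x) (trans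
      (cong₂ (λ u v → u +ᴬ (ιᴬ 0ℚ +ᴬ x *ᴬ v)) (evalℤ-scale a q x) (evalℤ-⊗ p q x))
      (solve 4 (λ a x u v → a :* v :+ (con 0ℚ :+ x :* (u :* v)) := (a :+ x :* u) :* v) refl
        (ιᴬ (a / 1)) x (evalℤ p x) (evalℤ q x)))

    evalℤ-⊟ : ∀ p q x → evalℤ (p ⊟ q) x ≡ evalℤ p x -ᴬ evalℤ q x
    evalℤ-⊟ p q x = trans (evalℤ-⊞ p (map (ℤ.-_) q) x) (cong (evalℤ p x +ᴬ_) (evalℤ-neg q x))

    evalℤ-map : ∀ (a : ℕ → ℤ) g N x →
      evalℤ (map a (applyUpTo g N)) x ≡ Evaluation.horner A (λ k → a (g k) / 1) N x
    evalℤ-map a g zero    x = refl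
    evalℤ-map a g (suc N) x = cong (λ v → ιᴬ (a (g 0) / 1) +ᴬ x *ᴬ v) (evalℤ-map a (g ∘ suc) N x)

  evalℤ-turán : ∀ m z → evalℤ ℚ[i] (turán (suc m)) z ≡ turán-eval m z
  evalℤ-turán m z = trans
    (evalℤ-⊟ ℚ[i] (Rₙ (2 ℕ.+ m) ⊗ Rₙ (2 ℕ.+ m)) (Rₙ (3 ℕ.+ m) ⊗ Rₙ (suc m)) z)
    (cong₂ _⊖_
      (trans (evalℤ-⊗ ℚ[i] (Rₙ (2 ℕ.+ m)) (Rₙ (2 ℕ.+ m)) z) (cong₂ _⊛_ (value (suc m)) (value (suc m))))
      (trans (evalℤ-⊗ ℚ[i] (Rₙ (3 ℕ.+ m)) (Rₙ (suc m)) z) (cong₂ _⊛_ (value (2 ℕ.+ m)) (value m))))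
    where
    open ℤ[x] using (_⊗_)
    value : ∀ m → evalℤ ℚ[i] (Rₙ (suc m)) z ≡ R-eval m z
    value m = evalℤ-map ℚ[i] (R (suc m)) id (suc m) z

  -- Passage to real and complex numbers

  approximation : ℂ → ℕ → ℂℚ
  approximation z k = seq (re z) k , seq (im z) k

  -- Real and complex operations act termwise on the Cauchy sequences, so no limit is involved; the
  -- two multiplications differ only in writing -u as -1 · u.
  approximation-eval : ∀ p z k →
    approximation (ℂ[x].eval (toℂ[x] p) z) k ≡ evalℤ ℚ[i] p (approximation z k)
  approximation-eval []      z k = refl
  approximation-eval (a ∷ p) z k = trans
    (cong (λ v → a / 1 + (x * proj₁ v + - (y * proj₂ v)) , 0ℚ + (x * proj₂ v + y * proj₁ v)) (approximation-eval p z k))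
    (cong (λ u → a / 1 + (x * proj₁ v + u) , 0ℚ + (x * proj₂ v + y * proj₁ v))
      (Q.solve 1 (λ u → Q.:- u Q.:= Q.con (- 1ℚ) Q.:* u) refl (y * proj₂ v)))
    where
    x = seq (re z) k
    y = seq (im z) k
    v = evalℤ ℚ[i] p (approximation z k)

  -- A zero would push the values at late approximations below any ε in the ℓ¹ norm. But
  -- `0ᴿ <ᴿ re z` provides a rational r below the real parts of all late approximations, and Cauchy
  -- sequences are bounded, so `bounded-below` applies to them with a fixed ε.
  turán-nonvanishing : ∀ m z → 0ᴿ <ᴿ re z → ¬ (ℂ[x].eval (toℂ[x] (turán (suc m))) z ≈ᶜ 0ᶜ)
  turán-nonvanishing m z (r , 0<r , N₀ , r≤) (re≈0 , im≈0) =
    let B₁ , 0<B₁ , N₁ , re≤ = eventually-bounded (re z)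
        B₂ , 0<B₂ , N₂ , im≤ = eventually-bounded (im z)
        ε , 0<ε , bound = bounded-below m r (B₁ + B₂) 0<r (0<-+ˡ 0<B₁ (<⇒≤ 0<B₂))
        N₃ , re-small = re≈0 (½ * ε) (0<-* (positive⁻¹ ½) 0<ε)
        N₄ , im-small = im≈0 (½ * ε) (0<-* (positive⁻¹ ½) 0<ε)
        k = N₀ ℕ.+ (N₁ ℕ.+ (N₂ ℕ.+ (N₃ ℕ.+ N₄)))
        k≥N₀ = ℕ.m≤m+n N₀ (N₁ ℕ.+ (N₂ ℕ.+ (N₃ ℕ.+ N₄)))
        k₁ = ℕ.m≤n+m (N₁ ℕ.+ (N₂ ℕ.+ (N₃ ℕ.+ N₄))) N₀
        k≥N₁ = ℕ.m+n≤o⇒m≤o N₁ k₁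
        k₂ = ℕ.m+n≤o⇒n≤o N₁ k₁
        k≥N₂ = ℕ.m+n≤o⇒m≤o N₂ k₂
        k₃ = ℕ.m+n≤o⇒n≤o N₂ k₂
        k≥N₃ = ℕ.m+n≤o⇒m≤o N₃ k₃
        k≥N₄ = ℕ.m+n≤o⇒n≤o N₃ k₃
        value = trans (approximation-eval (turán (suc m)) z k) (evalℤ-turán m (approximation z k))
    in ≤⇒≯
      (bound (approximation z k)
        (subst (_≤ seq (re z) k) (+-identityˡ r) (r≤ k k≥N₀))
        (≤-trans (<⇒≤ (re≤ k k≥N₁)) (≤-by B₂ (<⇒≤ 0<B₂) refl))
        (≤-trans (<⇒≤ (im≤ k k≥N₂)) (≤-by B₁ (<⇒≤ 0<B₁) (+-comm B₂ B₁))))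
      (subst (_< ε) (cong ‖_‖ value)
        (subst (‖ approximation (ℂ[x].eval (toℂ[x] (turán (suc m))) z) k ‖ <_)
          (Q.solve 1 (λ e → Q.con ½ Q.:* e Q.:+ Q.con ½ Q.:* e Q.:= e) refl ε)
          (+-mono-<
            (subst (λ u → ∣ u ∣ < ½ * ε) (+-identityʳ (seq (re (ℂ[x].eval (toℂ[x] (turán (suc m))) z)) k)) (re-small k k≥N₃))
            (subst (λ u → ∣ u ∣ < ½ * ε) (+-identityʳ (seq (im (ℂ[x].eval (toℂ[x] (turán (suc m))) z)) k)) (im-small k k≥N₄)))))

open import Data.Nat.Base using (ℕ; _≤_)

proposition3p8 : ∀ (n : ℕ) → 1 ≤ n → HurwitzStable (toℂ[x] (turán n))
-- Here n = m + 1, as `ρ m` belongs to R_{m+1}. Nonvanishing holds for every such n, so the second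
-- alternative is always the one that applies.
proposition3p8 (suc m) _ = inj₂ (Transfer.turán-nonvanishing m)
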